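{- Let $q=p^h$, $p$ prime, $h\ge1$, $n\ge2$, $1\le k\le n-1$. (1) If $k\ge n/2$ and $p>7$, then the only possible codewords of $C_k(n,q)$ with weight in the open interval $]\theta_k,(12\theta_k+6)/7[$ are scalar multiples of incidence vectors of non-linear blocking sets (minimal $k$-blocking sets that are not linear). (2) The minimum weight of $C_k(n,q)$ is $\theta_k$, and a codeword of weight $\theta_k$ is a scalar multiple of the incidence vector of a $k$-dimensional subspace.
   Context: $\theta_k=(q^{k+1}-1)/(q-1)$. $C_k(n,q)$ is the $p$-ary linear code spanned over $\mathbb{F}_p$ by the rows of the incidence matrix of $k$-dimensional subspaces versus points of $PG(n,q)$ (entry $1$ iff the point lies in the subspace). A $k$-blocking set meets every $(n-k)$-dimensional subspace. A linear $k$-blocking set is a set $\mathcal{B}(U)$ where $U$ is an $hk$-dimensional subspace of $PG(h(n+1)-1,p)$ and $\mathcal{B}(U)$ consists of the points of $PG(n,p^h)$ whose corresponding elements of the Desarguesian $(h-1)$-spread (obtained by field reduction $\mathbb{F}_{p^h}^{n+1}\cong\mathbb{F}_p^{h(n+1)}$) meet $U$. -}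

module Defs where

open import Level using (0ℓ)
open import Data.Nat as ℕ using (ℕ; zero; suc; _^_)
open import Data.Product using (Σ; ∃; _×_; _,_; proj₁; proj₂)
open import Data.Sum using (_⊎_)
open import Data.Empty using (⊥)
open import Data.List using (List; []; _∷_; length; filter; concatMap; map)
open import Data.List.Membership.Propositional using (_∈_)
open import Data.List.Relation.Unary.All using (All)
open import Data.List.Relation.Unary.Unique.Propositional using (Unique)
open import Data.Vec using (Vec; []; _∷_; zipWith; replicate)
import Data.Vec.Relation.Unary.All as VAll
import Data.Vec as V
open import Data.Fin using (Fin)
open import Relation.Nullary using (¬_; Dec; yes; no)
open import Relation.Nullary.Decidable using (¬?; _⊎-dec_; _×-dec_)
open import Relation.Binary.PropositionalEquality using (_≡_)
open import Relation.Binary.Definitions using (DecidableEquality)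
open import Algebra.Structures using (IsCommutativeRing)

record FiniteField (q : ℕ) : Set₁ where
  infixl 6 _+_
  infixl 7 _*_
  field
    Carrier : Set
    _+_ _*_ : Carrier → Carrier → Carrier
    -_      : Carrier → Carrier
    0# 1#   : Carrier
    isCommutativeRing : IsCommutativeRing _≡_ _+_ _*_ -_ 0# 1#
    1≢0     : ¬ (1# ≡ 0#)
    inverse : ∀ x → ¬ (x ≡ 0#) → Σ Carrier λ y → x * y ≡ 1#
    _≟_     : DecidableEquality Carrier
    elements : List Carrier
    complete : ∀ x → x ∈ elements
    distinct : Unique elements
    card     : length elements ≡ q

-- θ_k = (q^{k+1}-1)/(q-1) = 1 + q + ... + q^k

θ : ℕ → ℕ → ℕ
θ q zero    = 1
θ q (suc k) = θ q k ℕ.+ q ^ suc k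

module Geometry {q : ℕ} (F : FiniteField q) where
  open FiniteField F

  -- ambient vector space F^{n+1}; a point of PG(n,q) is represented by its
  -- unique normalized representative (first nonzero coordinate equals 1).
  Vect : ℕ → Set
  Vect n = Vec Carrier (suc n)

  Normalized : ∀ {m} → Vec Carrier m → Set
  Normalized []       = ⊥
  Normalized (x ∷ xs) = (x ≡ 1#) ⊎ ((x ≡ 0#) × Normalized xs)

  normalized? : ∀ {m} (v : Vec Carrier m) → Dec (Normalized v)
  normalized? []       = no λ ()
  normalized? (x ∷ xs) = (x ≟ 1#) ⊎-dec ((x ≟ 0#) ×-dec normalized? xs)

  allVecs : (m : ℕ) → List (Vec Carrier m)
  allVecs zero    = [] ∷ []
  allVecs (suc m) = concatMap (λ x → map (x ∷_) (allVecs m)) elements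

  points : (n : ℕ) → List (Vect n)
  points n = filter normalized? (allVecs (suc n))

  _·_ : ∀ {m} → Carrier → Vec Carrier m → Vec Carrier m
  a · v = V.map (a *_) v

  _⊕_ : ∀ {m} → Vec Carrier m → Vec Carrier m → Vec Carrier m
  _⊕_ = zipWith _+_

  lincomb : ∀ {m r} → Vec Carrier r → Vec (Vec Carrier m) r → Vec Carrier m
  lincomb []       []       = replicate _ 0#
  lincomb (a ∷ as) (v ∷ vs) = (a · v) ⊕ lincomb as vs

  zeroV : ∀ {m} → Vec Carrier m
  zeroV = replicate _ 0#

  record Subspace (n k : ℕ) : Set where
    field
      basis : Vec (Vect n) (suc k)
      independent : ∀ (a : Vec Carrier (suc k)) →
                    lincomb a basis ≡ zeroV → a ≡ replicate _ 0#

  _∈S_ : ∀ {n k} → Vect n → Subspace n k → Set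
  v ∈S S = Σ (Vec Carrier _) λ a → v ≡ lincomb a (Subspace.basis S)

  ι : ℕ → Carrier
  ι zero    = 0#
  ι (suc m) = 1# + ι m

  InFp : Carrier → Set
  InFp x = Σ ℕ λ m → x ≡ ι m

  -- words: functions on F^{n+1}, only their values at the normalized
  -- representatives (i.e. at the points of PG(n,q)) matter.
  Word : ℕ → Set
  Word n = Vect n → Carrier

  data IncSum {n k : ℕ} (v : Vect n) : List (Carrier × Subspace n k) → Carrier → Set where
    nil : IncSum v [] 0#
    inc : ∀ {a S l r} → v ∈S S → IncSum v l r → IncSum v ((a , S) ∷ l) (a + r)
    exc : ∀ {a S l r} → ¬ (v ∈S S) → IncSum v l r → IncSum v ((a , S) ∷ l) r

  Codeword : (n k : ℕ) → Word n → Set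
  Codeword n k c = Σ (List (Carrier × Subspace n k)) λ l →
    All (λ x → InFp (proj₁ x)) l × (∀ v → Normalized v → IncSum v l (c v))

  weight : ∀ {n} → Word n → ℕ
  weight {n} c = length (filter (λ v → ¬? (c v ≟ 0#)) (points n))

  PointSet : ℕ → Set₁
  PointSet n = Vect n → Set

  ScalarMultipleOfIncidence : ∀ {n} → Word n → PointSet n → Set
  ScalarMultipleOfIncidence {n} c B = Σ Carrier λ λ′ → InFp λ′ × ¬ (λ′ ≡ 0#) ×
    (∀ v → Normalized v → (B v → c v ≡ λ′) × (¬ B v → c v ≡ 0#))

  IsBlockingSet : (n k : ℕ) → PointSet n → Set
  IsBlockingSet n k B = ∀ (S : Subspace n (n ℕ.∸ k)) →
    Σ (Vect n) λ v → Normalized v × B v × v ∈S S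

  _⊆P_ : ∀ {n} → PointSet n → PointSet n → Set
  _⊆P_ {n} A B = ∀ v → Normalized v → A v → B v

  IsMinimalBlockingSet : (n k : ℕ) → PointSet n → Set₁
  IsMinimalBlockingSet n k B = IsBlockingSet n k B ×
    (∀ (B′ : PointSet n) → B′ ⊆P B → IsBlockingSet n k B′ → B ⊆P B′)

  -- F_p-subspace U of F^{n+1} ≅ F_p^{h(n+1)} of projective dimension r,
  -- i.e. spanned by r+1 F_p-linearly independent vectors.
  record FpSubspace (n r : ℕ) : Set where
    field
      basis : Vec (Vect n) (suc r)
      independent : ∀ (a : Vec Carrier (suc r)) → VAll.All InFp a →
                    lincomb a basis ≡ zeroV → a ≡ replicate _ 0#

  _∈U_ : ∀ {n r} → Vect n → FpSubspace n r → Set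
  v ∈U U = Σ (Vec Carrier _) λ a → VAll.All InFp a × v ≡ lincomb a (FpSubspace.basis U)

  -- B(U): points ⟨v⟩ whose spread element {λv : λ ∈ F} meets U nontrivially
  BU : ∀ {n r} → FpSubspace n r → PointSet n
  BU U v = Σ Carrier λ λ′ → ¬ (λ′ ≡ 0#) × (λ′ · v) ∈U U

  IsLinearBlockingSet : (h n k : ℕ) → PointSet n → Set
  IsLinearBlockingSet h n k B = IsBlockingSet n k B ×
    Σ (FpSubspace n (h ℕ.* k)) λ U →
      ∀ v → Normalized v → (B v → BU U v) × (BU U v → B v)

{-# OPTIONS --safe #-}

-- A codeword is extended to a homogeneous function g on F^{n+1} whose value a at 0 is the sum of its
-- coefficients. Since the kernel of an additive map from a group of order q^{n+1} has p-power order,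
-- the sum of g over a translate of the span of n - k vectors over F, or of h(n - k) vectors over 𝔽ₚ,
-- does not depend on the translate. Summing along the lines through a point projects to PG(n-1,q),
-- preserves this property and does not increase the weight. Projecting until k = n gives the minimum
-- weight; for a word of weight θ_k the support is moreover closed under addition.
--
-- If the weight is less than (12θ_k+6)/7, project from points on tangents until n = k + 1. Then all
-- line sums are a. Given a value b ≠ a at R, some line through R contains exactly one further point P
-- of the support. If a = 0, this contradicts the Bagchi-Inamdar bound. If a ≠ 0, no point of RP has
-- value a, so every line in an affine plane with RP at infinity is blocked, and for a suitable plane
-- this contradicts Jamison's theorem. So g is a times the indicator of its support, which has a tangent
-- (n-k)-space at each of its points because the sums over such spaces are 1 modulo p.
--
-- If h(n - k) ≥ 2, the sums over 𝔽ₚ-spans force the support to be a subspace, which is impossible for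
-- weights strictly between θ_k and 2θ_k; if h = 1, linear blocking sets are subspaces.
module Submission where

open import Defs
open import Algebra.Bundles using (CommutativeRing)
import Algebra.Properties.Ring
import Algebra.Solver.Ring.NaturalCoefficients.Default
open import Algebra.Structures using (IsCommutativeRing; IsCommutativeSemiring)
open import Data.Empty using (⊥; ⊥-elim)
open import Data.Fin using (toℕ; fromℕ<)
import Data.Fin.Properties as Fin
open import Data.List
  using (List; []; _∷_; _++_; length; filter; concatMap; map; tabulate; cartesianProduct; cartesianProductWith)
import Data.List.Properties as List
open import Data.List.Membership.Propositional using (_∈_; lose; find)
open import Data.List.Membership.Propositional.Properties
  using (∈-cartesianProductWith⁺; ∈-cartesianProduct⁺; ∈-tabulate⁺; ∈-tabulate⁻; ∈-filter⁺; ∈-filter⁻)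
open import Data.List.Relation.Unary.All as All using (All)
open import Data.List.Relation.Unary.AllPairs using ([]; _∷_)
open import Data.List.Relation.Unary.Any using (here; there; any?)
open import Data.List.Relation.Unary.Unique.Propositional using (Unique)
import Data.List.Relation.Unary.Unique.Propositional.Properties as Unique
open import Data.Nat as ℕ using (ℕ; zero; suc; _≤_; _<_; z≤n; s≤s; _^_; NonZero)
open import Data.Nat.Coprimality using (Coprime; coprime-Bézout; coprime-divisor)
open import Data.Nat.Divisibility as ∣ using (_∣_; divides)
open import Data.Nat.DivMod using (_%_; _/_; m%n<n; m≡m%n+[m/n]*n)
open import Data.Nat.GCD using (module Bézout)
open import Data.Nat.Primality using (Prime; prime⇒irreducible; prime⇒nonZero; prime⇒nonTrivial)
import Data.Nat.Properties as ℕ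
open import Data.Nat.Tactic.RingSolver using (solve-∀)
open import Data.Product using (Σ; ∃; ∃₂; _×_; _,_; proj₁; proj₂)
open import Data.Sum as Sum using (_⊎_; inj₁; inj₂)
open import Data.Unit using (⊤; tt)
open import Data.Vec as Vec using (Vec; []; _∷_; replicate)
import Data.Vec.Properties as Vec
open import Data.Vec.Relation.Unary.All as VAll using ([]; _∷_)
open import Function using (_∘_; id; case_of_)
open import Relation.Binary.Definitions using (DecidableEquality)
open import Relation.Binary.PropositionalEquality
open import Relation.Nullary using (¬_; Dec; yes; no)
open import Relation.Nullary.Decidable using (map′; ¬?; _×-dec_; _⊎-dec_; decidable-stable)
open import Relation.Unary using (Pred; Decidable)


-- The ratio 12/7 is 2(p - 1)/p at p = 7. When a = 0, the residues modulo p of the word and of its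
-- negative give p w ≥ 2((p - 1)θ_k + 1) for the weight w, which for p > 7 exceeds what the
-- hypothesis allows. The same hypothesis says that an average line through a point of the support
-- contains fewer than 2 further points, and that an average affine plane at a line with two support
-- points contains fewer than 2(q - 1).
--
-- Giving 0 a value makes linear and affine sums uniform: the multiples of Q contribute a + (q - 1)
-- g Q = a - g Q. So if all parallel affine lines have equal sums, every projective line has sum a,
-- and a itself survives projection from a point outside the support.
--
-- Summation is developed over an arbitrary commutative semiring because each projection is used
-- twice: over F it adds up values, over ℕ it counts support, and the support of the first is
-- bounded by the second.

-- Finite sums over a commutative semiring

module Summation {R : Set} {_+_ _*_ : R → R → R} {0# 1# : R}
    (isCommutativeSemiring : IsCommutativeSemiring _≡_ _+_ _*_ 0# 1#) where

  open IsCommutativeSemiring isCommutativeSemiring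
    using (+-assoc; +-comm; +-identityˡ; +-identityʳ; *-assoc; *-comm; *-identityˡ; *-identityʳ;
           distribˡ; distribʳ; zeroˡ; zeroʳ)
  open ≡-Reasoning

  private variable
    A B C P Q : Set

  ∑ : List A → (A → R) → R
  ∑ []       f = 0#
  ∑ (x ∷ xs) f = f x + ∑ xs f

  δ : Dec P → R
  δ (yes _) = 1#
  δ (no _)  = 0#

  δ-yes : (d : Dec P) → P → δ d ≡ 1#
  δ-yes (yes _) _ = refl
  δ-yes (no ¬p) p = ⊥-elim (¬p p)

  δ-no : (d : Dec P) → ¬ P → δ d ≡ 0#
  δ-no (yes p) ¬p = ⊥-elim (¬p p)
  δ-no (no _)  _  = refl

  δ-cong : (d : Dec P) (e : Dec Q) → (P → Q) → (Q → P) → δ d ≡ δ e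
  δ-cong (yes p) e to from = sym (δ-yes e (to p))
  δ-cong (no ¬p) e to from = sym (δ-no e (¬p ∘ from))

  ∑-cong∈ : ∀ (xs : List A) {f g : A → R} → (∀ {x} → x ∈ xs → f x ≡ g x) → ∑ xs f ≡ ∑ xs g
  ∑-cong∈ []       f≗g = refl
  ∑-cong∈ (x ∷ xs) f≗g = cong₂ _+_ (f≗g (here refl)) (∑-cong∈ xs (f≗g ∘ there))

  ∑-cong : ∀ (xs : List A) {f g : A → R} → (∀ x → f x ≡ g x) → ∑ xs f ≡ ∑ xs g
  ∑-cong xs f≗g = ∑-cong∈ xs (λ {x} _ → f≗g x)

  ∑-zero : ∀ (xs : List A) → ∑ xs (λ _ → 0#) ≡ 0#
  ∑-zero []       = refl
  ∑-zero (x ∷ xs) = trans (+-identityˡ _) (∑-zero xs)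

  ∑-+ : ∀ (xs : List A) (f g : A → R) → ∑ xs (λ x → f x + g x) ≡ ∑ xs f + ∑ xs g
  ∑-+ []       f g = sym (+-identityˡ _)
  ∑-+ (x ∷ xs) f g = begin
    (f x + g x) + ∑ xs (λ y → f y + g y) ≡⟨ cong ((f x + g x) +_) (∑-+ xs f g) ⟩
    (f x + g x) + (∑ xs f + ∑ xs g)      ≡⟨ +-assoc _ _ _ ⟩
    f x + (g x + (∑ xs f + ∑ xs g))      ≡⟨ cong (f x +_) (+-assoc _ _ _) ⟨
    f x + ((g x + ∑ xs f) + ∑ xs g)      ≡⟨ cong (λ z → f x + (z + ∑ xs g)) (+-comm _ _) ⟩
    f x + ((∑ xs f + g x) + ∑ xs g)      ≡⟨ cong (f x +_) (+-assoc _ _ _) ⟩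
    f x + (∑ xs f + (g x + ∑ xs g))      ≡⟨ +-assoc _ _ _ ⟨
    (f x + ∑ xs f) + (g x + ∑ xs g)      ∎

  ∑-*ˡ : ∀ (xs : List A) a (f : A → R) → ∑ xs (λ x → a * f x) ≡ a * ∑ xs f
  ∑-*ˡ []       a f = sym (zeroʳ a)
  ∑-*ˡ (x ∷ xs) a f = trans (cong ((a * f x) +_) (∑-*ˡ xs a f)) (sym (distribˡ a _ _))

  ∑-*ʳ : ∀ (xs : List A) a (f : A → R) → ∑ xs (λ x → f x * a) ≡ ∑ xs f * a
  ∑-*ʳ xs a f = trans (∑-cong xs (λ x → *-comm (f x) a)) (trans (∑-*ˡ xs a f) (*-comm a _))

  ∑-swap : ∀ (xs : List A) (ys : List B) (f : A → B → R) →
           ∑ xs (λ x → ∑ ys (λ y → f x y)) ≡ ∑ ys (λ y → ∑ xs (λ x → f x y))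
  ∑-swap []       ys f = sym (∑-zero ys)
  ∑-swap (x ∷ xs) ys f =
    trans (cong (∑ ys (f x) +_) (∑-swap xs ys f)) (sym (∑-+ ys (f x) _))

  ∑-++ : ∀ (xs ys : List A) (f : A → R) → ∑ (xs ++ ys) f ≡ ∑ xs f + ∑ ys f
  ∑-++ []       ys f = sym (+-identityˡ _)
  ∑-++ (x ∷ xs) ys f = trans (cong (f x +_) (∑-++ xs ys f)) (sym (+-assoc _ _ _))

  ∑-map : ∀ (k : A → B) xs (f : B → R) → ∑ (map k xs) f ≡ ∑ xs (f ∘ k)
  ∑-map k []       f = refl
  ∑-map k (x ∷ xs) f = cong (f (k x) +_) (∑-map k xs f)

  ∑-concatMap : ∀ (k : A → List B) xs (f : B → R) → ∑ (concatMap k xs) f ≡ ∑ xs (λ x → ∑ (k x) f)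
  ∑-concatMap k []       f = refl
  ∑-concatMap k (x ∷ xs) f =
    trans (∑-++ (k x) _ f) (cong (∑ (k x) f +_) (∑-concatMap k xs f))

  ∑-filter : ∀ {ℓ} {P : Pred A ℓ} (P? : Decidable P) (xs : List A) {k : A → R} →
             (∀ x → P x → k x ≡ 1#) → (∀ x → ¬ P x → k x ≡ 0#) → ∀ (f : A → R) →
             ∑ (filter P? xs) f ≡ ∑ xs (λ x → k x * f x)
  ∑-filter P? []       k1 k0 f = refl
  ∑-filter P? (x ∷ xs) {k} k1 k0 f with P? x
  ... | yes p = cong₂ _+_ (sym (trans (cong (_* f x) (k1 x p)) (*-identityˡ _))) (∑-filter P? xs k1 k0 f)
  ... | no ¬p = trans (∑-filter P? xs k1 k0 f) (sym (trans
      (cong (_+ ∑ xs (λ y → k y * f y)) (trans (cong (_* f x) (k0 x ¬p)) (zeroˡ _))) (+-identityˡ _)))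

  module _ (_≟_ : DecidableEquality A) where

    ∑-δ-∉ : ∀ (xs : List A) y → All (λ x → ¬ (y ≡ x)) xs → ∀ (f : A → R) →
            ∑ xs (λ x → δ (x ≟ y) * f x) ≡ 0#
    ∑-δ-∉ []       y _            f = refl
    ∑-δ-∉ (x ∷ xs) y (y≢x All.∷ n) f = trans
      (cong₂ _+_ (trans (cong (_* f x) (δ-no (x ≟ y) (y≢x ∘ sym))) (zeroˡ _)) (∑-δ-∉ xs y n f))
      (+-identityˡ _)

    ∑-δ : ∀ {xs : List A} → Unique xs → ∀ {y} → y ∈ xs → ∀ (f : A → R) →
          ∑ xs (λ x → δ (x ≟ y) * f x) ≡ f y
    ∑-δ {x ∷ xs} (n ∷ u) (here refl) f = trans
      (cong₂ _+_ (trans (cong (_* f x) (δ-yes (x ≟ x) refl)) (*-identityˡ _)) (∑-δ-∉ xs x n f))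
      (+-identityʳ _)
    ∑-δ {x ∷ xs} (n ∷ u) {y} (there y∈) f = trans
      (cong₂ _+_ (trans (cong (_* f x) (δ-no (x ≟ y) (All.lookup n y∈))) (zeroˡ _)) (∑-δ u y∈ f))
      (+-identityˡ _)

    ∑-δ1 : ∀ {xs : List A} → Unique xs → ∀ {y} → y ∈ xs → ∑ xs (λ x → δ (x ≟ y)) ≡ 1#
    ∑-δ1 {xs} u y∈ =
      trans (∑-cong xs (λ x → sym (*-identityʳ _))) (∑-δ u y∈ (λ _ → 1#))

    -- Each value `f (φ x)` is spread out by a Kronecker delta and the two sums are swapped, so no
    -- permutation of lists appears. The list may be a proper part of the type; later it is also the
    -- list of elements of a subfield.
    ∑-reindex : ∀ {xs : List A} → Unique xs → (φ ψ : A → A) →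
      (∀ {x} → x ∈ xs → φ x ∈ xs) → (∀ {x} → x ∈ xs → ψ x ∈ xs) →
      (∀ {x} → x ∈ xs → φ (ψ x) ≡ x) → (∀ {x} → x ∈ xs → ψ (φ x) ≡ x) →
      ∀ (f : A → R) → ∑ xs (f ∘ φ) ≡ ∑ xs f
    ∑-reindex {xs} u φ ψ φ∈ ψ∈ φψ ψφ f = begin
      ∑ xs (f ∘ φ)
        ≡⟨ ∑-cong∈ xs (λ x∈ → ∑-δ u (φ∈ x∈) f) ⟨
      ∑ xs (λ x → ∑ xs (λ z → δ (z ≟ φ x) * f z))
        ≡⟨ ∑-swap xs xs _ ⟩
      ∑ xs (λ z → ∑ xs (λ x → δ (z ≟ φ x) * f z))
        ≡⟨ ∑-cong∈ xs (λ {z} z∈ → trans (∑-*ʳ xs (f z) _) (trans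
             (cong (_* f z) (trans (∑-cong∈ xs (λ {x} x∈ → δ-cong (z ≟ φ x) (x ≟ ψ z)
               (λ { refl → sym (ψφ x∈) }) (λ { refl → sym (φψ z∈) }))) (∑-δ1 u (ψ∈ z∈))))
             (*-identityˡ _))) ⟩
      ∑ xs f ∎

  ∑-reindex₂ : (_≟ᴬ_ : DecidableEquality A) (_≟ᴮ_ : DecidableEquality B) (_≟ᶜ_ : DecidableEquality C) →
    ∀ {xs ys zs} → Unique xs → Unique ys → Unique zs →
    (∀ x → x ∈ xs) → (∀ y → y ∈ ys) → (∀ z → z ∈ zs) →
    (φ : B → C → A) (π : A → B) (τ : A → C) →
    (∀ x → φ (π x) (τ x) ≡ x) → (∀ y z → π (φ y z) ≡ y) → (∀ y z → τ (φ y z) ≡ z) →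
    ∀ (f : A → R) → ∑ xs f ≡ ∑ ys (λ y → ∑ zs (λ z → f (φ y z)))
  ∑-reindex₂ _≟ᴬ_ _≟ᴮ_ _≟ᶜ_ {xs} {ys} {zs} ux uy uz cx cy cz φ π τ φπτ πφ τφ f = sym (begin
    ∑ ys (λ y → ∑ zs (λ z → f (φ y z)))
      ≡⟨ ∑-cong ys (λ y → ∑-cong zs (λ z → ∑-δ _≟ᴬ_ ux (cx _) f)) ⟨
    ∑ ys (λ y → ∑ zs (λ z → ∑ xs (λ x → δ (x ≟ᴬ φ y z) * f x)))
      ≡⟨ ∑-cong ys (λ y → ∑-swap zs xs _) ⟩
    ∑ ys (λ y → ∑ xs (λ x → ∑ zs (λ z → δ (x ≟ᴬ φ y z) * f x)))
      ≡⟨ ∑-swap ys xs _ ⟩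
    ∑ xs (λ x → ∑ ys (λ y → ∑ zs (λ z → δ (x ≟ᴬ φ y z) * f x)))
      ≡⟨ ∑-cong xs inner ⟩
    ∑ xs f ∎)
    where
    split : ∀ x y z → δ (x ≟ᴬ φ y z) ≡ δ (z ≟ᶜ τ x) * δ (y ≟ᴮ π x)
    split x y z with y ≟ᴮ π x | z ≟ᶜ τ x
    ... | yes refl | yes refl = trans (δ-yes (x ≟ᴬ _) (sym (φπτ x))) (sym (*-identityˡ _))
    ... | yes _    | no z≢    = trans (δ-no (x ≟ᴬ _) (λ { refl → z≢ (sym (τφ y z)) })) (sym (zeroˡ _))
    ... | no y≢    | _        = trans (δ-no (x ≟ᴬ _) (λ { refl → y≢ (sym (πφ y z)) })) (sym (zeroʳ _))

    inner : ∀ x → ∑ ys (λ y → ∑ zs (λ z → δ (x ≟ᴬ φ y z) * f x)) ≡ f x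
    inner x = begin
      ∑ ys (λ y → ∑ zs (λ z → δ (x ≟ᴬ φ y z) * f x))
        ≡⟨ ∑-cong ys (λ y → trans (∑-cong zs (λ z → trans (cong (_* f x) (split x y z)) (*-assoc _ _ _)))
             (∑-δ _≟ᶜ_ uz (cz (τ x)) (λ _ → δ (y ≟ᴮ π x) * f x))) ⟩
      ∑ ys (λ y → δ (y ≟ᴮ π x) * f x)
        ≡⟨ ∑-δ _≟ᴮ_ uy (cy (π x)) (λ _ → f x) ⟩
      f x ∎

module N = Summation ℕ.+-*-isCommutativeSemiring

module _ {A : Set} where

  ∑-mono : ∀ (xs : List A) {f g : A → ℕ} → (∀ {x} → x ∈ xs → f x ≤ g x) → N.∑ xs f ≤ N.∑ xs g
  ∑-mono []       f≤g = z≤n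
  ∑-mono (x ∷ xs) f≤g = ℕ.+-mono-≤ (f≤g (here refl)) (∑-mono xs (f≤g ∘ there))

  ∑-<⇒∃ : ∀ (xs : List A) {f g : A → ℕ} → N.∑ xs f < N.∑ xs g → ∃ λ x → x ∈ xs × f x < g x
  ∑-<⇒∃ (x ∷ xs) {f} {g} lt with f x ℕ.<? g x
  ... | yes fx<gx = x , here refl , fx<gx
  ... | no  fx≮gx with ∑-<⇒∃ xs (ℕ.+-cancelˡ-< (g x) _ _ (ℕ.≤-<-trans (ℕ.+-monoˡ-≤ _ (ℕ.≮⇒≥ fx≮gx)) lt))
  ...   | y , y∈ , fy<gy = y , there y∈ , fy<gy

  ∑-const : ∀ (xs : List A) c → N.∑ xs (λ _ → c) ≡ length xs ℕ.* c
  ∑-const []       c = refl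
  ∑-const (x ∷ xs) c = cong (c ℕ.+_) (∑-const xs c)

  term≤∑ : ∀ {xs : List A} (f : A → ℕ) {x} → x ∈ xs → f x ≤ N.∑ xs f
  term≤∑ f (here refl) = ℕ.m≤m+n _ _
  term≤∑ f (there x∈)  = ℕ.≤-trans (term≤∑ f x∈) (ℕ.m≤n+m _ _)

  ∑≢0⇒∃ : ∀ (xs : List A) {f : A → ℕ} → 0 < N.∑ xs f → ∃ λ x → x ∈ xs × 0 < f x
  ∑≢0⇒∃ xs {f} pos = ∑-<⇒∃ xs {λ _ → 0} (subst (_< N.∑ xs f) (sym (N.∑-zero xs)) pos)

  -- All quantifiers of the proof range over finite sets; deciding them keeps the later arguments by
  -- contradiction constructive.
  ∃∈? : ∀ {P : A → Set} (xs : List A) → (∀ x → x ∈ xs) → (∀ x → Dec (P x)) → Dec (∃ P)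
  ∃∈? xs complete P? = map′ (λ a → let x , _ , px = find a in x , px)
                            (λ (x , px) → lose (complete x) px) (any? P? xs)

δ≤1 : ∀ {P : Set} (d : Dec P) → N.δ d ≤ 1
δ≤1 (yes _) = ℕ.≤-refl
δ≤1 (no _)  = z≤n

δ-pos : ∀ {P : Set} (d : Dec P) → 0 < N.δ d → P
δ-pos (yes p) _ = p

-- Linear algebra over a finite field

module Field {q : ℕ} (F : FiniteField q) where
  open FiniteField F public
  open Geometry F public
  open IsCommutativeRing isCommutativeRing public
    using (+-assoc; +-comm; +-identityˡ; +-identityʳ; *-assoc; *-comm; *-identityˡ; *-identityʳ;
           distribˡ; distribʳ; zeroˡ; zeroʳ; -‿inverseˡ; -‿inverseʳ)

  commutativeRing : CommutativeRing _ _
  commutativeRing = record { isCommutativeRing = isCommutativeRing }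

  open Algebra.Properties.Ring (CommutativeRing.ring commutativeRing) public
    using (-‿involutive; -‿distribˡ-*; -‿distribʳ-*; -1*x≈-x; +-cancelˡ; +-cancelʳ)
  module S = Summation (IsCommutativeRing.isCommutativeSemiring isCommutativeRing)
  module SemiringSolver = Algebra.Solver.Ring.NaturalCoefficients.Default (CommutativeRing.commutativeSemiring commutativeRing)

  private variable
    m r : ℕ

  inv : Carrier → Carrier
  inv x with x ≟ 0#
  ... | yes _  = 0#
  ... | no x≢0 = proj₁ (inverse x x≢0)

  *-inv : ∀ {x} → x ≢ 0# → x * inv x ≡ 1#
  *-inv {x} x≢0 with x ≟ 0#
  ... | yes x≡0 = ⊥-elim (x≢0 x≡0)
  ... | no x≢0′ = proj₂ (inverse x x≢0′)

  inv-* : ∀ {x} → x ≢ 0# → inv x * x ≡ 1#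
  inv-* x≢0 = trans (*-comm _ _) (*-inv x≢0)

  inv-0 : inv 0# ≡ 0#
  inv-0 with 0# ≟ 0#
  ... | yes _   = refl
  ... | no 0≢0 = ⊥-elim (0≢0 refl)

  *-cancelˡ : ∀ {x y z} → x ≢ 0# → x * y ≡ x * z → y ≡ z
  *-cancelˡ {x} {y} {z} x≢0 eq = begin
    y               ≡⟨ *-identityˡ y ⟨
    1# * y          ≡⟨ cong (_* y) (inv-* x≢0) ⟨
    inv x * x * y   ≡⟨ *-assoc _ _ _ ⟩
    inv x * (x * y) ≡⟨ cong (inv x *_) eq ⟩
    inv x * (x * z) ≡⟨ *-assoc _ _ _ ⟨
    inv x * x * z   ≡⟨ cong (_* z) (inv-* x≢0) ⟩
    1# * z          ≡⟨ *-identityˡ z ⟩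
    z               ∎ where open ≡-Reasoning

  *-≢0 : ∀ {x y} → x ≢ 0# → y ≢ 0# → x * y ≢ 0#
  *-≢0 x≢0 y≢0 xy≡0 = y≢0 (*-cancelˡ x≢0 (trans xy≡0 (sym (zeroʳ _))))

  inv-≢0 : ∀ {x} → x ≢ 0# → inv x ≢ 0#
  inv-≢0 {x} x≢0 eq = 1≢0 (trans (sym (*-inv x≢0)) (trans (cong (x *_) eq) (zeroʳ x)))

  inv-involutive : ∀ x → inv (inv x) ≡ x
  inv-involutive x = case x ≟ 0# of λ where
    (yes refl) → trans (cong inv inv-0) inv-0
    (no x≢0)   → *-cancelˡ (inv-≢0 x≢0) (trans (*-inv (inv-≢0 x≢0)) (sym (inv-* x≢0)))

  -≢0 : ∀ {x} → x ≢ 0# → - x ≢ 0#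
  -≢0 {x} x≢0 eq = x≢0 (trans (sym (+-identityʳ x)) (trans (cong (x +_) (sym eq)) (-‿inverseʳ x)))

  x+y≡0⇒x≡-y : ∀ {x y} → x + y ≡ 0# → x ≡ - y
  x+y≡0⇒x≡-y {x} {y} eq = +-cancelʳ y x (- y) (trans eq (sym (-‿inverseˡ y)))

  V : ℕ → Set
  V = Vec Carrier

  _≟ⱽ_ : DecidableEquality (V m)
  _≟ⱽ_ = Vec.≡-dec _≟_

  ⊕-assoc : ∀ (u v w : V m) → (u ⊕ v) ⊕ w ≡ u ⊕ (v ⊕ w)
  ⊕-assoc = Vec.zipWith-assoc +-assoc

  ⊕-comm : ∀ (u v : V m) → u ⊕ v ≡ v ⊕ u
  ⊕-comm = Vec.zipWith-comm +-comm

  ⊕-identityˡ : ∀ (v : V m) → zeroV ⊕ v ≡ v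
  ⊕-identityˡ = Vec.zipWith-identityˡ +-identityˡ

  ⊕-identityʳ : ∀ (v : V m) → v ⊕ zeroV ≡ v
  ⊕-identityʳ = Vec.zipWith-identityʳ +-identityʳ

  ⊕-medial : ∀ (a b c d : V m) → (a ⊕ b) ⊕ (c ⊕ d) ≡ (a ⊕ c) ⊕ (b ⊕ d)
  ⊕-medial []      []      []      []      = refl
  ⊕-medial (a ∷ u) (b ∷ v) (c ∷ w) (d ∷ x) = cong₂ _∷_
    (SemiringSolver.solve 4 (λ a b c d → (a :+ b) :+ (c :+ d) := (a :+ c) :+ (b :+ d)) refl a b c d)
    (⊕-medial u v w x) where open SemiringSolver

  ·-distribˡ : ∀ a (u v : V m) → a · (u ⊕ v) ≡ (a · u) ⊕ (a · v)
  ·-distribˡ a []      []      = refl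
  ·-distribˡ a (x ∷ u) (y ∷ v) = cong₂ _∷_ (distribˡ a x y) (·-distribˡ a u v)

  ·-distribʳ : ∀ a b (v : V m) → (a + b) · v ≡ (a · v) ⊕ (b · v)
  ·-distribʳ a b []      = refl
  ·-distribʳ a b (x ∷ v) = cong₂ _∷_ (distribʳ x a b) (·-distribʳ a b v)

  ·-assoc : ∀ a b (v : V m) → (a * b) · v ≡ a · (b · v)
  ·-assoc a b []      = refl
  ·-assoc a b (x ∷ v) = cong₂ _∷_ (*-assoc a b x) (·-assoc a b v)

  ·-identity : ∀ (v : V m) → 1# · v ≡ v
  ·-identity []      = refl
  ·-identity (x ∷ v) = cong₂ _∷_ (*-identityˡ x) (·-identity v)

  ·-zeroˡ : ∀ (v : V m) → 0# · v ≡ zeroV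
  ·-zeroˡ []      = refl
  ·-zeroˡ (x ∷ v) = cong₂ _∷_ (zeroˡ x) (·-zeroˡ v)

  ·-zeroʳ : ∀ m a → a · zeroV {m} ≡ zeroV
  ·-zeroʳ zero    a = refl
  ·-zeroʳ (suc m) a = cong₂ _∷_ (zeroʳ a) (·-zeroʳ m a)

  ⊝_ : V m → V m
  ⊝ v = (- 1#) · v

  ⊕-inverseʳ : ∀ (v : V m) → v ⊕ (⊝ v) ≡ zeroV
  ⊕-inverseʳ v = begin
    v ⊕ (⊝ v)        ≡⟨ cong (_⊕ (⊝ v)) (·-identity v) ⟨
    (1# · v) ⊕ (⊝ v) ≡⟨ ·-distribʳ _ _ v ⟨
    (1# + - 1#) · v  ≡⟨ cong (_· v) (-‿inverseʳ 1#) ⟩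
    0# · v           ≡⟨ ·-zeroˡ v ⟩
    zeroV            ∎ where open ≡-Reasoning

  ⊕-inverseˡ : ∀ (v : V m) → (⊝ v) ⊕ v ≡ zeroV
  ⊕-inverseˡ v = trans (⊕-comm _ v) (⊕-inverseʳ v)

  ⊕⊝-cancel : ∀ (u v : V m) → (u ⊕ v) ⊕ (⊝ v) ≡ u
  ⊕⊝-cancel u v = trans (⊕-assoc u v _) (trans (cong (u ⊕_) (⊕-inverseʳ v)) (⊕-identityʳ u))

  ⊝⊕-cancel : ∀ (u v : V m) → (u ⊕ (⊝ v)) ⊕ v ≡ u
  ⊝⊕-cancel u v = trans (⊕-assoc u _ v) (trans (cong (u ⊕_) (⊕-inverseˡ v)) (⊕-identityʳ u))

  ⊕-cancelʳ : ∀ (u v w : V m) → u ⊕ w ≡ v ⊕ w → u ≡ v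
  ⊕-cancelʳ u v w eq = trans (sym (⊕⊝-cancel u w)) (trans (cong (_⊕ (⊝ w)) eq) (⊕⊝-cancel v w))

  ·-inv : ∀ {a} → a ≢ 0# → ∀ (v : V m) → a · (inv a · v) ≡ v
  ·-inv a≢0 v = trans (sym (·-assoc _ _ v)) (trans (cong (_· v) (*-inv a≢0)) (·-identity v))

  inv-· : ∀ {a} → a ≢ 0# → ∀ (v : V m) → inv a · (a · v) ≡ v
  inv-· a≢0 v = trans (sym (·-assoc _ _ v)) (trans (cong (_· v) (inv-* a≢0)) (·-identity v))

  ·-≢0 : ∀ {a} {v : V m} → a ≢ 0# → v ≢ zeroV → a · v ≢ zeroV
  ·-≢0 {m} {a} {v} a≢0 v≢0 eq = v≢0 (trans (sym (inv-· a≢0 v)) (trans (cong (inv a ·_) eq) (·-zeroʳ m _)))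

  lincomb-⊕ : ∀ (a b : V r) (B : Vec (V m) r) →
              lincomb (a ⊕ b) B ≡ lincomb a B ⊕ lincomb b B
  lincomb-⊕ []      []      []      = sym (⊕-identityˡ zeroV)
  lincomb-⊕ (x ∷ a) (y ∷ b) (v ∷ B) = trans
    (cong₂ _⊕_ (·-distribʳ x y v) (lincomb-⊕ a b B)) (⊕-medial _ _ _ _)

  lincomb-· : ∀ c (a : V r) (B : Vec (V m) r) →
              lincomb (c · a) B ≡ c · lincomb a B
  lincomb-· c []      []      = sym (·-zeroʳ _ c)
  lincomb-· c (x ∷ a) (v ∷ B) = trans
    (cong₂ _⊕_ (·-assoc c x v) (lincomb-· c a B)) (sym (·-distribˡ c _ _))

  lincomb-zero : ∀ (B : Vec (V m) r) → lincomb zeroV B ≡ zeroV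
  lincomb-zero []      = refl
  lincomb-zero (v ∷ B) = trans (cong₂ _⊕_ (·-zeroˡ v) (lincomb-zero B)) (⊕-identityˡ zeroV)

  lincomb-⊝ : ∀ (a b : V r) (B : Vec (V m) r) →
              lincomb a B ≡ lincomb b B → lincomb (a ⊕ (⊝ b)) B ≡ zeroV
  lincomb-⊝ a b B eq = begin
    lincomb (a ⊕ (⊝ b)) B          ≡⟨ lincomb-⊕ a _ B ⟩
    lincomb a B ⊕ lincomb (⊝ b) B  ≡⟨ cong (_⊕ lincomb (⊝ b) B) eq ⟩
    lincomb b B ⊕ lincomb (⊝ b) B  ≡⟨ cong (lincomb b B ⊕_) (lincomb-· _ b B) ⟩
    lincomb b B ⊕ (⊝ lincomb b B)  ≡⟨ ⊕-inverseʳ _ ⟩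
    zeroV                          ∎ where open ≡-Reasoning

  Independent : Vec (V m) r → Set
  Independent B = ∀ a → lincomb a B ≡ zeroV → a ≡ zeroV

  lincomb-injective : ∀ {B : Vec (V m) r} → Independent B → ∀ a b →
                      lincomb a B ≡ lincomb b B → a ≡ b
  lincomb-injective {B = B} ind a b eq = ⊕-cancelʳ a b (⊝ b)
    (trans (ind _ (lincomb-⊝ a b B eq)) (sym (⊕-inverseʳ b)))

  cartesian : ∀ {A B C : Set} (f : A → B → C) (xs : List A) (ys : List B) →
              concatMap (λ x → map (f x) ys) xs ≡ cartesianProductWith f xs ys
  cartesian f []       ys = refl
  cartesian f (x ∷ xs) ys = cong (map (f x) ys ++_) (cartesian f xs ys)

  allVecs-complete : ∀ (v : V m) → v ∈ allVecs m
  allVecs-complete []      = here refl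
  allVecs-complete (x ∷ v) = subst (_ ∈_) (sym (cartesian _∷_ elements _))
    (∈-cartesianProductWith⁺ _∷_ (complete x) (allVecs-complete v))

  allVecs-unique : ∀ m → Unique (allVecs m)
  allVecs-unique zero    = All.[] ∷ []
  allVecs-unique (suc m) = subst Unique (sym (cartesian _∷_ elements _))
    (Unique.cartesianProductWith⁺ _∷_ (λ eq → Vec.∷-injective eq) distinct (allVecs-unique m))

  ∃ᶠ? : ∀ {P : Carrier → Set} → (∀ x → Dec (P x)) → Dec (∃ P)
  ∃ᶠ? = ∃∈? elements complete

  ∃ⱽ? : ∀ {P : V m → Set} → (∀ v → Dec (P v)) → Dec (∃ P)
  ∃ⱽ? = ∃∈? (allVecs _) allVecs-complete

  ι-+ : ∀ a b → ι (a ℕ.+ b) ≡ ι a + ι b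
  ι-+ zero    b = sym (+-identityˡ _)
  ι-+ (suc a) b = trans (cong (1# +_) (ι-+ a b)) (sym (+-assoc _ _ _))

  ι-* : ∀ a b → ι (a ℕ.* b) ≡ ι a * ι b
  ι-* zero    b = sym (zeroˡ _)
  ι-* (suc a) b = trans (ι-+ b (a ℕ.* b))
    (trans (cong₂ _+_ (sym (*-identityˡ _)) (ι-* a b)) (sym (distribʳ _ _ _)))

  ι-1 : ι 1 ≡ 1#
  ι-1 = +-identityʳ 1#

  ι-∑ : ∀ {A : Set} (xs : List A) f → ι (N.∑ xs f) ≡ S.∑ xs (λ x → ι (f x))
  ι-∑ []       f = refl
  ι-∑ (x ∷ xs) f = trans (ι-+ (f x) _) (cong (ι (f x) +_) (ι-∑ xs f))

-- Projection from a point, and sums over lines and flats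

module Projection {q : ℕ} (F : FiniteField q) where
  open Field F

  private variable
    m r : ℕ

  -- A linear section of the quotient map by ⟨Q⟩; π and τ are the resulting coordinates.
  sec  : V (suc m) → V m → V (suc m)
  sec′ : ∀ {a} → Dec (a ≡ 0#) → V (suc m) → V (suc m) → V (suc (suc m))
  sec {zero}  Q       Y = 0# ∷ []
  sec {suc m} (a ∷ Q) Y = sec′ (a ≟ 0#) Q Y
  sec′ (yes _) Q (y ∷ Y) = y ∷ sec Q Y
  -- The first nonzero entry of `Q` is the pivot. Since `sec` puts 0 there, the pivot entry of a
  -- vector determines its multiple of `Q`.
  sec′ (no _)  Q Y       = 0# ∷ Y

  τ  : V (suc m) → V (suc m) → Carrier
  τ′ : ∀ a → Dec (a ≡ 0#) → V (suc m) → V (suc (suc m)) → Carrier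
  τ {zero}  (a ∷ []) (x ∷ []) = x * inv a
  τ {suc m} (a ∷ Q)  X        = τ′ a (a ≟ 0#) Q X
  τ′ a (yes _) Q (x ∷ X) = τ Q X
  τ′ a (no _)  Q (x ∷ X) = x * inv a

  π  : V (suc m) → V (suc m) → V m
  π′ : ∀ a → Dec (a ≡ 0#) → V (suc m) → V (suc (suc m)) → V (suc m)
  π {zero}  Q       X = []
  π {suc m} (a ∷ Q) X = π′ a (a ≟ 0#) Q X
  π′ a (yes _) Q (x ∷ X) = x ∷ π Q X
  π′ a (no _)  Q (x ∷ X) = X ⊕ (⊝ ((x * inv a) · Q))

  private
    x*inv[a]*a : ∀ {a} x → a ≢ 0# → x * inv a * a ≡ x
    x*inv[a]*a x a≢0 = trans (*-assoc _ _ _) (trans (cong (x *_) (inv-* a≢0)) (*-identityʳ x))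

    [0+t*a]*inv[a] : ∀ {a} t → a ≢ 0# → (0# + t * a) * inv a ≡ t
    [0+t*a]*inv[a] {a} t a≢0 = trans (cong (_* inv a) (+-identityˡ _))
      (trans (*-assoc _ _ _) (trans (cong (t *_) (*-inv a≢0)) (*-identityʳ t)))

  head≢0 : ∀ {a} → (a ∷ []) ≢ zeroV → a ≢ 0#
  head≢0 Q≢0 refl = Q≢0 refl

  decompose : ∀ {Q : V (suc m)} → Q ≢ zeroV → ∀ X → sec Q (π Q X) ⊕ (τ Q X · Q) ≡ X
  decompose {zero} {a ∷ []} Q≢0 (x ∷ []) =
    cong (_∷ []) (trans (+-identityˡ _) (x*inv[a]*a x (head≢0 Q≢0)))
  decompose {suc m} {a ∷ Q} Q≢0 (x ∷ X) with a ≟ 0#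
  ... | yes a≡0 = cong₂ _∷_ (trans (cong (λ b → x + τ Q X * b) a≡0) (trans (cong (x +_) (zeroʳ _)) (+-identityʳ x)))
                            (decompose (λ Q≡0 → Q≢0 (cong₂ _∷_ a≡0 Q≡0)) X)
  ... | no a≢0  = cong₂ _∷_ (trans (+-identityˡ _) (x*inv[a]*a x a≢0)) (⊝⊕-cancel X _)

  π-sec : ∀ {Q : V (suc m)} → Q ≢ zeroV → ∀ Y t → π Q (sec Q Y ⊕ (t · Q)) ≡ Y
  π-sec {zero} {a ∷ []} Q≢0 [] t = refl
  π-sec {suc m} {a ∷ Q} Q≢0 (y ∷ Y) t with a ≟ 0#
  ... | yes a≡0 = cong₂ _∷_ (trans (cong (λ b → y + t * b) a≡0) (trans (cong (y +_) (zeroʳ _)) (+-identityʳ y)))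
                            (π-sec (λ Q≡0 → Q≢0 (cong₂ _∷_ a≡0 Q≡0)) Y t)
  ... | no a≢0 = trans (cong (λ s → ((y ∷ Y) ⊕ (t · Q)) ⊕ (⊝ (s · Q))) ([0+t*a]*inv[a] t a≢0))
                       (⊕⊝-cancel (y ∷ Y) (t · Q))

  τ-sec : ∀ {Q : V (suc m)} → Q ≢ zeroV → ∀ Y t → τ Q (sec Q Y ⊕ (t · Q)) ≡ t
  τ-sec {zero} {a ∷ []} Q≢0 [] t = [0+t*a]*inv[a] t (head≢0 Q≢0)
  τ-sec {suc m} {a ∷ Q} Q≢0 (y ∷ Y) t with a ≟ 0#
  ... | yes a≡0  = τ-sec (λ Q≡0 → Q≢0 (cong₂ _∷_ a≡0 Q≡0)) Y t
  ... | no a≢0   = [0+t*a]*inv[a] t a≢0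

  sec-⊕ : ∀ (Q : V (suc m)) Y Z → sec Q (Y ⊕ Z) ≡ sec Q Y ⊕ sec Q Z
  sec-⊕ {zero}  Q       Y       Z       = cong (_∷ []) (sym (+-identityˡ _))
  sec-⊕ {suc m} (a ∷ Q) (y ∷ Y) (z ∷ Z) with a ≟ 0#
  ... | yes _ = cong (_ ∷_) (sec-⊕ Q Y Z)
  ... | no _  = cong (_∷ _) (sym (+-identityˡ _))

  sec-· : ∀ (Q : V (suc m)) a Y → sec Q (a · Y) ≡ a · sec Q Y
  sec-· {zero}  Q       b Y       = cong (_∷ []) (sym (zeroʳ _))
  sec-· {suc m} (a ∷ Q) b (y ∷ Y) with a ≟ 0#
  ... | yes _ = cong (_ ∷_) (sec-· Q b Y)
  ... | no _  = cong (_∷ _) (sym (zeroʳ _))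

  sec-zero : ∀ (Q : V (suc m)) → sec Q zeroV ≡ zeroV
  sec-zero {m} Q = begin
    sec Q zeroV        ≡⟨ cong (sec Q) (·-zeroʳ m 0#) ⟨
    sec Q (0# · zeroV) ≡⟨ sec-· Q 0# zeroV ⟩
    0# · sec Q zeroV   ≡⟨ ·-zeroˡ _ ⟩
    zeroV              ∎ where open ≡-Reasoning

  lincomb-sec : ∀ (Q : V (suc m)) (a : V r) B →
                lincomb a (Vec.map (sec Q) B) ≡ sec Q (lincomb a B)
  lincomb-sec Q []      []      = sym (sec-zero Q)
  lincomb-sec Q (x ∷ a) (v ∷ B) = trans
    (cong₂ _⊕_ (sym (sec-· Q x v)) (lincomb-sec Q a B)) (sym (sec-⊕ Q _ _))

  π≢0 : ∀ {Q X : V (suc m)} → Q ≢ zeroV → (∀ t → X ≢ t · Q) → π Q X ≢ zeroV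
  π≢0 {Q = Q} {X} Q≢0 indep πX≡0 = indep (τ Q X) (begin
    X                              ≡⟨ decompose Q≢0 X ⟨
    sec Q (π Q X) ⊕ (τ Q X · Q)    ≡⟨ cong (λ Y → sec Q Y ⊕ (τ Q X · Q)) πX≡0 ⟩
    sec Q zeroV ⊕ (τ Q X · Q)      ≡⟨ cong (_⊕ (τ Q X · Q)) (sec-zero Q) ⟩
    zeroV ⊕ (τ Q X · Q)            ≡⟨ ⊕-identityˡ _ ⟩
    τ Q X · Q                      ∎) where open ≡-Reasoning

  sec-independent : ∀ {Q : V (suc m)} → Q ≢ zeroV → ∀ {Y} → Y ≢ zeroV → ∀ t → sec Q Y ≢ t · Q
  sec-independent {Q = Q} Q≢0 {Y} Y≢0 t eq = Y≢0 (begin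
    Y                          ≡⟨ π-sec Q≢0 Y 0# ⟨
    π Q (sec Q Y ⊕ (0# · Q))   ≡⟨ cong (λ v → π Q (v ⊕ (0# · Q))) eq ⟩
    π Q ((t · Q) ⊕ (0# · Q))   ≡⟨ cong (λ v → π Q ((t · Q) ⊕ v)) (·-zeroˡ Q) ⟩
    π Q ((t · Q) ⊕ zeroV)      ≡⟨ cong (π Q) (⊕-comm _ _) ⟩
    π Q (zeroV ⊕ (t · Q))      ≡⟨ cong (λ v → π Q (v ⊕ (t · Q))) (sec-zero Q) ⟨
    π Q (sec Q zeroV ⊕ (t · Q)) ≡⟨ π-sec Q≢0 zeroV t ⟩
    zeroV                      ∎) where open ≡-Reasoning

  module Sums {R : Set} {_+ᴿ_ _*ᴿ_ : R → R → R} {0ᴿ 1ᴿ : R}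
      (isCommutativeSemiring : IsCommutativeSemiring _≡_ _+ᴿ_ _*ᴿ_ 0ᴿ 1ᴿ) where
    open Summation isCommutativeSemiring
    private module R = IsCommutativeSemiring isCommutativeSemiring

    ∑ᶠ : (Carrier → R) → R
    ∑ᶠ = ∑ elements

    ∑ⱽ : (V m → R) → R
    ∑ⱽ = ∑ (allVecs _)

    ∑ⱽ-∷ : ∀ (f : V (suc m) → R) → ∑ⱽ f ≡ ∑ᶠ (λ x → ∑ⱽ (λ X → f (x ∷ X)))
    ∑ⱽ-∷ f = trans (∑-concatMap _ elements f) (∑-cong elements (λ x → ∑-map (x ∷_) (allVecs _) f))

    ∑ⱽ-translate : ∀ (Y : V m) f → ∑ⱽ (λ X → f (X ⊕ Y)) ≡ ∑ⱽ f
    ∑ⱽ-translate {m} Y = ∑-reindex _≟ⱽ_ (allVecs-unique m) (_⊕ Y) (_⊕ (⊝ Y))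
      (λ _ → allVecs-complete _) (λ _ → allVecs-complete _)
      (λ {X} _ → ⊝⊕-cancel X Y) (λ {X} _ → ⊕⊝-cancel X Y)

    ∑ⱽ-scale : ∀ {a} → a ≢ 0# → ∀ (f : V m → R) → ∑ⱽ (λ X → f (a · X)) ≡ ∑ⱽ f
    ∑ⱽ-scale {m} {a} a≢0 = ∑-reindex _≟ⱽ_ (allVecs-unique m) (a ·_) (inv a ·_)
      (λ _ → allVecs-complete _) (λ _ → allVecs-complete _)
      (λ {X} _ → ·-inv a≢0 X) (λ {X} _ → inv-· a≢0 X)

    ∑ᶠ-translate : ∀ a f → ∑ᶠ (λ x → f (a + x)) ≡ ∑ᶠ f
    ∑ᶠ-translate a = ∑-reindex _≟_ distinct (a +_) (- a +_) (λ _ → complete _) (λ _ → complete _)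
      (λ {x} _ → trans (sym (+-assoc _ _ x)) (trans (cong (_+ x) (-‿inverseʳ a)) (+-identityˡ x)))
      (λ {x} _ → trans (sym (+-assoc _ _ x)) (trans (cong (_+ x) (-‿inverseˡ a)) (+-identityˡ x)))

    ∑ᶠ-scale : ∀ {a} → a ≢ 0# → ∀ f → ∑ᶠ (λ x → f (a * x)) ≡ ∑ᶠ f
    ∑ᶠ-scale {a} a≢0 = ∑-reindex _≟_ distinct (a *_) (inv a *_) (λ _ → complete _) (λ _ → complete _)
      (λ {x} _ → trans (sym (*-assoc _ _ x)) (trans (cong (_* x) (*-inv a≢0)) (*-identityˡ x)))
      (λ {x} _ → trans (sym (*-assoc _ _ x)) (trans (cong (_* x) (inv-* a≢0)) (*-identityˡ x)))

    ∑ᶠ-inv : ∀ f → ∑ᶠ (λ x → f (inv x)) ≡ ∑ᶠ f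
    ∑ᶠ-inv = ∑-reindex _≟_ distinct inv inv (λ _ → complete _) (λ _ → complete _)
      (λ {x} _ → inv-involutive x) (λ {x} _ → inv-involutive x)

    ∑ᶠ-δ : ∀ a f → ∑ᶠ (λ x → δ (x ≟ a) *ᴿ f x) ≡ f a
    ∑ᶠ-δ a = ∑-δ _≟_ distinct (complete a)

    -- Subtraction is avoided so that the identity serves ℕ as well as F: over F the constant sum on
    -- the right vanishes, over ℕ it is a multiple of `c`.
    ∑-constant-off-0 : ∀ {L} → Unique L → 0# ∈ L → ∀ e c → (∀ {t} → t ∈ L → t ≢ 0# → e t ≡ c) →
                       ∑ L e +ᴿ c ≡ e 0# +ᴿ ∑ L (λ _ → c)
    ∑-constant-off-0 {L} unique 0∈ e c e≡c = begin
      ∑ L e +ᴿ c                                   ≡⟨ cong (∑ L e +ᴿ_) (∑-δ _≟_ unique 0∈ (λ _ → c)) ⟨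
      ∑ L e +ᴿ ∑ L (λ t → δ (t ≟ 0#) *ᴿ c)         ≡⟨ ∑-+ L _ _ ⟨
      ∑ L (λ t → e t +ᴿ (δ (t ≟ 0#) *ᴿ c))         ≡⟨ ∑-cong∈ L pointwise ⟩
      ∑ L (λ t → (δ (t ≟ 0#) *ᴿ e t) +ᴿ c)         ≡⟨ ∑-+ L _ _ ⟩
      ∑ L (λ t → δ (t ≟ 0#) *ᴿ e t) +ᴿ ∑ L (λ _ → c) ≡⟨ cong (_+ᴿ ∑ L (λ _ → c)) (∑-δ _≟_ unique 0∈ e) ⟩
      e 0# +ᴿ ∑ L (λ _ → c)                        ∎
      where
      open ≡-Reasoning
      pointwise : ∀ {t} → t ∈ L → e t +ᴿ (δ (t ≟ 0#) *ᴿ c) ≡ (δ (t ≟ 0#) *ᴿ e t) +ᴿ c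
      pointwise {t} t∈ with t ≟ 0#
      ... | yes _  = cong₂ _+ᴿ_ (sym (R.*-identityˡ _)) (R.*-identityˡ _)
      ... | no t≢0 = trans (cong₂ _+ᴿ_ (e≡c t∈ t≢0) (R.zeroˡ c))
                           (trans (R.+-comm c 0ᴿ) (cong (_+ᴿ c) (sym (R.zeroˡ _))))

    ∑ᶠ-constant-off-0 : ∀ e c → (∀ t → t ≢ 0# → e t ≡ c) → ∑ᶠ e +ᴿ c ≡ e 0# +ᴿ ∑ᶠ (λ _ → c)
    ∑ᶠ-constant-off-0 e c e≡c = ∑-constant-off-0 distinct (complete 0#) e c (λ _ → e≡c _)

    line : List Carrier → V m → (V m → R) → V m → R
    line L Q f X = ∑ L (λ t → f (X ⊕ (t · Q)))

    -- The sum runs over coefficient tuples, so a dependent `C` counts the vectors of the flat with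
    -- multiplicity. The list `L` is either all of F or the prime field.
    flat : List Carrier → Vec (V m) r → (V m → R) → V m → R
    flat L []      f = f
    flat L (Q ∷ C) f = line L Q (flat L C f)

    ⊕-swapʳ : ∀ (X Y Z : V m) → (X ⊕ Y) ⊕ Z ≡ (X ⊕ Z) ⊕ Y
    ⊕-swapʳ X Y Z = trans (⊕-assoc X Y Z) (trans (cong (X ⊕_) (⊕-comm Y Z)) (sym (⊕-assoc X Z Y)))

    flat-cong : ∀ L (C : Vec (V m) r) {f g} → (∀ X → f X ≡ g X) → ∀ X → flat L C f X ≡ flat L C g X
    flat-cong L []      f≗g X = f≗g X
    flat-cong L (Q ∷ C) f≗g X = ∑-cong L (λ t → flat-cong L C f≗g _)

    flat-line : ∀ L (C : Vec (V m) r) Q f X → flat L C (line L Q f) X ≡ line L Q (flat L C f) X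
    flat-line L []      Q f X = refl
    flat-line L (P ∷ C) Q f X = begin
      ∑ L (λ t → flat L C (line L Q f) (X ⊕ (t · P)))
        ≡⟨ ∑-cong L (λ t → flat-line L C Q f _) ⟩
      ∑ L (λ t → ∑ L (λ u → flat L C f ((X ⊕ (t · P)) ⊕ (u · Q))))
        ≡⟨ ∑-swap L L _ ⟩
      ∑ L (λ u → ∑ L (λ t → flat L C f ((X ⊕ (t · P)) ⊕ (u · Q))))
        ≡⟨ ∑-cong L (λ u → ∑-cong L (λ t → cong (flat L C f) (⊕-swapʳ X _ _))) ⟩
      ∑ L (λ u → ∑ L (λ t → flat L C f ((X ⊕ (u · Q)) ⊕ (t · P)))) ∎ where open ≡-Reasoning

    flat-sec : ∀ L (Q : V (suc m)) (C : Vec (V m) r) f Y →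
               flat L C (f ∘ sec Q) Y ≡ flat L (Vec.map (sec Q) C) f (sec Q Y)
    flat-sec L Q []      f Y = refl
    flat-sec L Q (P ∷ C) f Y = ∑-cong L (λ t → trans (flat-sec L Q C f _)
      (cong (flat L (Vec.map (sec Q) C) f) (trans (sec-⊕ Q Y _) (cong (sec Q Y ⊕_) (sec-· Q t P)))))

    -- `Y` stands for a coset of ⟨Q⟩. For nonzero `Y` and `Q`, the vectors `sec Q Y ⊕ (t · Q)`
    -- represent the q points other than Q of a line through Q.
    push : V (suc m) → (V (suc m) → R) → V m → R
    push Q f Y = line elements Q f (sec Q Y)

    ∑ⱽ-push : ∀ {Q : V (suc m)} → Q ≢ zeroV → ∀ f → ∑ⱽ f ≡ ∑ⱽ (push Q f)
    ∑ⱽ-push {Q = Q} Q≢0 = ∑-reindex₂ _≟ⱽ_ _≟ⱽ_ _≟_ (allVecs-unique _) (allVecs-unique _) distinct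
      allVecs-complete allVecs-complete complete (λ Y t → sec Q Y ⊕ (t · Q)) (π Q) (τ Q)
      (decompose Q≢0) (π-sec Q≢0) (τ-sec Q≢0)

    push-π : ∀ {Q : V (suc m)} → Q ≢ zeroV → ∀ f X → push Q f (π Q X) ≡ line elements Q f X
    push-π {Q = Q} Q≢0 f X = begin
      ∑ᶠ (λ t → f (sec Q (π Q X) ⊕ (t · Q)))
        ≡⟨ ∑ᶠ-translate (τ Q X) _ ⟨
      ∑ᶠ (λ t → f (sec Q (π Q X) ⊕ ((τ Q X + t) · Q)))
        ≡⟨ ∑-cong elements (λ t → cong f (trans (cong (sec Q (π Q X) ⊕_) (·-distribʳ _ t Q))
             (trans (sym (⊕-assoc _ _ _)) (cong (_⊕ (t · Q)) (decompose Q≢0 X))))) ⟩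
      ∑ᶠ (λ t → f (X ⊕ (t · Q))) ∎ where open ≡-Reasoning

    Homogeneous : (V m → R) → Set
    Homogeneous f = ∀ {a} → a ≢ 0# → ∀ X → f (a · X) ≡ f X

    push-homogeneous : ∀ Q {f : V (suc m) → R} → Homogeneous f → Homogeneous (push Q f)
    push-homogeneous Q {f} hf {a} a≢0 Y = begin
      ∑ᶠ (λ t → f (sec Q (a · Y) ⊕ (t · Q)))
        ≡⟨ ∑ᶠ-scale a≢0 _ ⟨
      ∑ᶠ (λ t → f (sec Q (a · Y) ⊕ ((a * t) · Q)))
        ≡⟨ ∑-cong elements (λ t → trans (cong f (trans (cong₂ _⊕_ (sec-· Q a Y) (·-assoc a t Q))
             (sym (·-distribˡ a _ _)))) (hf a≢0 _)) ⟩
      ∑ᶠ (λ t → f (sec Q Y ⊕ (t · Q))) ∎ where open ≡-Reasoning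

    line-0 : ∀ {f : V m → R} → Homogeneous f → ∀ Q →
             line elements Q f zeroV +ᴿ f Q ≡ f zeroV +ᴿ ∑ᶠ (λ _ → f Q)
    line-0 {f = f} hf Q = trans (∑ᶠ-constant-off-0 (λ t → f (zeroV ⊕ (t · Q))) (f Q)
        (λ t t≢0 → trans (cong f (⊕-identityˡ _)) (hf t≢0 Q)))
      (cong (λ v → f v +ᴿ ∑ᶠ (λ _ → f Q)) (trans (⊕-identityˡ _) (·-zeroˡ Q)))

  module Nat = Sums ℕ.+-*-isCommutativeSemiring
  module Fld = Sums (IsCommutativeRing.isCommutativeSemiring isCommutativeRing)

-- Characteristic, subfields, and fibres of additive maps

∑-tight : ∀ {A : Set} (xs : List A) {f g : A → ℕ} → (∀ {x} → x ∈ xs → f x ≤ g x) →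
          N.∑ xs g ≤ N.∑ xs f → ∀ {x} → x ∈ xs → f x ≡ g x
∑-tight xs {f} {g} f≤g ∑g≤∑f {x} x∈ with f x ℕ.<? g x
... | no fx≮gx = ℕ.≤-antisym (f≤g x∈) (ℕ.≮⇒≥ fx≮gx)
... | yes fx<gx = ⊥-elim (ℕ.<⇒≱ (strict xs f≤g x∈ fx<gx) ∑g≤∑f)
  where
  strict : ∀ xs → (∀ {y} → y ∈ xs → f y ≤ g y) → ∀ {x} → x ∈ xs → f x < g x → N.∑ xs f < N.∑ xs g
  strict (y ∷ ys) le (here refl) lt = ℕ.+-mono-<-≤ lt (∑-mono ys (le ∘ there))
  strict (y ∷ ys) le (there x∈)  lt = ℕ.+-mono-≤-< (le (here refl)) (strict ys (le ∘ there) x∈ lt)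

prime-power-divisor : ∀ {p} → Prime p → ∀ {k} → ¬ p ∣ k → ∀ n → k ∣ p ^ n → k ≡ 1
prime-power-divisor pr {k} p∤k zero    k∣1 = ∣.∣1⇒≡1 k∣1
prime-power-divisor {p} pr {k} p∤k (suc n) k∣p^n = prime-power-divisor pr p∤k n (coprime-divisor coprime k∣p^n)
  where
  coprime : Coprime k p
  coprime (d∣k , d∣p) with prime⇒irreducible pr d∣p
  ... | inj₁ d≡1  = d≡1
  ... | inj₂ refl = ⊥-elim (p∤k d∣k)

module Characteristic {p h : ℕ} (pr : Prime p) (1≤h : 1 ≤ h) (F : FiniteField (p ^ h)) where
  open Projection F public
  open Field F public

  private
    q : ℕ
    q = p ^ h
    instance
      p-nonZero : NonZero p
      p-nonZero = prime⇒nonZero pr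
    variable
      m r : ℕ

  -- The translation x ↦ 1 + x permutes the field, so ∑ x = ∑ 1 + ∑ x. The characteristic is derived
  -- from this: first q, then p, becomes 0 in F.
  ∑ᶠ-const : ∀ c → Fld.∑ᶠ (λ _ → c) ≡ 0#
  ∑ᶠ-const c = begin
    Fld.∑ᶠ (λ _ → c)             ≡⟨ S.∑-cong elements (λ _ → *-identityʳ c) ⟨
    Fld.∑ᶠ (λ _ → c * 1#)        ≡⟨ S.∑-*ˡ elements c _ ⟩
    c * Fld.∑ᶠ (λ _ → 1#)        ≡⟨ cong (c *_) ∑1≡0 ⟩
    c * 0#                       ≡⟨ zeroʳ c ⟩
    0#                           ∎
    where
    open ≡-Reasoning
    ∑1≡0 : Fld.∑ᶠ (λ _ → 1#) ≡ 0#
    ∑1≡0 = +-cancelʳ (Fld.∑ᶠ id) _ _ (trans (sym (S.∑-+ elements (λ _ → 1#) id))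
      (trans (Fld.∑ᶠ-translate 1# id) (sym (+-identityˡ _))))

  ι-q : ι q ≡ 0#
  ι-q = begin
    ι (p ^ h)                        ≡⟨ cong ι card ⟨
    ι (length elements)              ≡⟨ cong ι (ℕ.*-identityʳ (length elements)) ⟨
    ι (length elements ℕ.* 1)        ≡⟨ cong ι (∑-const elements 1) ⟨
    ι (N.∑ elements (λ _ → 1))       ≡⟨ ι-∑ elements (λ _ → 1) ⟩
    S.∑ elements (λ _ → ι 1)         ≡⟨ ∑ᶠ-const (ι 1) ⟩
    0#                               ∎ where open ≡-Reasoning

  ι-p : ι p ≡ 0#
  ι-p with ι p ≟ 0#
  ... | yes ιp≡0 = ιp≡0
  ... | no ιp≢0  = ⊥-elim (power h ι-q)
    where
    power : ∀ n → ι (p ^ n) ≢ 0#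
    power zero    eq = 1≢0 (trans (sym ι-1) eq)
    power (suc n) eq = *-≢0 ιp≢0 (power n) (trans (sym (ι-* p _)) eq)

  ι[pred[p]] : ι (ℕ.pred p) ≡ - 1#
  ι[pred[p]] = x+y≡0⇒x≡-y (trans (+-comm _ 1#) (trans (cong ι (ℕ.suc-pred p)) ι-p))

  ι-∣ : ∀ {n} → p ∣ n → ι n ≡ 0#
  ι-∣ (divides k refl) = trans (ι-* k p) (trans (cong (ι k *_) ι-p) (zeroʳ _))

  ι-inverse : ∀ n → ¬ p ∣ n → ∃ λ k → ι k * ι n ≡ 1#
  ι-inverse n p∤n with coprime-Bézout {p} {n} (λ (d∣p , d∣n) → case prime⇒irreducible pr d∣p of λ where
      (inj₁ d≡1)  → d≡1
      (inj₂ refl) → ⊥-elim (p∤n d∣n))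
  ... | Bézout.-+ x y eq = y , (begin
    ι y * ι n          ≡⟨ ι-* y n ⟨
    ι (y ℕ.* n)        ≡⟨ cong ι eq ⟨
    1# + ι (x ℕ.* p)   ≡⟨ cong (1# +_) (ι-∣ (divides x refl)) ⟩
    1# + 0#            ≡⟨ +-identityʳ 1# ⟩
    1#                 ∎) where open ≡-Reasoning
  -- Here 1 + y n = x p, so the inverse of n is - y, represented by the natural number (p - 1) y.
  ... | Bézout.+- x y eq = ℕ.pred p ℕ.* y , (begin
    ι (ℕ.pred p ℕ.* y) * ι n   ≡⟨ cong (_* ι n) (ι-* (ℕ.pred p) y) ⟩
    ι (ℕ.pred p) * ι y * ι n   ≡⟨ cong (λ z → z * ι y * ι n) ι[pred[p]] ⟩
    - 1# * ι y * ι n           ≡⟨ *-assoc _ _ _ ⟩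
    - 1# * (ι y * ι n)         ≡⟨ -1*x≈-x _ ⟩
    - (ι y * ι n)              ≡⟨ x+y≡0⇒x≡-y (begin
        1# + ι y * ι n           ≡⟨ cong (1# +_) (ι-* y n) ⟨
        1# + ι (y ℕ.* n)         ≡⟨ cong ι eq ⟩
        ι (x ℕ.* p)              ≡⟨ ι-∣ (divides x refl) ⟩
        0#                       ∎) ⟨
    1#                         ∎) where open ≡-Reasoning

  ι≡0⇒∣ : ∀ {n} → ι n ≡ 0# → p ∣ n
  ι≡0⇒∣ {n} ιn≡0 with p ∣.∣? n
  ... | yes p∣n = p∣n
  ... | no p∤n  = let k , eq = ι-inverse n p∤n in
    ⊥-elim (1≢0 (trans (sym eq) (trans (cong (ι k *_) ιn≡0) (zeroʳ _))))

  ι≡0⇒≡0 : ∀ {n} → n < p → ι n ≡ 0# → n ≡ 0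
  ι≡0⇒≡0 {zero}  _   _  = refl
  ι≡0⇒≡0 {suc n} n<p eq = ⊥-elim (ℕ.<⇒≱ n<p (∣.∣⇒≤ (ι≡0⇒∣ eq)))

  ι≡0⇒p≤ : ∀ {n} → 0 < n → ι n ≡ 0# → p ≤ n
  ι≡0⇒p≤ {suc n} _ eq = ∣.∣⇒≤ (ι≡0⇒∣ eq)

  ι-injective-≤ : ∀ {i j} → j < p → i ≤ j → ι i ≡ ι j → i ≡ j
  ι-injective-≤ {i} {j} j<p i≤j eq = ℕ.≤-antisym i≤j (ℕ.m∸n≡0⇒m≤n (ι≡0⇒≡0 (ℕ.≤-<-trans (ℕ.m∸n≤m j i) j<p)
    (+-cancelˡ (ι i) _ _ (trans (sym (ι-+ i (j ℕ.∸ i)))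
      (trans (cong ι (ℕ.m+[n∸m]≡n i≤j)) (trans (sym eq) (sym (+-identityʳ _))))))))

  ι-injective : ∀ {i j} → i < p → j < p → ι i ≡ ι j → i ≡ j
  ι-injective {i} {j} i<p j<p eq with ℕ.≤-total i j
  ... | inj₁ i≤j = ι-injective-≤ j<p i≤j eq
  ... | inj₂ j≤i = sym (ι-injective-≤ i<p j≤i (sym eq))

  ι-% : ∀ n → ι (n % p) ≡ ι n
  ι-% n = sym (begin
    ι n                                ≡⟨ cong ι (m≡m%n+[m/n]*n n p) ⟩
    ι (n % p ℕ.+ (n / p) ℕ.* p)        ≡⟨ ι-+ (n % p) _ ⟩
    ι (n % p) + ι ((n / p) ℕ.* p)      ≡⟨ cong (ι (n % p) +_) (ι-∣ (divides (n / p) refl)) ⟩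
    ι (n % p) + 0#                     ≡⟨ +-identityʳ _ ⟩
    ι (n % p)                          ∎) where open ≡-Reasoning

  InFp-+ : ∀ {x y} → InFp x → InFp y → InFp (x + y)
  InFp-+ (a , refl) (b , refl) = a ℕ.+ b , sym (ι-+ a b)

  InFp-* : ∀ {x y} → InFp x → InFp y → InFp (x * y)
  InFp-* (a , refl) (b , refl) = a ℕ.* b , sym (ι-* a b)

  InFp-neg : ∀ {x} → InFp x → InFp (- x)
  InFp-neg {x} fx = subst InFp (-1*x≈-x x) (InFp-* (ℕ.pred p , sym ι[pred[p]]) fx)

  InFp-inv : ∀ {x} → InFp x → InFp (inv x)
  InFp-inv {x} (a , refl) = case ι a ≟ 0# of λ where
    (yes eq)  → 0 , trans (cong inv eq) inv-0
    (no ιa≢0) → let k , eq = ι-inverse a (λ p∣a → ιa≢0 (ι-∣ p∣a)) in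
      k , *-cancelˡ ιa≢0 (trans (*-inv ιa≢0) (trans (sym eq) (*-comm _ _)))

  -- A duplicate-free list closed under the operations, so that sums over F and over 𝔽ₚ are
  -- instances of one development.
  record Subfield : Set where
    field
      list   : List Carrier
      unique : Unique list
      0∈     : 0# ∈ list
      +∈     : ∀ {x y} → x ∈ list → y ∈ list → x + y ∈ list
      neg∈   : ∀ {x} → x ∈ list → - x ∈ list
      *∈     : ∀ {x y} → x ∈ list → y ∈ list → x * y ∈ list
      inv∈   : ∀ {x} → x ∈ list → inv x ∈ list
  open Subfield public

  whole : Subfield
  whole = record { list = elements ; unique = distinct ; 0∈ = complete _ ; +∈ = λ _ _ → complete _
                 ; neg∈ = λ _ → complete _ ; *∈ = λ _ _ → complete _ ; inv∈ = λ _ → complete _ }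

  private
    fp : List Carrier
    fp = tabulate {n = p} (ι ∘ toℕ)

  InFp⇒∈ : ∀ {x} → InFp x → x ∈ fp
  InFp⇒∈ (a , refl) = subst (_∈ fp) (trans (cong ι (Fin.toℕ-fromℕ< (m%n<n a p))) (ι-% a))
    (∈-tabulate⁺ {f = ι ∘ toℕ} (fromℕ< (m%n<n a p)))

  ∈⇒InFp : ∀ {x} → x ∈ fp → InFp x
  ∈⇒InFp x∈ = let i , eq = ∈-tabulate⁻ x∈ in toℕ i , eq

  primeField : Subfield
  primeField = record
    { list   = fp
    ; unique = Unique.tabulate⁺ (λ {i} {j} eq → Fin.toℕ-injective (ι-injective (Fin.toℕ<n i) (Fin.toℕ<n j) eq))
    ; 0∈     = InFp⇒∈ (0 , refl)
    ; +∈     = λ x∈ y∈ → InFp⇒∈ (InFp-+ (∈⇒InFp x∈) (∈⇒InFp y∈))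
    ; neg∈   = λ x∈ → InFp⇒∈ (InFp-neg (∈⇒InFp x∈))
    ; *∈     = λ x∈ y∈ → InFp⇒∈ (InFp-* (∈⇒InFp x∈) (∈⇒InFp y∈))
    ; inv∈   = λ x∈ → InFp⇒∈ (InFp-inv (∈⇒InFp x∈)) }

  length-primeField : length (list primeField) ≡ p
  length-primeField = List.length-tabulate (ι ∘ toℕ)

  -- Every coefficient has its own subfield: a flat spanned over 𝔽ₚ together with a subspace spanned
  -- over F is the image of one additive map with coefficients of both kinds.
  vecs : Vec Subfield r → List (V r)
  vecs []       = [] ∷ []
  vecs (M ∷ Ms) = concatMap (λ x → map (x ∷_) (vecs Ms)) (list M)

  ∑-vecs-∷ : ∀ M (Ms : Vec Subfield r) f →
             N.∑ (vecs (M ∷ Ms)) f ≡ N.∑ (list M) (λ x → N.∑ (vecs Ms) (λ a → f (x ∷ a)))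
  ∑-vecs-∷ M Ms f = trans (N.∑-concatMap _ (list M) f) (N.∑-cong (list M) (λ x → N.∑-map (x ∷_) (vecs Ms) f))

  CoordinatesIn : Vec Subfield r → V r → Set
  CoordinatesIn []       []      = ⊤
  CoordinatesIn (M ∷ Ms) (x ∷ a) = x ∈ list M × CoordinatesIn Ms a

  ∑-vecs-pos : ∀ (Ms : Vec Subfield r) {f} → 0 < N.∑ (vecs Ms) f → ∃ λ a → CoordinatesIn Ms a × 0 < f a
  ∑-vecs-pos []       {f} pos = [] , tt , subst (0 <_) (ℕ.+-identityʳ _) pos
  ∑-vecs-pos (M ∷ Ms) {f} pos with ∑≢0⇒∃ (list M) (subst (0 <_) (∑-vecs-∷ M Ms f) pos)
  ... | x , x∈ , pos′ with ∑-vecs-pos Ms pos′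
  ...   | a , a∈ , fa = x ∷ a , (x∈ , a∈) , fa

  ∑-vecs-translate : ∀ (Ms : Vec Subfield r) {b} → CoordinatesIn Ms b → ∀ f →
                     N.∑ (vecs Ms) (λ a → f (a ⊕ b)) ≡ N.∑ (vecs Ms) f
  ∑-vecs-translate []       {[]}    _         f = refl
  ∑-vecs-translate (M ∷ Ms) {y ∷ b} (y∈ , b∈) f = begin
    N.∑ (vecs (M ∷ Ms)) (λ a → f (a ⊕ (y ∷ b)))
      ≡⟨ ∑-vecs-∷ M Ms _ ⟩
    N.∑ (list M) (λ x → N.∑ (vecs Ms) (λ a → f ((x + y) ∷ (a ⊕ b))))
      ≡⟨ N.∑-cong (list M) (λ x → ∑-vecs-translate Ms b∈ (λ a → f ((x + y) ∷ a))) ⟩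
    N.∑ (list M) (λ x → N.∑ (vecs Ms) (λ a → f ((x + y) ∷ a)))
      ≡⟨ N.∑-reindex _≟_ (unique M) (_+ y) (_+ - y) (λ x∈ → +∈ M x∈ y∈) (λ x∈ → +∈ M x∈ (neg∈ M y∈))
           (λ {x} _ → trans (+-assoc x _ _) (trans (cong (x +_) (-‿inverseˡ y)) (+-identityʳ x)))
           (λ {x} _ → trans (+-assoc x _ _) (trans (cong (x +_) (-‿inverseʳ y)) (+-identityʳ x))) _ ⟩
    N.∑ (list M) (λ x → N.∑ (vecs Ms) (λ a → f (x ∷ a)))
      ≡⟨ ∑-vecs-∷ M Ms f ⟨
    N.∑ (vecs (M ∷ Ms)) f ∎ where open ≡-Reasoning

  size : Vec Subfield r → ℕ
  size []       = 1
  size (M ∷ Ms) = length (list M) ℕ.* size Ms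

  ∑-vecs-const : ∀ (Ms : Vec Subfield r) c → N.∑ (vecs Ms) (λ _ → c) ≡ size Ms ℕ.* c
  ∑-vecs-const []       c = refl
  ∑-vecs-const (M ∷ Ms) c = begin
    N.∑ (vecs (M ∷ Ms)) (λ _ → c)                      ≡⟨ ∑-vecs-∷ M Ms _ ⟩
    N.∑ (list M) (λ _ → N.∑ (vecs Ms) (λ _ → c))       ≡⟨ N.∑-cong (list M) (λ _ → ∑-vecs-const Ms c) ⟩
    N.∑ (list M) (λ _ → size Ms ℕ.* c)                 ≡⟨ ∑-const (list M) _ ⟩
    length (list M) ℕ.* (size Ms ℕ.* c)                ≡⟨ ℕ.*-assoc (length (list M)) _ _ ⟨
    size (M ∷ Ms) ℕ.* c                                ∎ where open ≡-Reasoning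

  length-allVecs : ∀ m c → Nat.∑ⱽ {m} (λ _ → c) ≡ q ^ m ℕ.* c
  length-allVecs zero    c = refl
  length-allVecs (suc m) c = begin
    Nat.∑ⱽ {suc m} (λ _ → c)                       ≡⟨ Nat.∑ⱽ-∷ (λ _ → c) ⟩
    N.∑ elements (λ _ → Nat.∑ⱽ {m} (λ _ → c))      ≡⟨ N.∑-cong elements (λ _ → length-allVecs m c) ⟩
    N.∑ elements (λ _ → q ^ m ℕ.* c)               ≡⟨ ∑-const elements _ ⟩
    length elements ℕ.* (q ^ m ℕ.* c)              ≡⟨ cong (ℕ._* (q ^ m ℕ.* c)) card ⟩
    q ℕ.* (q ^ m ℕ.* c)                            ≡⟨ ℕ.*-assoc q _ c ⟨
    q ^ suc m ℕ.* c                                ∎ where open ≡-Reasoning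

  count : Vec Subfield r → Vec (V m) r → V m → ℕ
  count Ms B X = N.∑ (vecs Ms) (λ a → N.δ (lincomb a B ≟ⱽ X))

  count-member : ∀ (Ms : Vec Subfield r) (B : Vec (V m) r) {X} → 0 < count Ms B X →
                 ∃ λ a → CoordinatesIn Ms a × lincomb a B ≡ X
  count-member Ms B {X} pos = let a , a∈ , pos′ = ∑-vecs-pos Ms pos in a , a∈ , δ-pos (lincomb a B ≟ⱽ X) pos′

  count-translate : ∀ (Ms : Vec Subfield r) (B : Vec (V m) r) {b} → CoordinatesIn Ms b →
                    ∀ X → count Ms B (X ⊕ lincomb b B) ≡ count Ms B X
  count-translate Ms B {b} b∈ X = begin
    N.∑ (vecs Ms) (λ a → N.δ (lincomb a B ≟ⱽ (X ⊕ lincomb b B)))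
      ≡⟨ ∑-vecs-translate Ms b∈ _ ⟨
    N.∑ (vecs Ms) (λ a → N.δ (lincomb (a ⊕ b) B ≟ⱽ (X ⊕ lincomb b B)))
      ≡⟨ N.∑-cong (vecs Ms) (λ a → N.δ-cong (lincomb (a ⊕ b) B ≟ⱽ _) (lincomb a B ≟ⱽ X)
           (λ eq → ⊕-cancelʳ _ _ (lincomb b B) (trans (sym (lincomb-⊕ a b B)) eq))
           (λ eq → trans (lincomb-⊕ a b B) (cong (_⊕ lincomb b B) eq))) ⟩
    count Ms B X ∎ where open ≡-Reasoning

  -- A nonempty fibre of the additive map is a translate of its kernel.
  count-0-or-kernel : ∀ (Ms : Vec Subfield r) (B : Vec (V m) r) X →
                      count Ms B X ≡ 0 ⊎ count Ms B X ≡ count Ms B zeroV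
  count-0-or-kernel Ms B X with count Ms B X in eq
  ... | zero  = inj₁ refl
  ... | suc _ with count-member Ms B (subst (0 <_) (sym eq) (s≤s z≤n))
  ...   | b , b∈ , refl = inj₂ (trans (sym eq) (trans
          (cong (count Ms B) (sym (⊕-identityˡ _))) (count-translate Ms B b∈ zeroV)))

  ∑-count : ∀ (Ms : Vec Subfield r) (B : Vec (V m) r) → Nat.∑ⱽ (count Ms B) ≡ size Ms
  ∑-count {m = m} Ms B = begin
    Nat.∑ⱽ (count Ms B)
      ≡⟨ N.∑-swap (allVecs m) (vecs Ms) _ ⟩
    N.∑ (vecs Ms) (λ a → Nat.∑ⱽ (λ X → N.δ (lincomb a B ≟ⱽ X)))
      ≡⟨ N.∑-cong (vecs Ms) (λ a → trans (N.∑-cong (allVecs m)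
           (λ X → N.δ-cong (lincomb a B ≟ⱽ X) (X ≟ⱽ lincomb a B) sym sym))
           (N.∑-δ1 _≟ⱽ_ (allVecs-unique m) (allVecs-complete _))) ⟩
    N.∑ (vecs Ms) (λ _ → 1)
      ≡⟨ ∑-vecs-const Ms 1 ⟩
    size Ms ℕ.* 1
      ≡⟨ ℕ.*-identityʳ _ ⟩
    size Ms ∎ where open ≡-Reasoning

  -- The kernel of a ↦ lincomb a B has order dividing q^m, a power of p; so either p divides every
  -- fibre, or the map is injective, hence bijective.
  count-constant : ∀ (Ms : Vec Subfield r) (B : Vec (V m) r) → size Ms ≡ q ^ m →
                   ∀ X → ι (count Ms B X) ≡ ι (count Ms B zeroV)
  count-constant {m = m} Ms B size≡ X with p ∣.∣? count Ms B zeroV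
  ... | yes p∣k = case count-0-or-kernel Ms B X of λ where
    (inj₁ eq) → trans (cong ι eq) (sym (ι-∣ p∣k))
    (inj₂ eq) → cong ι eq
  ... | no p∤k = cong ι (trans (all-one X) (sym (all-one zeroV)))
    where
    k : ℕ
    k = count Ms B zeroV

    e : V m → ℕ
    e Y = N.δ (0 ℕ.<? count Ms B Y)

    count≡ : ∀ Y → count Ms B Y ≡ k ℕ.* e Y
    count≡ Y with 0 ℕ.<? count Ms B Y
    ... | no ≮0 = trans (ℕ.n≤0⇒n≡0 (ℕ.≮⇒≥ ≮0)) (sym (ℕ.*-zeroʳ k))
    ... | yes 0< with count-0-or-kernel Ms B Y
    ...   | inj₁ eq = ⊥-elim (ℕ.<⇒≢ 0< (sym eq))
    ...   | inj₂ eq = trans eq (sym (ℕ.*-identityʳ k))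

    ∑e : q ^ m ≡ k ℕ.* Nat.∑ⱽ e
    ∑e = begin
      q ^ m                       ≡⟨ size≡ ⟨
      size Ms                     ≡⟨ ∑-count Ms B ⟨
      Nat.∑ⱽ (count Ms B)         ≡⟨ N.∑-cong (allVecs m) count≡ ⟩
      Nat.∑ⱽ (λ Y → k ℕ.* e Y)    ≡⟨ N.∑-*ˡ (allVecs m) k e ⟩
      k ℕ.* Nat.∑ⱽ e              ∎ where open ≡-Reasoning

    k≡1 : k ≡ 1
    k≡1 = prime-power-divisor pr p∤k (h ℕ.* m)
      (divides (Nat.∑ⱽ e) (trans (sym (ℕ.^-*-assoc p h m)) (trans ∑e (ℕ.*-comm k _))))

    all-one : ∀ Y → count Ms B Y ≡ 1
    all-one Y = ∑-tight (allVecs m)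
      (λ {Z} _ → ℕ.≤-trans (ℕ.≤-reflexive (trans (count≡ Z) (trans (cong (ℕ._* e Z) k≡1) (ℕ.*-identityˡ _))))
                           (δ≤1 (0 ℕ.<? count Ms B Z)))
      (ℕ.≤-reflexive (trans (length-allVecs m 1) (trans (ℕ.*-identityʳ _) (trans (sym size≡) (sym (∑-count Ms B))))))
      (allVecs-complete Y)

-- Codewords as homogeneous functions with constant flat sums

module Codes {p h : ℕ} (pr : Prime p) (1≤h : 1 ≤ h) (F : FiniteField (p ^ h)) where
  open Characteristic pr 1≤h F public

  private
    q : ℕ
    q = p ^ h
    variable
      m r s : ℕ

  size-replicate-++ : ∀ d M (Ms : Vec Subfield r) →
                      size (replicate d M Vec.++ Ms) ≡ length (list M) ^ d ℕ.* size Ms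
  size-replicate-++ zero    M Ms = sym (ℕ.*-identityˡ _)
  size-replicate-++ (suc d) M Ms = trans (cong (length (list M) ℕ.*_) (size-replicate-++ d M Ms))
                                         (sym (ℕ.*-assoc (length (list M)) _ _))

  size-replicate : ∀ d M → size (replicate d M) ≡ length (list M) ^ d
  size-replicate zero    M = refl
  size-replicate (suc d) M = cong (length (list M) ℕ.*_) (size-replicate d M)

  -- The additional generator Q enters with coefficient - t.
  line-count : ∀ M (Ms : Vec Subfield r) (Q : V m) B X →
               Nat.line (list M) Q (count Ms B) X ≡ count (M ∷ Ms) (Q ∷ B) X
  line-count M Ms Q B X = begin
    N.∑ (list M) (λ t → N.∑ (vecs Ms) (λ a → N.δ (lincomb a B ≟ⱽ (X ⊕ (t · Q)))))
      ≡⟨ N.∑-reindex _≟_ (unique M) -_ -_ (neg∈ M) (neg∈ M) (λ _ → -‿involutive _) (λ _ → -‿involutive _) _ ⟨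
    N.∑ (list M) (λ t → N.∑ (vecs Ms) (λ a → N.δ (lincomb a B ≟ⱽ (X ⊕ ((- t) · Q)))))
      ≡⟨ N.∑-cong (list M) (λ t → N.∑-cong (vecs Ms) (λ a →
           N.δ-cong (lincomb a B ≟ⱽ _) (((t · Q) ⊕ lincomb a B) ≟ⱽ X) (to t a) (from t a))) ⟩
    N.∑ (list M) (λ t → N.∑ (vecs Ms) (λ a → N.δ (((t · Q) ⊕ lincomb a B) ≟ⱽ X)))
      ≡⟨ ∑-vecs-∷ M Ms _ ⟨
    count (M ∷ Ms) (Q ∷ B) X ∎
    where
    open ≡-Reasoning
    neg : ∀ t → (- t) · Q ≡ ⊝ (t · Q)
    neg t = trans (cong (_· Q) (sym (-1*x≈-x t))) (·-assoc _ t Q)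
    to : ∀ t a → lincomb a B ≡ X ⊕ ((- t) · Q) → (t · Q) ⊕ lincomb a B ≡ X
    to t a eq = trans (⊕-comm _ _) (trans (cong (_⊕ (t · Q)) (trans eq (cong (X ⊕_) (neg t)))) (⊝⊕-cancel X _))
    from : ∀ t a → (t · Q) ⊕ lincomb a B ≡ X → lincomb a B ≡ X ⊕ ((- t) · Q)
    from t a eq = trans (sym (⊕⊝-cancel _ (t · Q)))
      (trans (cong₂ _⊕_ (trans (⊕-comm _ _) eq) (sym (neg t))) refl)

  flat-count : ∀ M (C : Vec (V m) s) (Ms : Vec Subfield r) B X →
               Nat.flat (list M) C (count Ms B) X ≡ count (replicate s M Vec.++ Ms) (C Vec.++ B) X
  flat-count M []      Ms B X = refl
  flat-count M (Q ∷ C) Ms B X = trans (N.∑-cong (list M) (λ t → flat-count M C Ms B _))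
                                      (line-count M (replicate _ M Vec.++ Ms) Q (C Vec.++ B) X)

  ι-flat : ∀ L (C : Vec (V m) s) f X → ι (Nat.flat L C f X) ≡ Fld.flat L C (ι ∘ f) X
  ι-flat L []      f X = refl
  ι-flat L (Q ∷ C) f X = trans (ι-∑ L _) (S.∑-cong L (λ t → ι-flat L C f _))

  -- For homogeneous g, M = `whole` and independent X, C, the sum at X is taken over the points of
  -- the projective space ⟨X, C⟩ outside ⟨C⟩.
  FlatConstant : Subfield → ℕ → (V m → Carrier) → Set
  FlatConstant {m} M d g =
    ∀ (C : Vec (V m) d) X → Fld.flat (list M) C g X ≡ Fld.flat (list M) C g zeroV

  flat-*ˡ : ∀ L (C : Vec (V m) s) a f X → Fld.flat L C (λ Y → a * f Y) X ≡ a * Fld.flat L C f X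
  flat-*ˡ L []      a f X = refl
  flat-*ˡ L (Q ∷ C) a f X = trans (S.∑-cong L (λ t → flat-*ˡ L C a f _)) (S.∑-*ˡ L a _)

  flat-+ : ∀ L (C : Vec (V m) s) f g X →
           Fld.flat L C (λ Y → f Y + g Y) X ≡ Fld.flat L C f X + Fld.flat L C g X
  flat-+ L []      f g X = refl
  flat-+ L (Q ∷ C) f g X = trans (S.∑-cong L (λ t → flat-+ L C f g _)) (S.∑-+ L _ _)

  flat-0 : ∀ L (C : Vec (V m) s) X → Fld.flat L C (λ _ → 0#) X ≡ 0#
  flat-0 L []      X = refl
  flat-0 L (Q ∷ C) X = trans (S.∑-cong L (λ t → flat-0 L C _)) (S.∑-zero L)

  FlatConstant-cong : ∀ M d {f g : V m → Carrier} → (∀ X → f X ≡ g X) →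
                      FlatConstant M d f → FlatConstant M d g
  FlatConstant-cong M d f≗g fc C X = trans (sym (Fld.flat-cong (list M) C f≗g X))
    (trans (fc C X) (Fld.flat-cong (list M) C f≗g zeroV))

  FlatConstant-*ˡ : ∀ M d a {f : V m → Carrier} → FlatConstant M d f → FlatConstant M d (λ X → a * f X)
  FlatConstant-*ˡ M d a fc C X = trans (flat-*ˡ _ C a _ X)
    (trans (cong (a *_) (fc C X)) (sym (flat-*ˡ _ C a _ zeroV)))

  FlatConstant-+ : ∀ M d {f g : V m → Carrier} → FlatConstant M d f → FlatConstant M d g →
                   FlatConstant M d (λ X → f X + g X)
  FlatConstant-+ M d fc gc C X = trans (flat-+ _ C _ _ X)
    (trans (cong₂ _+_ (fc C X) (gc C X)) (sym (flat-+ _ C _ _ zeroV)))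

  FlatConstant-0 : ∀ M d → FlatConstant {m} M d (λ _ → 0#)
  FlatConstant-0 M d C X = trans (flat-0 _ C X) (sym (flat-0 _ C zeroV))

  -- A flat of the quotient by ⟨Q⟩ pulls back to a flat with one more direction, namely `Q`.
  FlatConstant-push : ∀ d {g : V (suc m) → Carrier} → FlatConstant whole (suc d) g →
                      ∀ Q → FlatConstant whole d (Fld.push Q g)
  FlatConstant-push d {g} fc Q C Y = trans (as-flat Y) (trans (fc C′ _)
    (trans (cong (Fld.flat elements C′ g) (sym (sec-zero Q))) (sym (as-flat zeroV))))
    where
    C′ = Q ∷ Vec.map (sec Q) C
    as-flat : ∀ Y → Fld.flat elements C (Fld.push Q g) Y ≡ Fld.flat elements C′ g (sec Q Y)
    as-flat Y = trans (Fld.flat-sec elements Q C (Fld.line elements Q g) Y)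
                      (Fld.flat-line elements (Vec.map (sec Q) C) Q g (sec Q Y))

  incidence : Vec (V m) r → V m → ℕ
  incidence B = count (replicate _ whole) B

  -- The flat sum counts the ways to write X with coefficients from M on `C` and from F on `B`.
  -- These are the fibres of an additive map whose domain is as large as its codomain, so
  -- `count-constant` applies.
  incidence-flatConstant : ∀ M d (B : Vec (V m) r) →
    length (list M) ^ d ℕ.* q ^ r ≡ q ^ m → FlatConstant M d (ι ∘ incidence B)
  incidence-flatConstant {m} {r} M d B size≡ C X =
    trans (sym (as-count X)) (trans (count-constant Ms (C Vec.++ B)
      (trans (size-replicate-++ d M (replicate r whole))
        (trans (cong (length (list M) ^ d ℕ.*_) (trans (size-replicate r whole) (cong (_^ r) card))) size≡)) X)
      (as-count zeroV))
    where
    Ms = replicate d M Vec.++ replicate r whole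
    as-count : ∀ X → ι (count Ms (C Vec.++ B) X) ≡ Fld.flat (list M) C (ι ∘ incidence B) X
    as-count X = trans (cong ι (sym (flat-count M C (replicate r whole) B X)))
                       (ι-flat (list M) C (incidence B) X)

  coordinatesInWhole : ∀ (a : V r) → CoordinatesIn (replicate r whole) a
  coordinatesInWhole []      = tt
  coordinatesInWhole (x ∷ a) = complete x , coordinatesInWhole a

  vecs-whole : ∀ r → vecs (replicate r whole) ≡ allVecs r
  vecs-whole zero    = refl
  vecs-whole (suc r) = cong (λ as → concatMap (λ x → map (x ∷_) as) elements) (vecs-whole r)

  incidence-homogeneous : ∀ (B : Vec (V m) r) → Nat.Homogeneous (incidence B)
  incidence-homogeneous {r = r} B {a} a≢0 X rewrite vecs-whole r = begin
    Nat.∑ⱽ (λ s → N.δ (lincomb s B ≟ⱽ (a · X)))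
      ≡⟨ Nat.∑ⱽ-scale {r} a≢0 (λ s → N.δ (lincomb s B ≟ⱽ (a · X))) ⟨
    Nat.∑ⱽ (λ s → N.δ (lincomb (a · s) B ≟ⱽ (a · X)))
      ≡⟨ N.∑-cong (allVecs r) (λ s → N.δ-cong (lincomb (a · s) B ≟ⱽ _) (lincomb s B ≟ⱽ X)
           (λ eq → trans (sym (inv-· a≢0 _)) (trans (cong (inv a ·_) (trans (sym (lincomb-· a s B)) eq)) (inv-· a≢0 X)))
           (λ eq → trans (lincomb-· a s B) (cong (a ·_) eq))) ⟩
    Nat.∑ⱽ (λ s → N.δ (lincomb s B ≟ⱽ X)) ∎ where open ≡-Reasoning

  ∑-incidence : ∀ (B : Vec (V m) r) → Nat.∑ⱽ (incidence B) ≡ q ^ r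
  ∑-incidence {r = r} B = trans (∑-count (replicate r whole) B) (trans (size-replicate r whole) (cong (_^ r) card))

  incidence-member : ∀ (B : Vec (V m) r) {X} → 0 < incidence B X → ∃ λ a → lincomb a B ≡ X
  incidence-member {r = r} B pos = let a , _ , eq = count-member (replicate r whole) B pos in a , eq

  incidence≥1 : ∀ (B : Vec (V m) r) a → 0 < incidence B (lincomb a B)
  incidence≥1 {r = r} B a rewrite vecs-whole r =
    ℕ.≤-trans (ℕ.≤-reflexive (sym (N.δ-yes (lincomb a B ≟ⱽ lincomb a B) refl)))
              (term≤∑ (λ s → N.δ (lincomb s B ≟ⱽ lincomb a B)) (allVecs-complete a))

  incidence-independent : ∀ {B : Vec (V m) r} → Independent B → ∀ a → incidence B (lincomb a B) ≡ 1
  incidence-independent {r = r} {B} ind a rewrite vecs-whole r = trans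
    (N.∑-cong (allVecs r) (λ s → N.δ-cong (lincomb s B ≟ⱽ lincomb a B) (s ≟ⱽ a)
      (lincomb-injective ind s a) (cong (λ s → lincomb s B))))
    (N.∑-δ1 _≟ⱽ_ (allVecs-unique r) (allVecs-complete a))

  incidence≤1 : ∀ {B : Vec (V m) r} → Independent B → ∀ X → incidence B X ≤ 1
  incidence≤1 {B = B} ind X with 0 ℕ.<? incidence B X
  ... | no ≮0 = ℕ.≤-trans (ℕ.≮⇒≥ ≮0) z≤n
  ... | yes 0< with incidence-member B 0<
  ...   | a , refl = ℕ.≤-reflexive (incidence-independent ind a)

  -- The word of a codeword, extended from points to all vectors; at the zero vector it takes the
  -- sum of the coefficients as value.
  extension : ∀ {n k} → List (Carrier × Subspace n k) → V (suc n) → Carrier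
  extension []            X = 0#
  extension ((a , S) ∷ l) X = a * ι (incidence (Subspace.basis S) X) + extension l X

  module _ {n k : ℕ} where

    extension-IncSum : ∀ (l : List (Carrier × Subspace n k)) {v x} → IncSum v l x → extension l v ≡ x
    extension-IncSum _ nil = refl
    extension-IncSum ((a , S) ∷ l) (inc (s , refl) sum) = cong₂ _+_
      (trans (cong (λ c → a * ι c) (incidence-independent (Subspace.independent S) s))
             (trans (cong (a *_) ι-1) (*-identityʳ a)))
      (extension-IncSum l sum)
    extension-IncSum ((a , S) ∷ l) {v} (exc v∉S sum) = trans (cong₂ _+_
      (trans (cong (λ c → a * ι c) (ℕ.n≤0⇒n≡0 (ℕ.≮⇒≥ (λ pos →
        let s , eq = incidence-member (Subspace.basis S) pos in v∉S (s , sym eq))))) (zeroʳ a))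
      (extension-IncSum l sum)) (+-identityˡ _)

    extension-homogeneous : ∀ (l : List (Carrier × Subspace n k)) → Fld.Homogeneous (extension l)
    extension-homogeneous []            a≢0 X = refl
    extension-homogeneous ((b , S) ∷ l) a≢0 X = cong₂ (λ c d → b * ι c + d)
      (incidence-homogeneous (Subspace.basis S) a≢0 X) (extension-homogeneous l a≢0 X)

    extension-InFp : ∀ (l : List (Carrier × Subspace n k)) → All (λ x → InFp (proj₁ x)) l →
                     ∀ X → InFp (extension l X)
    extension-InFp []            _              X = 0 , refl
    extension-InFp ((a , S) ∷ l) (fa All.∷ fl) X =
      InFp-+ (InFp-* fa (incidence (Subspace.basis S) X , refl)) (extension-InFp l fl X)

    extension-flatConstant : ∀ M d → length (list M) ^ d ℕ.* q ^ suc k ≡ q ^ suc n →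
                             ∀ (l : List (Carrier × Subspace n k)) → FlatConstant M d (extension l)
    extension-flatConstant M d size≡ []            = FlatConstant-0 M d
    extension-flatConstant M d size≡ ((a , S) ∷ l) = FlatConstant-+ M d
      (FlatConstant-*ˡ M d a (incidence-flatConstant M d (Subspace.basis S) size≡))
      (extension-flatConstant M d size≡ l)

-- Weights counted on nonzero vectors, and the lower bound for them

length-filter : ∀ {A : Set} {P : A → Set} (P? : ∀ x → Dec (P x)) (xs : List A) →
                length (filter P? xs) ≡ N.∑ xs (λ x → N.δ (P? x))
length-filter P? xs = begin
  length (filter P? xs)              ≡⟨ ℕ.*-identityʳ _ ⟨
  length (filter P? xs) ℕ.* 1        ≡⟨ ∑-const (filter P? xs) 1 ⟨
  N.∑ (filter P? xs) (λ _ → 1)       ≡⟨ N.∑-filter P? xs (λ x → N.δ-yes (P? x)) (λ x → N.δ-no (P? x)) (λ _ → 1) ⟩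
  N.∑ xs (λ x → N.δ (P? x) ℕ.* 1)    ≡⟨ N.∑-cong xs (λ x → ℕ.*-identityʳ _) ⟩
  N.∑ xs (λ x → N.δ (P? x))          ∎ where open ≡-Reasoning

module Weights {p h : ℕ} (pr : Prime p) (1≤h : 1 ≤ h) (F : FiniteField (p ^ h)) where
  open Codes pr 1≤h F public

  q q₁ : ℕ
  q  = p ^ h
  q₁ = ℕ.pred q

  private variable
    m : ℕ

  1<q : 1 < q
  1<q = ℕ.≤-trans (ℕ.nonTrivial⇒n>1 p {{prime⇒nonTrivial pr}})
    (ℕ.≤-trans (ℕ.≤-reflexive (sym (ℕ.^-identityʳ p))) (ℕ.^-monoʳ-≤ p {{prime⇒nonZero pr}} 1≤h))

  instance
    q-nonZero : NonZero q
    q-nonZero = ℕ.>-nonZero (ℕ.<-trans (s≤s z≤n) 1<q)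

  suc-q₁ : suc q₁ ≡ q
  suc-q₁ = ℕ.suc-pred q

  0<q₁ : 0 < q₁
  0<q₁ = ℕ.≤-pred (subst (2 ≤_) (sym suc-q₁) 1<q)

  star : V m → ℕ
  star X = N.δ (¬? (X ≟ⱽ zeroV))

  -- Counting nonzero vectors instead of points avoids choosing representatives: for a homogeneous
  -- function every point counts q - 1 times, so θ_k appears as q^(k+1) - 1.
  ∑* : (V m → ℕ) → ℕ
  ∑* f = Nat.∑ⱽ (λ X → star X ℕ.* f X)

  star-≢0 : ∀ {X : V m} → X ≢ zeroV → star X ≡ 1
  star-≢0 {X = X} X≢0 = N.δ-yes (¬? (X ≟ⱽ zeroV)) X≢0

  star-* : ∀ {X : V m} → X ≢ zeroV → ∀ x → star X ℕ.* x ≡ x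
  star-* X≢0 x = trans (cong (ℕ._* x) (star-≢0 X≢0)) (ℕ.*-identityˡ x)

  ∑*-split : ∀ (f : V m → ℕ) → ∑* f ℕ.+ f zeroV ≡ Nat.∑ⱽ f
  ∑*-split {m} f = begin
    ∑* f ℕ.+ f zeroV
      ≡⟨ cong (∑* f ℕ.+_) (N.∑-δ _≟ⱽ_ (allVecs-unique m) (allVecs-complete zeroV) f) ⟨
    ∑* f ℕ.+ Nat.∑ⱽ (λ X → N.δ (X ≟ⱽ zeroV) ℕ.* f X)
      ≡⟨ N.∑-+ (allVecs m) _ _ ⟨
    Nat.∑ⱽ (λ X → star X ℕ.* f X ℕ.+ N.δ (X ≟ⱽ zeroV) ℕ.* f X)
      ≡⟨ N.∑-cong (allVecs m) pointwise ⟩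
    Nat.∑ⱽ f ∎
    where
    open ≡-Reasoning
    pointwise : ∀ X → star X ℕ.* f X ℕ.+ N.δ (X ≟ⱽ zeroV) ℕ.* f X ≡ f X
    pointwise X with X ≟ⱽ zeroV
    ... | yes _ = ℕ.+-identityʳ _
    ... | no _  = trans (ℕ.+-identityʳ _) (ℕ.+-identityʳ _)

  star-mono : ∀ (f g : V m → ℕ) → (∀ X → X ≢ zeroV → f X ≤ g X) → ∀ X → star X ℕ.* f X ≤ star X ℕ.* g X
  star-mono f g f≤g X with X ≟ⱽ zeroV
  ... | yes _  = z≤n
  ... | no X≢0 = ℕ.+-monoˡ-≤ 0 (f≤g X X≢0)

  ∑*-mono : ∀ {f g : V m → ℕ} → (∀ X → X ≢ zeroV → f X ≤ g X) → ∑* f ≤ ∑* g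
  ∑*-mono {m} {f} {g} f≤g = ∑-mono (allVecs m) (λ {X} _ → star-mono f g f≤g X)

  ∑*-cong : ∀ {f g : V m → ℕ} → (∀ X → X ≢ zeroV → f X ≡ g X) → ∑* f ≡ ∑* g
  ∑*-cong f≡g = ℕ.≤-antisym (∑*-mono (λ X X≢0 → ℕ.≤-reflexive (f≡g X X≢0)))
                            (∑*-mono (λ X X≢0 → ℕ.≤-reflexive (sym (f≡g X X≢0))))

  ∑*-<⇒∃ : ∀ {f g : V m → ℕ} → ∑* f < ∑* g → ∃ λ X → X ≢ zeroV × f X < g X
  ∑*-<⇒∃ {m} {f} {g} lt with ∑-<⇒∃ (allVecs m) lt
  ... | X , _ , fX<gX = X , X≢0 , subst₂ _<_ (star-* X≢0 (f X)) (star-* X≢0 (g X)) fX<gX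
    where
    X≢0 : X ≢ zeroV
    X≢0 X≡0 = ℕ.<⇒≢ fX<gX (trans (zero* f) (sym (zero* g)))
      where
      zero* : ∀ f → star X ℕ.* f X ≡ 0
      zero* f = cong (ℕ._* f X) (N.δ-no (¬? (X ≟ⱽ zeroV)) (λ X≢0 → X≢0 X≡0))

  ∑*-tight : ∀ {f g : V m → ℕ} → (∀ X → X ≢ zeroV → f X ≤ g X) → ∑* g ≤ ∑* f →
             ∀ {X} → X ≢ zeroV → f X ≡ g X
  ∑*-tight {m} {f} {g} f≤g ∑g≤∑f {X} X≢0 = trans (sym (star-* X≢0 (f X))) (trans
    (∑-tight (allVecs m) (λ {X} _ → star-mono f g f≤g X) ∑g≤∑f (allVecs-complete X)) (star-* X≢0 (g X)))

  ∑*-+ : ∀ (f g : V m → ℕ) → ∑* (λ X → f X ℕ.+ g X) ≡ ∑* f ℕ.+ ∑* g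
  ∑*-+ {m} f g = trans (N.∑-cong (allVecs m) (λ X → ℕ.*-distribˡ-+ (star X) (f X) (g X))) (N.∑-+ (allVecs m) _ _)

  ∑*-*ˡ : ∀ c (f : V m → ℕ) → ∑* (λ X → c ℕ.* f X) ≡ c ℕ.* ∑* f
  ∑*-*ˡ {m} c f = trans (N.∑-cong (allVecs m) (λ X → begin
    star X ℕ.* (c ℕ.* f X)   ≡⟨ ℕ.*-assoc (star X) c _ ⟨
    star X ℕ.* c ℕ.* f X     ≡⟨ cong (ℕ._* f X) (ℕ.*-comm (star X) c) ⟩
    c ℕ.* star X ℕ.* f X     ≡⟨ ℕ.*-assoc c _ _ ⟩
    c ℕ.* (star X ℕ.* f X)   ∎)) (N.∑-*ˡ (allVecs m) c _)
    where open ≡-Reasoning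

  #* : ℕ → ℕ
  #* m = ∑* {m} (λ _ → 1)

  #*+1 : ∀ m → #* m ℕ.+ 1 ≡ q ^ m
  #*+1 m = trans (∑*-split {m} (λ _ → 1)) (trans (length-allVecs m 1) (ℕ.*-identityʳ _))

  suc-#* : ∀ m → suc (#* m) ≡ q ^ m
  suc-#* m = trans (ℕ.+-comm 1 _) (#*+1 m)

  ∑*-const : ∀ m c → ∑* {m} (λ _ → c) ≡ c ℕ.* #* m
  ∑*-const m c = trans (∑*-cong {m} (λ _ _ → sym (ℕ.*-identityʳ c))) (∑*-*ˡ {m} c (λ _ → 1))

  #*-mono : ∀ {a b} → a ≤ b → #* a ≤ #* b
  #*-mono {a} {b} a≤b = ℕ.≤-pred (subst₂ _≤_ (sym (suc-#* a)) (sym (suc-#* b)) (ℕ.^-monoʳ-≤ q a≤b))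

  #*-suc : ∀ m → #* (suc m) ≡ q ℕ.* #* m ℕ.+ q₁
  #*-suc m = ℕ.suc-injective (begin
    suc (#* (suc m))                ≡⟨ suc-#* (suc m) ⟩
    q ℕ.* q ^ m                     ≡⟨ cong (q ℕ.*_) (suc-#* m) ⟨
    q ℕ.* suc (#* m)                ≡⟨ ℕ.*-suc q _ ⟩
    q ℕ.+ q ℕ.* #* m                ≡⟨ cong (ℕ._+ q ℕ.* #* m) suc-q₁ ⟨
    suc (q₁ ℕ.+ q ℕ.* #* m)         ≡⟨ cong suc (ℕ.+-comm q₁ _) ⟩
    suc (q ℕ.* #* m ℕ.+ q₁)         ∎) where open ≡-Reasoning

  #*-0 : #* 0 ≡ 0
  #*-0 = ℕ.suc-injective (suc-#* 0)

  #*-1 : #* 1 ≡ q₁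
  #*-1 = trans (#*-suc 0) (cong (ℕ._+ q₁) (trans (cong (q ℕ.*_) #*-0) (ℕ.*-zeroʳ q)))

  q₁*θ : ∀ k → q₁ ℕ.* θ q k ≡ #* (suc k)
  q₁*θ zero    = trans (ℕ.*-identityʳ q₁) (sym #*-1)
  q₁*θ (suc k) = ℕ.suc-injective (begin
    suc (q₁ ℕ.* (θ q k ℕ.+ q ^ suc k))          ≡⟨ cong suc (ℕ.*-distribˡ-+ q₁ (θ q k) _) ⟩
    suc (q₁ ℕ.* θ q k ℕ.+ q₁ ℕ.* q ^ suc k)     ≡⟨ cong (λ z → suc (z ℕ.+ q₁ ℕ.* q ^ suc k)) (q₁*θ k) ⟩
    suc (#* (suc k)) ℕ.+ q₁ ℕ.* q ^ suc k       ≡⟨ cong (ℕ._+ q₁ ℕ.* q ^ suc k) (suc-#* (suc k)) ⟩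
    suc q₁ ℕ.* q ^ suc k                        ≡⟨ cong (ℕ._* q ^ suc k) suc-q₁ ⟩
    q ^ suc (suc k)                             ≡⟨ suc-#* (suc (suc k)) ⟨
    suc (#* (suc (suc k)))                      ∎) where open ≡-Reasoning

  -- The nonzero vectors fall into the nonzero cosets of ⟨Q⟩ and the q - 1 nonzero multiples of Q.
  -- Hence projecting from a point of the support loses exactly that point.
  ∑*-push : ∀ {Q : V (suc m)} → Q ≢ zeroV → ∀ {f} → Nat.Homogeneous f →
            ∑* f ≡ ∑* (Nat.push Q f) ℕ.+ q₁ ℕ.* f Q
  ∑*-push {m} {Q} Q≢0 {f} hf = ℕ.+-cancelʳ-≡ (f zeroV) _ _ (begin
    ∑* f ℕ.+ f zeroV                                     ≡⟨ ∑*-split f ⟩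
    Nat.∑ⱽ f                                             ≡⟨ Nat.∑ⱽ-push Q≢0 f ⟩
    Nat.∑ⱽ (Nat.push Q f)                                ≡⟨ ∑*-split (Nat.push Q f) ⟨
    ∑* (Nat.push Q f) ℕ.+ Nat.push Q f zeroV             ≡⟨ cong (∑* (Nat.push Q f) ℕ.+_) push-0 ⟩
    ∑* (Nat.push Q f) ℕ.+ (q₁ ℕ.* f Q ℕ.+ f zeroV)       ≡⟨ ℕ.+-assoc (∑* (Nat.push Q f)) _ _ ⟨
    ∑* (Nat.push Q f) ℕ.+ q₁ ℕ.* f Q ℕ.+ f zeroV         ∎)
    where
    open ≡-Reasoning
    push-0 : Nat.push Q f zeroV ≡ q₁ ℕ.* f Q ℕ.+ f zeroV
    push-0 = ℕ.+-cancelʳ-≡ (f Q) _ _ (begin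
      Nat.push Q f zeroV ℕ.+ f Q            ≡⟨ cong (λ v → Nat.line elements Q f v ℕ.+ f Q) (sec-zero Q) ⟩
      Nat.line elements Q f zeroV ℕ.+ f Q   ≡⟨ Nat.line-0 hf Q ⟩
      f zeroV ℕ.+ N.∑ elements (λ _ → f Q)  ≡⟨ cong (f zeroV ℕ.+_) (trans (∑-const elements (f Q)) (cong (ℕ._* f Q) (trans card (sym suc-q₁)))) ⟩
      f zeroV ℕ.+ (f Q ℕ.+ q₁ ℕ.* f Q)      ≡⟨ cong (f zeroV ℕ.+_) (ℕ.+-comm (f Q) _) ⟩
      f zeroV ℕ.+ (q₁ ℕ.* f Q ℕ.+ f Q)      ≡⟨ ℕ.+-assoc (f zeroV) _ _ ⟨
      f zeroV ℕ.+ q₁ ℕ.* f Q ℕ.+ f Q        ≡⟨ cong (ℕ._+ f Q) (ℕ.+-comm (f zeroV) _) ⟩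
      q₁ ℕ.* f Q ℕ.+ f zeroV ℕ.+ f Q        ∎)

  ∑*-push-≤ : ∀ {Q : V (suc m)} → Q ≢ zeroV → ∀ {f} → Nat.Homogeneous f → ∑* (Nat.push Q f) ≤ ∑* f
  ∑*-push-≤ Q≢0 hf = ℕ.≤-trans (ℕ.m≤m+n _ _) (ℕ.≤-reflexive (sym (∑*-push Q≢0 hf)))

  supp : (V m → Carrier) → V m → ℕ
  supp g X = N.δ (¬? (g X ≟ 0#))

  supp-≢0 : ∀ (g : V m → Carrier) {X} → g X ≢ 0# → supp g X ≡ 1
  supp-≢0 g {X} = N.δ-yes (¬? (g X ≟ 0#))

  supp-≡0 : ∀ (g : V m → Carrier) {X} → g X ≡ 0# → supp g X ≡ 0
  supp-≡0 g {X} eq = N.δ-no (¬? (g X ≟ 0#)) (λ ≢0 → ≢0 eq)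

  supp-pos : ∀ (g : V m → Carrier) {X} → 0 < supp g X → g X ≢ 0#
  supp-pos g {X} = δ-pos (¬? (g X ≟ 0#))

  supp-none : ∀ (g : V m → Carrier) {X} → supp g X < 1 → g X ≡ 0#
  supp-none g {X} lt with g X ≟ 0#
  ... | yes eq = eq
  ... | no _   = ⊥-elim (ℕ.<-irrefl refl lt)

  supp-homogeneous : ∀ {g : V m → Carrier} → Fld.Homogeneous g → Nat.Homogeneous (supp g)
  supp-homogeneous hg a≢0 X = cong (λ x → N.δ (¬? (x ≟ 0#))) (hg a≢0 X)

  ∑-supp : ∀ {A : Set} (xs : List A) f → N.δ (¬? (S.∑ xs f ≟ 0#)) ≤ N.∑ xs (λ x → N.δ (¬? (f x ≟ 0#)))
  ∑-supp [] f = ℕ.≤-reflexive (N.δ-no (¬? (0# ≟ 0#)) (λ 0≢0 → 0≢0 refl))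
  ∑-supp (x ∷ xs) f with f x ≟ 0#
  ... | no _    = ℕ.≤-trans (δ≤1 (¬? (_ ≟ 0#))) (s≤s z≤n)
  ... | yes f≡0 = subst (λ s → N.δ (¬? (s ≟ 0#)) ≤ N.∑ xs (λ x → N.δ (¬? (f x ≟ 0#))))
                        (sym (trans (cong (_+ S.∑ xs f) f≡0) (+-identityˡ _))) (∑-supp xs f)

  supp-push : ∀ Q (g : V (suc m) → Carrier) Y → supp (Fld.push Q g) Y ≤ Nat.push Q (supp g) Y
  supp-push Q g Y = ∑-supp elements _

  ∑*-supp-push : ∀ {Q : V (suc m)} → Q ≢ zeroV → ∀ {g} → Fld.Homogeneous g →
                 ∑* (supp (Fld.push Q g)) ≤ ∑* (supp g)
  ∑*-supp-push Q≢0 {g} hg = ℕ.≤-trans (∑*-mono (λ Y _ → supp-push _ g Y)) (∑*-push-≤ Q≢0 (supp-homogeneous hg))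

  -- For independent X and Y both sides are the sum over the projective line XY, parametrised once
  -- as X + t Y together with Y and once as Y + t X together with X. The substitution t ↦ 1/t
  -- matches the two.
  exchange : ∀ {g : V m → Carrier} → Fld.Homogeneous g → ∀ X Y →
             Fld.line elements Y g X + g Y ≡ Fld.line elements X g Y + g X
  exchange {g = g} hg X Y = begin
    Fld.∑ᶠ e + g Y
      ≡⟨ cong₂ _+_ (Fld.∑ᶠ-inv e) (Fld.∑ᶠ-δ 0# (λ _ → g Y)) ⟨
    Fld.∑ᶠ (e ∘ inv) + Fld.∑ᶠ (λ t → S.δ (t ≟ 0#) * g Y)
      ≡⟨ S.∑-+ elements _ _ ⟨
    Fld.∑ᶠ (λ t → e (inv t) + S.δ (t ≟ 0#) * g Y)
      ≡⟨ S.∑-cong elements (λ t → pointwise t (t ≟ 0#)) ⟩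
    Fld.∑ᶠ (λ t → g (Y ⊕ (t · X)) + S.δ (t ≟ 0#) * g X)
      ≡⟨ S.∑-+ elements _ _ ⟩
    Fld.line elements X g Y + Fld.∑ᶠ (λ t → S.δ (t ≟ 0#) * g X)
      ≡⟨ cong (Fld.line elements X g Y +_) (Fld.∑ᶠ-δ 0# (λ _ → g X)) ⟩
    Fld.line elements X g Y + g X ∎
    where
    open ≡-Reasoning
    e : Carrier → Carrier
    e t = g (X ⊕ (t · Y))
    X⊕0Y : ∀ X Y → X ⊕ (0# · Y) ≡ X
    X⊕0Y X Y = trans (cong (X ⊕_) (·-zeroˡ Y)) (⊕-identityʳ X)
    pointwise : ∀ t (d : Dec (t ≡ 0#)) → e (inv t) + S.δ d * g Y ≡ g (Y ⊕ (t · X)) + S.δ d * g X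
    -- Since `inv 0#` is `0#`, the terms at t = 0 are `g X` and `g Y`; the two delta terms supply
    -- the point that each parametrisation misses.
    pointwise t (yes refl) = begin
      g (X ⊕ (inv 0# · Y)) + 1# * g Y   ≡⟨ cong₂ _+_ (cong g (trans (cong (λ s → X ⊕ (s · Y)) inv-0) (X⊕0Y X Y))) (*-identityˡ _) ⟩
      g X + g Y                         ≡⟨ +-comm _ _ ⟩
      g Y + g X                         ≡⟨ cong₂ _+_ (cong g (X⊕0Y Y X)) (*-identityˡ _) ⟨
      g (Y ⊕ (0# · X)) + 1# * g X       ∎
    pointwise t (no t≢0) = cong₂ _+_ (begin
      g (X ⊕ (inv t · Y))               ≡⟨ hg t≢0 _ ⟨
      g (t · (X ⊕ (inv t · Y)))         ≡⟨ cong g (trans (·-distribˡ t X _) (trans (cong ((t · X) ⊕_) (·-inv t≢0 Y)) (⊕-comm _ _))) ⟩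
      g (Y ⊕ (t · X))                   ∎) (trans (zeroˡ _) (sym (zeroˡ _)))

  vanishing-line : ∀ {Q : V (suc m)} → Q ≢ zeroV → ∀ g →
    (∀ Y → Y ≢ zeroV → Fld.push Q g Y ≡ 0#) → ∀ {X} → (∀ t → X ≢ t · Q) → Fld.line elements Q g X ≡ 0#
  vanishing-line Q≢0 g van {X} indep = trans (sym (Fld.push-π Q≢0 g X)) (van _ (π≢0 Q≢0 indep))

  flip-multiple : ∀ {X Y : V m} → X ≢ zeroV → (∀ t → Y ≢ t · X) → ∀ t → X ≢ t · Y
  flip-multiple {X = X} {Y} X≢0 indep t X≡tY with t ≟ 0#
  ... | yes refl = X≢0 (trans X≡tY (·-zeroˡ Y))
  ... | no t≢0   = indep (inv t) (trans (sym (inv-· t≢0 Y)) (cong (inv t ·_) (sym X≡tY)))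

  homogeneous-multiple : ∀ {g : V m → Carrier} → Fld.Homogeneous g →
                         ∀ {X Y} → Y ≢ zeroV → ∀ t → Y ≡ t · X → g Y ≡ g X
  homogeneous-multiple {g = g} hg {X} Y≢0 t Y≡tX =
    trans (cong g Y≡tX) (hg (λ t≡0 → Y≢0 (trans Y≡tX (trans (cong (_· X) t≡0) (·-zeroˡ X)))) X)

  -- If some projection is nonzero away from 0, induction applies to it. Otherwise the sum over a
  -- line XZ reduces to `g X` and, after `exchange`, to `g Z`; then g is constant on nonzero vectors
  -- and its support is the whole space.
  minimum-weight : ∀ j {κ} (g : V (j ℕ.+ κ) → Carrier) → Fld.Homogeneous g →
    FlatConstant whole j g → ∀ {X} → X ≢ zeroV → g X ≢ 0# → #* κ ≤ ∑* (supp g)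
  minimum-weight zero g hg fc {X} X≢0 gX≢0 = ∑*-mono (λ Y Y≢0 → ℕ.≤-reflexive (sym (supp-≢0 g
    (λ gY≡0 → gX≢0 (trans (fc [] X) (trans (sym (fc [] Y)) gY≡0))))))
  minimum-weight (suc j) {κ} g hg fc {X} X≢0 gX≢0
    with ∃ⱽ? (λ Q → ¬? (Q ≟ⱽ zeroV) ×-dec ∃ⱽ? (λ Y → ¬? (Y ≟ⱽ zeroV) ×-dec ¬? (Fld.push Q g Y ≟ 0#)))
  ... | yes (Q , Q≢0 , Y , Y≢0 , ≢0) = ℕ.≤-trans
    (minimum-weight j (Fld.push Q g) (Fld.push-homogeneous Q hg) (FlatConstant-push j fc Q) Y≢0 ≢0)
    (∑*-supp-push Q≢0 hg)
  ... | no none = ℕ.≤-trans (#*-mono (ℕ.m≤n+m κ (suc j)))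
                            (∑*-mono (λ Z Z≢0 → ℕ.≤-reflexive (sym (supp-≢0 g (λ gZ≡0 → gX≢0 (trans (same Z≢0) gZ≡0))))))
    where
    vanish : ∀ {Q} → Q ≢ zeroV → ∀ Y → Y ≢ zeroV → Fld.push Q g Y ≡ 0#
    vanish Q≢0 Y Y≢0 = decidable-stable (_ ≟ 0#) (λ ≢0 → none (_ , Q≢0 , Y , Y≢0 , ≢0))
    same : ∀ {Z} → Z ≢ zeroV → g X ≡ g Z
    same {Z} Z≢0 with ∃ᶠ? (λ t → Z ≟ⱽ (t · X))
    ... | yes (t , Z≡tX) = sym (homogeneous-multiple hg Z≢0 t Z≡tX)
    ... | no Z≢tX = +-cancelˡ 0# (g X) (g Z) (begin
      0# + g X                               ≡⟨ cong (_+ g X) (vanishing-line X≢0 g (vanish X≢0) (λ t eq → Z≢tX (t , eq))) ⟨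
      Fld.line elements X g Z + g X          ≡⟨ exchange hg Z X ⟩
      Fld.line elements Z g X + g Z          ≡⟨ cong (_+ g Z) (vanishing-line Z≢0 g (vanish Z≢0)
                                                  (flip-multiple X≢0 (λ t eq → Z≢tX (t , eq)))) ⟩
      0# + g Z                               ∎) where open ≡-Reasoning

  two-terms : ∀ (f : Carrier → ℕ) {a b} → a ≢ b → f a ℕ.+ f b ≤ Nat.∑ᶠ f
  two-terms f {a} {b} a≢b = begin
    f a ℕ.+ f b
      ≡⟨ cong₂ ℕ._+_ (Nat.∑ᶠ-δ a f) (Nat.∑ᶠ-δ b f) ⟨
    Nat.∑ᶠ (λ x → N.δ (x ≟ a) ℕ.* f x) ℕ.+ Nat.∑ᶠ (λ x → N.δ (x ≟ b) ℕ.* f x)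
      ≡⟨ N.∑-+ elements _ _ ⟨
    Nat.∑ᶠ (λ x → N.δ (x ≟ a) ℕ.* f x ℕ.+ N.δ (x ≟ b) ℕ.* f x)
      ≤⟨ ∑-mono elements (λ {x} _ → pointwise x) ⟩
    Nat.∑ᶠ f ∎
    where
    open ℕ.≤-Reasoning
    pointwise : ∀ x → N.δ (x ≟ a) ℕ.* f x ℕ.+ N.δ (x ≟ b) ℕ.* f x ≤ f x
    pointwise x with x ≟ a | x ≟ b
    ... | yes refl | yes refl = ⊥-elim (a≢b refl)
    ... | yes _    | no _     = ℕ.≤-reflexive (trans (ℕ.+-identityʳ _) (ℕ.+-identityʳ _))
    ... | no _     | yes _    = ℕ.≤-reflexive (ℕ.+-identityʳ _)
    ... | no _     | no _     = z≤n

-- Words of minimum weight have a subspace as support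

module MinimumWords {p h : ℕ} (pr : Prime p) (1≤h : 1 ≤ h) (F : FiniteField (p ^ h)) where
  open Weights pr 1≤h F public

  private variable
    m r : ℕ

  -- The zero vector is added by hand, because the value of g at 0 is a sum of coefficients and says
  -- nothing about any point.
  Support₀ : (V m → Carrier) → V m → Set
  Support₀ g X = X ≡ zeroV ⊎ g X ≢ 0#

  support₀? : ∀ (g : V m → Carrier) X → Dec (Support₀ g X)
  support₀? g X = (X ≟ⱽ zeroV) ⊎-dec ¬? (g X ≟ 0#)

  ∑-support₀ : ∀ (g : V m → Carrier) →
               Nat.∑ⱽ (λ X → N.δ (support₀? g X)) ≡ suc (∑* (supp g))
  ∑-support₀ {m} g = begin
    Nat.∑ⱽ (λ X → N.δ (support₀? g X))
      ≡⟨ ∑*-split {m} (λ X → N.δ (support₀? g X)) ⟨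
    ∑* (λ X → N.δ (support₀? g X)) ℕ.+ N.δ (support₀? g zeroV)
      ≡⟨ cong₂ ℕ._+_ (∑*-cong (λ X X≢0 → N.δ-cong (support₀? g X) (¬? (g X ≟ 0#))
           (λ { (inj₁ X≡0) → ⊥-elim (X≢0 X≡0) ; (inj₂ ≢0) → ≢0 }) inj₂))
           (N.δ-yes (support₀? g zeroV) (inj₁ refl)) ⟩
    ∑* (supp g) ℕ.+ 1
      ≡⟨ ℕ.+-comm _ 1 ⟩
    suc (∑* (supp g)) ∎ where open ≡-Reasoning

  record IsSubspace (G : V m → Set) : Set where
    field
      zero-closed : G zeroV
      ⊕-closed : ∀ {X Y} → G X → G Y → G (X ⊕ Y)
      ·-closed : ∀ a {X} → G X → G (a · X)

  module Basis {G : V m → Set} (G? : ∀ X → Dec (G X)) (subspace : IsSubspace G) where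
    open IsSubspace subspace

    order : ℕ
    order = Nat.∑ⱽ (λ X → N.δ (G? X))

    span⊆ : ∀ {B : Vec (V m) r} → VAll.All G B → ∀ a → G (lincomb a B)
    span⊆ []        []      = zero-closed
    span⊆ (Gv ∷ GB) (x ∷ a) = ⊕-closed (·-closed x Gv) (span⊆ GB a)

    incidence≤δ : ∀ {B : Vec (V m) r} → VAll.All G B → Independent B → ∀ X →
                  incidence B X ≤ N.δ (G? X)
    incidence≤δ {B = B} GB ind X with 0 ℕ.<? incidence B X
    ... | no ≮0 = ℕ.≤-trans (ℕ.≮⇒≥ ≮0) z≤n
    ... | yes 0< with incidence-member B 0<
    ...   | a , refl = ℕ.≤-trans (incidence≤1 ind X) (ℕ.≤-reflexive (sym (N.δ-yes (G? X) (span⊆ GB a))))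

    independent⇒≤order : ∀ {B : Vec (V m) r} → VAll.All G B → Independent B → q ^ r ≤ order
    independent⇒≤order {B = B} GB ind =
      subst (_≤ order) (∑-incidence B) (∑-mono (allVecs m) (λ {X} _ → incidence≤δ GB ind X))

    -- The r vectors span at most q^r vectors, so counting finds an element of G outside their span.
    extend : ∀ {B : Vec (V m) r} → Independent B → q ^ r < order →
             ∃ λ v → G v × Independent (v ∷ B)
    extend {B = B} ind lt with ∑-<⇒∃ (allVecs m) (subst (_< order) (sym (∑-incidence B)) lt)
    ... | v , _ , inc<δ = v , Gv , ind′
      where
      Gv : G v
      Gv = δ-pos (G? v) (ℕ.≤-<-trans z≤n inc<δ)
      v∉span : ∀ a → lincomb a B ≢ v
      v∉span a refl = ℕ.<-irrefl refl (ℕ.<-≤-trans (incidence≥1 B a) (ℕ.≤-pred (ℕ.≤-trans inc<δ (δ≤1 (G? v)))))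
      ind′ : Independent (v ∷ B)
      ind′ (t ∷ a) eq with t ≟ 0#
      ... | no t≢0 = ⊥-elim (v∉span (inv t · (⊝ a)) (begin
        lincomb (inv t · (⊝ a)) B    ≡⟨ lincomb-· _ (⊝ a) B ⟩
        inv t · lincomb (⊝ a) B      ≡⟨ cong (inv t ·_) (lincomb-· _ a B) ⟩
        inv t · (⊝ lincomb a B)      ≡⟨ cong (inv t ·_) (⊕-cancelʳ _ _ (lincomb a B)
                                          (trans (⊕-inverseˡ _) (sym eq))) ⟩
        inv t · (t · v)              ≡⟨ inv-· t≢0 v ⟩
        v                            ∎)) where open ≡-Reasoning
      ... | yes refl = cong (0# ∷_) (ind a (trans (sym (trans (cong (_⊕ lincomb a B) (·-zeroˡ v)) (⊕-identityˡ _))) eq))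

    basis : ∀ r → q ^ r ≤ order → ∃ λ (B : Vec (V m) r) → VAll.All G B × Independent B
    basis zero    _  = [] , [] , λ { [] _ → refl }
    basis (suc r) le with ℕ.<-≤-trans (ℕ.^-monoʳ-< q 1<q (ℕ.n<1+n r)) le
    ... | lt with basis r (ℕ.<⇒≤ lt)
    ...   | B , GB , ind = let v , Gv , ind′ = extend ind lt in v ∷ B , Gv ∷ GB , ind′

    spans : ∀ {B : Vec (V m) r} → VAll.All G B → Independent B → order ≤ q ^ r →
            ∀ {X} → G X → ∃ λ a → lincomb a B ≡ X
    spans {B = B} GB ind order≤ {X} GX = incidence-member B (ℕ.≤-reflexive (sym (trans
      (∑-tight (allVecs m) (λ {Y} _ → incidence≤δ GB ind Y)
        (subst (order ≤_) (sym (∑-incidence B)) order≤) (allVecs-complete X))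
      (N.δ-yes (G? X) GX))))

  module _ j {κ} (g : V (suc j ℕ.+ κ) → Carrier) (hg : Fld.Homogeneous g)
           (fc : FlatConstant whole (suc j) g) (light : ∑* (supp g) ≤ #* κ) where

    -- Projecting from a point of the support makes the weight drop strictly below the minimum, so
    -- only the zero word is left.
    minimum-push : ∀ {R} → R ≢ zeroV → g R ≢ 0# → ∀ Y → Y ≢ zeroV → Fld.push R g Y ≡ 0#
    minimum-push {R} R≢0 gR≢0 Y Y≢0 = decidable-stable (_ ≟ 0#) (λ ≢0 → ℕ.<-irrefl refl (begin-strict
      ∑* (supp g)                                                ≤⟨ light ⟩
      #* κ                                                       ≤⟨ minimum-weight j (Fld.push R g) (Fld.push-homogeneous R hg)
                                                                      (FlatConstant-push j fc R) Y≢0 ≢0 ⟩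
      ∑* (supp (Fld.push R g))                                   ≤⟨ ∑*-mono (λ Z _ → supp-push R g Z) ⟩
      ∑* (Nat.push R (supp g))                                   <⟨ ℕ.m<m+n _ 0<q₁ ⟩
      ∑* (Nat.push R (supp g)) ℕ.+ q₁                            ≡⟨ cong (∑* (Nat.push R (supp g)) ℕ.+_) (ℕ.*-identityʳ q₁) ⟨
      ∑* (Nat.push R (supp g)) ℕ.+ q₁ ℕ.* 1                      ≡⟨ cong (λ c → ∑* (Nat.push R (supp g)) ℕ.+ q₁ ℕ.* c) (supp-≢0 g gR≢0) ⟨
      ∑* (Nat.push R (supp g)) ℕ.+ q₁ ℕ.* supp g R               ≡⟨ ∑*-push R≢0 (supp-homogeneous hg) ⟨
      ∑* (supp g)                                                ∎))
      where open ℕ.≤-Reasoning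

    minimum-line : ∀ {R} → R ≢ zeroV → g R ≢ 0# → ∀ {X} → (∀ t → X ≢ t · R) → Fld.line elements R g X ≡ 0#
    minimum-line R≢0 gR≢0 = vanishing-line R≢0 g (minimum-push R≢0 gR≢0)

    -- By `minimum-line` the sum over the line RT is `g R` when the line is viewed from R, and `g T`
    -- when it is viewed from T.
    minimum-constant : ∀ {R T} → R ≢ zeroV → g R ≢ 0# → T ≢ zeroV → g T ≢ 0# → g R ≡ g T
    minimum-constant {R} {T} R≢0 gR≢0 T≢0 gT≢0 with ∃ᶠ? (λ t → T ≟ⱽ (t · R))
    ... | yes (t , T≡tR) = sym (homogeneous-multiple hg T≢0 t T≡tR)
    ... | no T≢tR = +-cancelˡ 0# (g R) (g T) (begin
      0# + g R                         ≡⟨ cong (_+ g R) (minimum-line R≢0 gR≢0 (λ t eq → T≢tR (t , eq))) ⟨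
      Fld.line elements R g T + g R    ≡⟨ exchange hg T R ⟩
      Fld.line elements T g R + g T    ≡⟨ cong (_+ g T) (minimum-line T≢0 gT≢0 (flip-multiple R≢0 (λ t eq → T≢tR (t , eq)))) ⟩
      0# + g T                         ∎) where open ≡-Reasoning

    -- If R ⊕ T were missed, the line through it would contain two points of the support, so projecting
    -- from R ⊕ T would lower the weight and hence kill the word.
    minimum-closed : ∀ {R T} → R ≢ zeroV → g R ≢ 0# → g T ≢ 0# → R ⊕ T ≢ zeroV → g (R ⊕ T) ≢ 0#
    minimum-closed {R} {T} R≢0 gR≢0 gT≢0 Q≢0 gQ≡0 with ∃ᶠ? (λ t → (R ⊕ T) ≟ⱽ (t · R))
    ... | yes (t , Q≡tR) = gR≢0 (trans (sym (homogeneous-multiple hg Q≢0 t Q≡tR)) gQ≡0)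
    ... | no Q≢tR = gR≢0 (sym (+-cancelˡ 0# 0# (g R) (begin
      0# + 0#                              ≡⟨ cong₂ _+_ (vanishing-line Q≢0 g push≡0 R≢tQ) gQ≡0 ⟨
      Fld.line elements Q g R + g Q        ≡⟨ exchange hg R Q ⟩
      Fld.line elements R g Q + g R        ≡⟨ cong (_+ g R) (minimum-line R≢0 gR≢0 (λ t eq → Q≢tR (t , eq))) ⟩
      0# + g R                             ∎)))
      where
      open ≡-Reasoning
      Q : V (suc j ℕ.+ κ)
      Q = R ⊕ T
      R≢tQ : ∀ t → R ≢ t · Q
      R≢tQ = flip-multiple R≢0 (λ t eq → Q≢tR (t , eq))
      two : 2 ≤ Nat.push Q (supp g) (π Q R)
      two = ℕ.≤-trans (ℕ.≤-reflexive (sym (cong₂ ℕ._+_ at-0 at--1)))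
        (subst (supp g (R ⊕ (0# · Q)) ℕ.+ supp g (R ⊕ (⊝ Q)) ≤_) (sym (Nat.push-π Q≢0 (supp g) R))
          (two-terms (λ t → supp g (R ⊕ (t · Q))) (λ eq → -≢0 1≢0 (sym eq))))
        where
        at-0 : supp g (R ⊕ (0# · Q)) ≡ 1
        at-0 = supp-≢0 g (λ eq → gR≢0 (trans (cong g (sym (trans (cong (R ⊕_) (·-zeroˡ Q)) (⊕-identityʳ R)))) eq))
        R-Q : R ⊕ (⊝ Q) ≡ ⊝ T
        R-Q = begin
          R ⊕ (⊝ (R ⊕ T))         ≡⟨ cong (R ⊕_) (·-distribˡ _ R T) ⟩
          R ⊕ ((⊝ R) ⊕ (⊝ T))     ≡⟨ ⊕-assoc R _ _ ⟨
          (R ⊕ (⊝ R)) ⊕ (⊝ T)     ≡⟨ cong (_⊕ (⊝ T)) (⊕-inverseʳ R) ⟩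
          zeroV ⊕ (⊝ T)           ≡⟨ ⊕-identityˡ _ ⟩
          ⊝ T                     ∎
        at--1 : supp g (R ⊕ (⊝ Q)) ≡ 1
        at--1 = supp-≢0 g (λ eq → gT≢0 (trans (sym (hg (-≢0 1≢0) T)) (trans (cong g (sym R-Q)) eq)))
      -- A nonzero projection would again have the minimum weight. Then the bound `supp-push` is
      -- tight everywhere, and no nonzero coset of ⟨Q⟩ contains two vectors of the support, contrary
      -- to `two`.
      push≡0 : ∀ Y → Y ≢ zeroV → Fld.push Q g Y ≡ 0#
      push≡0 Y Y≢0 = decidable-stable (_ ≟ 0#) (λ ≢0 → ℕ.<⇒≱ two (subst (_≤ 1)
        (∑*-tight (λ Z _ → supp-push Q g Z)
          (ℕ.≤-trans (∑*-push-≤ Q≢0 (supp-homogeneous hg)) (ℕ.≤-trans light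
            (minimum-weight j (Fld.push Q g) (Fld.push-homogeneous Q hg) (FlatConstant-push j fc Q) Y≢0 ≢0)))
          (π≢0 Q≢0 R≢tQ))
        (δ≤1 (¬? (Fld.push Q g (π Q R) ≟ 0#)))))

    minimum-subspace : IsSubspace (Support₀ g)
    minimum-subspace = record { zero-closed = inj₁ refl ; ⊕-closed = add ; ·-closed = scale }
      where
      add : ∀ {X Y} → Support₀ g X → Support₀ g Y → Support₀ g (X ⊕ Y)
      add {Y = Y} (inj₁ refl) GY = subst (Support₀ g) (sym (⊕-identityˡ Y)) GY
      add {X} GX (inj₁ refl) = subst (Support₀ g) (sym (⊕-identityʳ X)) GX
      add {X} {Y} (inj₂ gX≢0) (inj₂ gY≢0) with X ≟ⱽ zeroV | (X ⊕ Y) ≟ⱽ zeroV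
      ... | _        | yes X⊕Y≡0 = inj₁ X⊕Y≡0
      ... | yes refl | no _      = inj₂ (λ eq → gY≢0 (trans (cong g (sym (⊕-identityˡ Y))) eq))
      ... | no X≢0   | no X⊕Y≢0  = inj₂ (minimum-closed X≢0 gX≢0 gY≢0 X⊕Y≢0)
      scale : ∀ a {X} → Support₀ g X → Support₀ g (a · X)
      scale a (inj₁ refl) = inj₁ (·-zeroʳ _ a)
      scale a {X} (inj₂ gX≢0) with a ≟ 0#
      ... | yes refl = inj₁ (·-zeroˡ X)
      ... | no a≢0   = inj₂ (λ eq → gX≢0 (trans (sym (hg a≢0 X)) eq))

  -- Vectors with nonzero first entry form q - 1 scaled copies of those with first entry 1; vectors
  -- with first entry 0 are left to the induction. This translates between points and nonzero
  -- vectors.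
  ∑-normalized : ∀ m {f : V m → ℕ} → Nat.Homogeneous f →
                 q₁ ℕ.* Nat.∑ⱽ (λ v → N.δ (normalized? v) ℕ.* f v) ≡ ∑* f
  ∑-normalized zero    {f} hf = ℕ.*-zeroʳ q₁
  ∑-normalized (suc m) {f} hf = ℕ.+-cancelʳ-≡ A _ _ (begin
    q₁ ℕ.* Nat.∑ⱽ (λ v → N.δ (normalized? v) ℕ.* f v) ℕ.+ A
      ≡⟨ cong (λ s → q₁ ℕ.* s ℕ.+ A) normalized-split ⟩
    q₁ ℕ.* (A ℕ.+ B) ℕ.+ A
      ≡⟨ cong (ℕ._+ A) (trans (ℕ.*-distribˡ-+ q₁ A B) (ℕ.+-comm (q₁ ℕ.* A) _)) ⟩
    q₁ ℕ.* B ℕ.+ q₁ ℕ.* A ℕ.+ A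
      ≡⟨ trans (ℕ.+-assoc (q₁ ℕ.* B) _ _) (cong (q₁ ℕ.* B ℕ.+_) (ℕ.+-comm (q₁ ℕ.* A) A)) ⟩
    q₁ ℕ.* B ℕ.+ suc q₁ ℕ.* A
      ≡⟨ cong₂ ℕ._+_ (∑-normalized m (λ {a} a≢0 X → trans (cong (λ z → f (z ∷ (a · X))) (sym (zeroʳ a))) (hf a≢0 (0# ∷ X))))
           (cong (ℕ._* A) (trans suc-q₁ (sym card))) ⟩
    ∑* (λ X → f (0# ∷ X)) ℕ.+ length elements ℕ.* A
      ≡⟨ cong₂ ℕ._+_ (N.∑-cong (allVecs m) (λ X → cong (ℕ._* f (0# ∷ X)) (star-0∷ X))) (∑-const elements A) ⟨
    e 0# ℕ.+ Nat.∑ᶠ (λ _ → A)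
      ≡⟨ Nat.∑ᶠ-constant-off-0 e A e≡A ⟨
    Nat.∑ᶠ e ℕ.+ A
      ≡⟨ cong (ℕ._+ A) (Nat.∑ⱽ-∷ (λ v → star v ℕ.* f v)) ⟨
    ∑* f ℕ.+ A ∎)
    where
    open ≡-Reasoning
    A B : ℕ
    A = Nat.∑ⱽ (λ X → f (1# ∷ X))
    B = Nat.∑ⱽ (λ X → N.δ (normalized? X) ℕ.* f (0# ∷ X))
    e : Carrier → ℕ
    e x = Nat.∑ⱽ (λ X → star (x ∷ X) ℕ.* f (x ∷ X))

    star-0∷ : ∀ X → star (0# ∷ X) ≡ star X
    star-0∷ X = N.δ-cong (¬? ((0# ∷ X) ≟ⱽ zeroV)) (¬? (X ≟ⱽ zeroV))
      (λ ≢0 eq → ≢0 (cong (0# ∷_) eq)) (λ ≢0 eq → ≢0 (Vec.∷-injectiveʳ eq))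

    e≡A : ∀ x → x ≢ 0# → e x ≡ A
    e≡A x x≢0 = begin
      Nat.∑ⱽ (λ X → star (x ∷ X) ℕ.* f (x ∷ X))
        ≡⟨ N.∑-cong (allVecs m) (λ X → trans (cong (ℕ._* f (x ∷ X)) (star-≢0 (λ eq → x≢0 (Vec.∷-injectiveˡ eq))))
             (trans (ℕ.*-identityˡ _) (sym (hf (inv-≢0 x≢0) (x ∷ X))))) ⟩
      Nat.∑ⱽ (λ X → f ((inv x * x) ∷ (inv x · X)))
        ≡⟨ Nat.∑ⱽ-scale (inv-≢0 x≢0) (λ X → f ((inv x * x) ∷ X)) ⟩
      Nat.∑ⱽ (λ X → f ((inv x * x) ∷ X))
        ≡⟨ N.∑-cong (allVecs m) (λ X → cong (λ z → f (z ∷ X)) (inv-* x≢0)) ⟩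
      A ∎

    δ-normalized : ∀ x X → N.δ (normalized? (x ∷ X)) ≡ N.δ (x ≟ 1#) ℕ.+ N.δ (x ≟ 0#) ℕ.* N.δ (normalized? X)
    δ-normalized x X with x ≟ 1# | x ≟ 0# | normalized? X
    ... | yes refl | yes 1≡0 | _     = ⊥-elim (1≢0 1≡0)
    ... | yes _    | no _    | _     = refl
    ... | no _     | yes _   | yes _ = refl
    ... | no _     | yes _   | no _  = refl
    ... | no _     | no _    | _     = refl

    normalized-split : Nat.∑ⱽ (λ v → N.δ (normalized? v) ℕ.* f v) ≡ A ℕ.+ B
    normalized-split = begin
      Nat.∑ⱽ (λ v → N.δ (normalized? v) ℕ.* f v)
        ≡⟨ Nat.∑ⱽ-∷ _ ⟩
      Nat.∑ᶠ (λ x → Nat.∑ⱽ (λ X → N.δ (normalized? (x ∷ X)) ℕ.* f (x ∷ X)))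
        ≡⟨ N.∑-cong elements (λ x → trans (N.∑-cong (allVecs m) (λ X → trans
             (cong (ℕ._* f (x ∷ X)) (δ-normalized x X))
             (trans (ℕ.*-distribʳ-+ (f (x ∷ X)) (N.δ (x ≟ 1#)) _)
               (cong (N.δ (x ≟ 1#) ℕ.* f (x ∷ X) ℕ.+_) (ℕ.*-assoc (N.δ (x ≟ 0#)) _ _)))))
             (trans (N.∑-+ (allVecs m) _ _) (cong₂ ℕ._+_ (N.∑-*ˡ (allVecs m) (N.δ (x ≟ 1#)) _)
               (N.∑-*ˡ (allVecs m) (N.δ (x ≟ 0#)) _)))) ⟩
      Nat.∑ᶠ (λ x → N.δ (x ≟ 1#) ℕ.* Nat.∑ⱽ (λ X → f (x ∷ X))
                ℕ.+ N.δ (x ≟ 0#) ℕ.* Nat.∑ⱽ (λ X → N.δ (normalized? X) ℕ.* f (x ∷ X)))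
        ≡⟨ N.∑-+ elements _ _ ⟩
      _ ≡⟨ cong₂ ℕ._+_ (Nat.∑ᶠ-δ 1# _) (Nat.∑ᶠ-δ 0# _) ⟩
      A ℕ.+ B ∎

  weight-∑* : ∀ {n} (c : Word n) (g : V (suc n) → Carrier) → Fld.Homogeneous g →
              (∀ v → Normalized v → c v ≡ g v) → q₁ ℕ.* weight c ≡ ∑* (supp g)
  weight-∑* {n} c g hg c≡g = trans (cong (q₁ ℕ.*_) (begin
    weight c
      ≡⟨ length-filter (λ v → ¬? (c v ≟ 0#)) (points n) ⟩
    N.∑ (points n) (supp c)
      ≡⟨ N.∑-filter normalized? (allVecs (suc n)) (λ v → N.δ-yes (normalized? v)) (λ v → N.δ-no (normalized? v)) _ ⟩
    Nat.∑ⱽ (λ v → N.δ (normalized? v) ℕ.* supp c v)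
      ≡⟨ N.∑-cong (allVecs (suc n)) (λ v → pointwise v (normalized? v)) ⟩
    Nat.∑ⱽ (λ v → N.δ (normalized? v) ℕ.* supp g v) ∎))
    (∑-normalized (suc n) (supp-homogeneous hg))
    where
    open ≡-Reasoning
    pointwise : ∀ v (d : Dec (Normalized v)) → N.δ d ℕ.* supp c v ≡ N.δ d ℕ.* supp g v
    pointwise v (yes nv) = cong (λ x → 1 ℕ.* N.δ (¬? (x ≟ 0#))) (c≡g v nv)
    pointwise v (no _)   = refl

  normalized⇒≢0 : ∀ {v : V m} → Normalized v → v ≢ zeroV
  normalized⇒≢0 {v = x ∷ v} (inj₁ x≡1)         eq = 1≢0 (trans (sym x≡1) (Vec.∷-injectiveˡ eq))
  normalized⇒≢0 {v = x ∷ v} (inj₂ (_ , nv)) eq = normalized⇒≢0 nv (Vec.∷-injectiveʳ eq)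

  normalize : ∀ {v : V m} → v ≢ zeroV → ∃ λ a → a ≢ 0# × Normalized (a · v)
  normalize {v = []}    v≢0 = ⊥-elim (v≢0 refl)
  normalize {v = x ∷ v} v≢0 with x ≟ 0#
  ... | no x≢0   = inv x , inv-≢0 x≢0 , inj₁ (inv-* x≢0)
  ... | yes refl = let a , a≢0 , nv = normalize (λ eq → v≢0 (cong (0# ∷_) eq)) in a , a≢0 , inj₂ (zeroʳ a , nv)

  normalized-unique : ∀ {v w : V m} a → Normalized v → Normalized w → v ≡ a · w → v ≡ w
  normalized-unique {v = x ∷ v} {y ∷ w} a (inj₁ refl) (inj₁ refl) eq = trans eq
    (trans (cong (_· (1# ∷ w)) (trans (sym (*-identityʳ a)) (sym (Vec.∷-injectiveˡ eq)))) (·-identity _))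
  normalized-unique {v = x ∷ v} {y ∷ w} a (inj₁ refl) (inj₂ (refl , _)) eq =
    ⊥-elim (1≢0 (trans (Vec.∷-injectiveˡ eq) (zeroʳ a)))
  normalized-unique {v = x ∷ v} {y ∷ w} a (inj₂ (refl , nv)) (inj₁ refl) eq =
    ⊥-elim (normalized⇒≢0 nv (trans (Vec.∷-injectiveʳ eq)
      (trans (cong (_· w) (trans (sym (*-identityʳ a)) (sym (Vec.∷-injectiveˡ eq)))) (·-zeroˡ w))))
  normalized-unique {v = x ∷ v} {y ∷ w} a (inj₂ (refl , nv)) (inj₂ (refl , nw)) eq =
    cong (0# ∷_) (normalized-unique a nv nw (Vec.∷-injectiveʳ eq))

-- The minimum weight of the code and the codewords attaining it

module MinimumWeight {p h : ℕ} (pr : Prime p) (1≤h : 1 ≤ h) (F : FiniteField (p ^ h)) (j k : ℕ) where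
  open MinimumWords pr 1≤h F public

  n κ : ℕ
  n = j ℕ.+ suc k
  κ = suc k

  instance
    q₁-nonZero : NonZero q₁
    q₁-nonZero = ℕ.>-nonZero 0<q₁

  -- The properties of a codeword on which the arguments about weights rest; the list of subspaces
  -- is forgotten. `fc` is stated for all subfields since both F and 𝔽ₚ will be needed.
  record HomogeneousExtension (c : Word n) : Set where
    field
      g    : V (suc n) → Carrier
      hg   : Fld.Homogeneous g
      gFp  : ∀ X → InFp (g X)
      fc   : ∀ M d → length (list M) ^ d ℕ.* q ^ κ ≡ q ^ suc n → FlatConstant M d g
      c≡g  : ∀ v → Normalized v → c v ≡ g v

    fc-whole : FlatConstant whole (suc j) g
    fc-whole = fc whole (suc j) (trans (cong (λ s → s ^ suc j ℕ.* q ^ κ) card)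
                                       (sym (ℕ.^-distribˡ-+-* q (suc j) κ)))

    weight-supp : q₁ ℕ.* weight c ≡ ∑* (supp g)
    weight-supp = weight-∑* c g hg c≡g

    nonzero-vector : 0 < weight c → ∃ λ X → X ≢ zeroV × g X ≢ 0#
    nonzero-vector pos =
      let X , X≢0 , sX = ∑*-<⇒∃ {suc n} {λ _ → 0} {supp g} none<supp in X , X≢0 , supp-pos g sX
      where
      0<q₁*w : ∀ {w} → 0 < w → 0 < q₁ ℕ.* w
      0<q₁*w {suc w} _ = ℕ.<-≤-trans 0<q₁ (ℕ.m≤m*n q₁ (suc w))
      none<supp : ∑* {suc n} (λ _ → 0) < ∑* (supp g)
      none<supp = subst₂ _<_ (sym (∑*-const (suc n) 0)) weight-supp (0<q₁*w pos)

  codeword-extension : ∀ (c : Word n) → Codeword n k c → HomogeneousExtension c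
  codeword-extension c (l , fl , sums) = record
    { g   = extension l
    ; hg  = extension-homogeneous l
    ; gFp = extension-InFp l fl
    ; fc  = λ M d size≡ → extension-flatConstant M d size≡ l
    ; c≡g = λ v nv → sym (extension-IncSum l (sums v nv)) }

  θ≤weight : ∀ (c : Word n) → Codeword n k c → ¬ (weight c ≡ 0) → θ q k ≤ weight c
  θ≤weight c cw w≢0 = ℕ.*-cancelˡ-≤ q₁ (begin
    q₁ ℕ.* θ q k       ≡⟨ q₁*θ k ⟩
    #* κ               ≤⟨ (let X , X≢0 , gX≢0 = nonzero-vector (ℕ.n≢0⇒n>0 w≢0)
                           in minimum-weight (suc j) g hg fc-whole X≢0 gX≢0) ⟩
    ∑* (supp g)        ≡⟨ weight-supp ⟨
    q₁ ℕ.* weight c    ∎)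
    where
    open HomogeneousExtension (codeword-extension c cw)
    open ℕ.≤-Reasoning

  bit : ∀ {i} → i ≤ 1 → i ≡ 0 ⊎ i ≡ 1
  bit z≤n       = inj₁ refl
  bit (s≤s z≤n) = inj₂ refl

  subspace-word : Σ (Word n) λ c → Codeword n k c × weight c ≡ θ q k
  subspace-word = c , codeword , ℕ.*-cancelˡ-≡ _ _ q₁ (begin
    q₁ ℕ.* weight c           ≡⟨ weight-∑* c c (extension-homogeneous l) (λ _ _ → refl) ⟩
    ∑* (supp c)               ≡⟨ ∑*-cong (λ X _ → supp-c X) ⟩
    ∑* (incidence B)          ≡⟨ ℕ.suc-injective (begin
      suc (∑* (incidence B))                      ≡⟨ ℕ.+-comm 1 _ ⟩
      ∑* (incidence B) ℕ.+ 1                      ≡⟨ cong (∑* (incidence B) ℕ.+_) (trans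
                                                       (cong (incidence B) (sym (lincomb-zero B)))
                                                       (incidence-independent ind zeroV)) ⟨
      ∑* (incidence B) ℕ.+ incidence B zeroV      ≡⟨ ∑*-split (incidence B) ⟩
      Nat.∑ⱽ (incidence B)                        ≡⟨ ∑-incidence B ⟩
      q ^ κ                                       ≡⟨ suc-#* κ ⟨
      suc (#* κ)                                  ∎) ⟩
    #* κ                      ≡⟨ q₁*θ k ⟨
    q₁ ℕ.* θ q k              ∎)
    where
    open ≡-Reasoning
    everything : IsSubspace {suc n} (λ _ → ⊤)
    everything = record { zero-closed = tt ; ⊕-closed = λ _ _ → tt ; ·-closed = λ _ _ → tt }
    open Basis (λ _ → yes tt) everything
    -- Any κ independent vectors span a suitable k-space; they come from the basis construction
    -- applied to the whole space.
    found : ∃ λ (B : Vec (V (suc n)) κ) → VAll.All (λ _ → ⊤) B × Independent B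
    found = basis κ (ℕ.≤-trans (ℕ.^-monoʳ-≤ q (ℕ.m≤n+m κ (suc j)))
      (ℕ.≤-reflexive (sym (trans (length-allVecs (suc n) 1) (ℕ.*-identityʳ _)))))
    B : Vec (V (suc n)) κ
    B = proj₁ found
    ind : Independent B
    ind = proj₂ (proj₂ found)
    S : Subspace n k
    S = record { basis = B ; independent = ind }
    l : List (Carrier × Subspace n k)
    l = (1# , S) ∷ []
    c : Word n
    c = extension l
    c≡ι : ∀ X → c X ≡ ι (incidence B X)
    c≡ι X = trans (+-identityʳ _) (*-identityˡ _)
    supp-c : ∀ X → supp c X ≡ incidence B X
    supp-c X = case bit (incidence≤1 ind X) of λ where
      (inj₁ eq) → trans (supp-≡0 c {X} (trans (c≡ι X) (cong ι eq))) (sym eq)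
      (inj₂ eq) → trans (supp-≢0 c {X} (λ cX≡0 → 1≢0 (trans (sym ι-1) (trans (cong ι (sym eq)) (trans (sym (c≡ι X)) cX≡0))))) (sym eq)
    codeword : Codeword n k c
    codeword = l , (1 , sym ι-1) All.∷ All.[] , λ v _ → case bit (incidence≤1 ind v) of λ where
      (inj₁ eq) → subst (IncSum v l) (sym (trans (c≡ι v) (cong ι eq)))
        (exc (λ (a , v≡) → ℕ.<⇒≢ (incidence≥1 B a) (trans (sym eq) (cong (incidence B) v≡))) nil)
      (inj₂ eq) → subst (IncSum v l) (sym (trans (c≡ι v) (cong ι eq)))
        (inc (let a , B≡v = incidence-member B (subst (0 <_) (sym eq) (s≤s z≤n)) in a , sym B≡v) nil)

  minimum-weight-words : ∀ (c : Word n) → Codeword n k c → weight c ≡ θ q k →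
                         Σ (Subspace n k) λ S → ScalarMultipleOfIncidence c (λ v → v ∈S S)
  minimum-weight-words c cw w≡θ = S , g R , gFp R , gR≢0 , λ v nv → on v nv , off v nv
    where
    open HomogeneousExtension (codeword-extension c cw)
    ∑≡ : ∑* (supp g) ≡ #* κ
    ∑≡ = trans (sym weight-supp) (trans (cong (q₁ ℕ.*_) w≡θ) (q₁*θ k))
    nonzero : ∃ λ X → X ≢ zeroV × g X ≢ 0#
    nonzero = nonzero-vector (subst (0 <_) (sym w≡θ) (0<θ k))
      where
      0<θ : ∀ k → 0 < θ q k
      0<θ zero    = s≤s z≤n
      0<θ (suc k) = ℕ.≤-trans (0<θ k) (ℕ.m≤m+n _ _)
    R = proj₁ nonzero
    R≢0 = proj₁ (proj₂ nonzero)
    gR≢0 = proj₂ (proj₂ nonzero)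
    open Basis (support₀? g) (minimum-subspace j g hg fc-whole (ℕ.≤-reflexive ∑≡))
    order≡ : order ≡ q ^ κ
    order≡ = trans (∑-support₀ g) (trans (cong suc ∑≡) (suc-#* κ))
    found : ∃ λ (B : Vec (V (suc n)) κ) → VAll.All (Support₀ g) B × Independent B
    found = basis κ (ℕ.≤-reflexive (sym order≡))
    S : Subspace n k
    S = record { basis = proj₁ found ; independent = proj₂ (proj₂ found) }
    on : ∀ v → Normalized v → v ∈S S → c v ≡ g R
    on v nv (a , v≡) = case subst (Support₀ g) (sym v≡) (span⊆ (proj₁ (proj₂ found)) a) of λ where
      (inj₁ v≡0)  → ⊥-elim (normalized⇒≢0 nv v≡0)
      (inj₂ gv≢0) → trans (c≡g v nv) (minimum-constant j g hg fc-whole (ℕ.≤-reflexive ∑≡)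
                                        (normalized⇒≢0 nv) gv≢0 R≢0 gR≢0)
    off : ∀ v → Normalized v → ¬ (v ∈S S) → c v ≡ 0#
    off v nv v∉S = trans (c≡g v nv) (decidable-stable (g v ≟ 0#) (λ gv≢0 →
      let a , eq = spans (proj₁ (proj₂ found)) (proj₂ (proj₂ found)) (ℕ.≤-reflexive order≡) (inj₂ gv≢0)
      in v∉S (a , sym eq)))

-- Jamison's bound for sets blocking the lines of an affine plane off the origin

module Jamison {p h : ℕ} (pr : Prime p) (1≤h : 1 ≤ h) (F : FiniteField (p ^ h)) where
  open Weights pr 1≤h F

  -- Functions given by polynomials of degree less than d, characterised by divisibility of f x - f r by x - r.
  data Degree< : ℕ → (Carrier → Carrier) → Set where
    zero   : ∀ {f} → (∀ x → f x ≡ 0#) → Degree< 0 f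
    divide : ∀ {d f} → (∀ r → ∃ λ g → Degree< d g × ∀ x → f x ≡ f r + (x + - r) * g x) → Degree< (suc d) f

  raise : ∀ {d f} → Degree< d f → Degree< (suc d) f
  raise {f = f} (zero f≡0) = divide λ r → (λ _ → 0#) , zero (λ _ → refl) , λ x →
    trans (f≡0 x) (sym (trans (cong₂ _+_ (f≡0 r) (zeroʳ _)) (+-identityˡ _)))
  raise (divide div) = divide λ r → let g , dg , eq = div r in g , raise dg , eq

  combine : ∀ {d f g} c → Degree< d f → Degree< d g → Degree< d (λ x → f x + c * g x)
  combine c (zero f≡0) (zero g≡0) = zero λ x →
    trans (cong₂ (λ a b → a + c * b) (f≡0 x) (g≡0 x)) (trans (+-identityˡ _) (zeroʳ c))
  combine {f = f} {g} c (divide div-f) (divide div-g) = divide λ r →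
    let f′ , df , eq-f = div-f r ; g′ , dg , eq-g = div-g r in
    (λ x → f′ x + c * g′ x) , combine c df dg , λ x → trans (cong₂ (λ a b → a + c * b) (eq-f x) (eq-g x))
      (solve 6 (λ fr gr y c f′ g′ → (fr :+ y :* f′) :+ c :* (gr :+ y :* g′) := (fr :+ c :* gr) :+ y :* (f′ :+ c :* g′))
        refl (f r) (g r) (x + - r) c (f′ x) (g′ x))
    where open SemiringSolver

  -- The quotient comes from x f x - r f r = (x - r) f x + r (f x - f r).
  times-x : ∀ {d f} → Degree< d f → Degree< (suc d) (λ x → x * f x)
  times-x {f = f} (zero f≡0) = raise (zero (λ x → trans (cong (x *_) (f≡0 x)) (zeroʳ x)))
  times-x {f = f} df@(divide div) = divide λ r →
    let g , dg , eq = div r in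
    (λ x → f x + r * g x) , combine r df (raise dg) , λ x → begin
      x * f x                                   ≡⟨ cong (_* f x) (trans (+-assoc x _ r) (trans (cong (x +_) (-‿inverseˡ r)) (+-identityʳ x))) ⟨
      (x + - r + r) * f x                       ≡⟨ distribʳ (f x) _ r ⟩
      (x + - r) * f x + r * f x                 ≡⟨ cong (λ z → (x + - r) * f x + r * z) (eq x) ⟩
      (x + - r) * f x + r * (f r + (x + - r) * g x)
        ≡⟨ solve 5 (λ y r fx fr gx → y :* fx :+ r :* (fr :+ y :* gx) := r :* fr :+ y :* (fx :+ r :* gx))
             refl (x + - r) r (f x) (f r) (g x) ⟩
      r * f r + (x + - r) * (f x + r * g x)     ∎
    where
    open SemiringSolver
    open ≡-Reasoning

  -- Dividing by x - r at one root r leaves a quotient that vanishes at the remaining roots, because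
  -- x - r is invertible there.
  Degree<-vanishes : ∀ {d f} → Degree< d f → ∀ {rs} → Unique rs → d ≤ length rs →
                     (∀ {r} → r ∈ rs → f r ≡ 0#) → ∀ x → f x ≡ 0#
  Degree<-vanishes (zero f≡0) _ _ _ = f≡0
  Degree<-vanishes {f = f} (divide div) {r ∷ rs} (r∉ ∷ u) (s≤s d≤) roots x =
    let g , dg , eq = div r
        f≡ : ∀ x → f x ≡ (x + - r) * g x
        f≡ x = trans (eq x) (trans (cong (_+ (x + - r) * g x) (roots (here refl))) (+-identityˡ _))
    in trans (f≡ x) (trans (cong ((x + - r) *_) (Degree<-vanishes dg u d≤ (λ {s} s∈ →
      *-cancelˡ (λ s-r≡0 → All.lookup r∉ s∈ (sym (trans (x+y≡0⇒x≡-y s-r≡0) (-‿involutive r))))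
        (trans (sym (f≡ s)) (trans (roots (there s∈)) (sym (zeroʳ _))))) x)) (zeroʳ _))

  pow : Carrier → ℕ → Carrier
  pow x zero    = 1#
  pow x (suc i) = x * pow x i

  pow-degree : ∀ i → Degree< (suc i) (λ x → pow x i)
  pow-degree zero    = divide λ r → (λ _ → 0#) , zero (λ _ → refl) , λ x →
    sym (trans (cong (1# +_) (zeroʳ _)) (+-identityʳ 1#))
  pow-degree (suc i) = times-x (pow-degree i)

  constant-degree : ∀ d c → Degree< (suc d) (λ _ → c)
  constant-degree zero    c = divide λ r → (λ _ → 0#) , zero (λ _ → refl) , λ x →
    sym (trans (cong (c +_) (zeroʳ _)) (+-identityʳ c))
  constant-degree (suc d) c = raise (constant-degree d c)

  nonzeros : List Carrier
  nonzeros = filter (λ x → ¬? (x ≟ 0#)) elements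

  length-nonzeros : length nonzeros ≡ q₁
  length-nonzeros = ℕ.suc-injective (begin
    suc (length nonzeros)                                          ≡⟨ cong suc (length-filter _ elements) ⟩
    suc (Nat.∑ᶠ (λ x → N.δ (¬? (x ≟ 0#))))                         ≡⟨ ℕ.+-comm 1 _ ⟩
    Nat.∑ᶠ (λ x → N.δ (¬? (x ≟ 0#))) ℕ.+ 1                         ≡⟨ Nat.∑ᶠ-constant-off-0 _ 1 (λ t t≢0 → N.δ-yes (¬? (t ≟ 0#)) t≢0) ⟩
    N.δ (¬? (0# ≟ 0#)) ℕ.+ Nat.∑ᶠ (λ _ → 1)                        ≡⟨ cong₂ ℕ._+_ (N.δ-no (¬? (0# ≟ 0#)) (λ ≢0 → ≢0 refl))
                                                                       (trans (∑-const elements 1) (ℕ.*-identityʳ _)) ⟩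
    length elements                                                ≡⟨ trans card (sym suc-q₁) ⟩
    suc q₁                                                         ∎) where open ≡-Reasoning

  pow-* : ∀ x y i → pow (x * y) i ≡ pow x i * pow y i
  pow-* x y zero    = sym (*-identityˡ 1#)
  pow-* x y (suc i) = trans (cong (x * y *_) (pow-* x y i))
    (solve 4 (λ x y a b → x :* y :* (a :* b) := x :* a :* (y :* b)) refl x y (pow x i) (pow y i))
    where open SemiringSolver

  -- If some nonzero y has y^i ≠ 1, the substitution x ↦ y x multiplies the sum by y^i and so kills
  -- it. Otherwise, for positive i, the polynomial x^i - 1 would have q - 1 > i roots and vanish
  -- identically, although its value at 0 is - 1.
  power-sum : ∀ i → i < q₁ → Fld.∑ᶠ (λ x → pow x i) ≡ 0#
  power-sum zero    _    = ∑ᶠ-const 1#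
  power-sum (suc i) i<q₁ with ∃ᶠ? (λ y → ¬? (y ≟ 0#) ×-dec ¬? (pow y (suc i) ≟ 1#))
  ... | yes (y , y≢0 , y^i≢1) = *-cancelˡ (λ eq → y^i≢1 (trans (x+y≡0⇒x≡-y eq) (-‿involutive 1#))) (begin
    (pow y (suc i) + - 1#) * P     ≡⟨ trans (distribʳ P _ _) (cong (pow y (suc i) * P +_) (-1*x≈-x P)) ⟩
    pow y (suc i) * P + - P        ≡⟨ cong (_+ - P) (S.∑-*ˡ elements _ _) ⟨
    Fld.∑ᶠ (λ x → pow y (suc i) * pow x (suc i)) + - P ≡⟨ cong (_+ - P) (S.∑-cong elements (λ x → sym (pow-* y x (suc i)))) ⟩
    Fld.∑ᶠ (λ x → pow (y * x) (suc i)) + - P ≡⟨ cong (_+ - P) (Fld.∑ᶠ-scale y≢0 (λ x → pow x (suc i))) ⟩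
    P + - P                        ≡⟨ -‿inverseʳ P ⟩
    0#                             ≡⟨ zeroʳ _ ⟨
    (pow y (suc i) + - 1#) * 0#    ∎)
    where
    open ≡-Reasoning
    P = Fld.∑ᶠ (λ x → pow x (suc i))
  ... | no none = ⊥-elim (-≢0 1≢0 (trans (sym (trans (cong₂ _+_ (zeroˡ _) (*-identityʳ _)) (+-identityˡ _)))
    (Degree<-vanishes (combine (- 1#) (pow-degree (suc i)) (constant-degree (suc i) 1#))
      (Unique.filter⁺ (λ x → ¬? (x ≟ 0#)) distinct) (subst (suc (suc i) ≤_) (sym length-nonzeros) i<q₁)
      (λ {r} r∈ → let _ , r≢0 = ∈-filter⁻ (λ x → ¬? (x ≟ 0#)) {xs = elements} r∈ in
        trans (cong (_+ - 1# * 1#) (decidable-stable (pow r (suc i) ≟ 1#) (λ ≢1 → none (r , r≢0 , ≢1))))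
          (trans (cong (1# +_) (*-identityʳ _)) (-‿inverseʳ 1#))) 0#)))

  form : Carrier → Carrier → Carrier × Carrier → Carrier
  form α β (u , t) = α * u + β * t + - 1#

  ∏forms : Carrier → Carrier → List (Carrier × Carrier) → Carrier
  ∏forms α β []      = 1#
  ∏forms α β (P ∷ l) = form α β P * ∏forms α β l

  -- The monomial is carried along for the induction: expanding one form raises i or j by at most
  -- one while the list gets shorter. At the end i + j < 2(q - 1), so one exponent is below q - 1
  -- and `power-sum` applies.
  ∑forms : ∀ l i j → i ℕ.+ j ℕ.+ length l < q₁ ℕ.+ q₁ →
           Fld.∑ᶠ (λ α → Fld.∑ᶠ (λ β → pow α i * pow β j * ∏forms α β l)) ≡ 0#
  ∑forms [] i j lt = begin
    Fld.∑ᶠ (λ α → Fld.∑ᶠ (λ β → pow α i * pow β j * 1#))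
      ≡⟨ S.∑-cong elements (λ α → trans (S.∑-cong elements (λ β → *-identityʳ _)) (S.∑-*ˡ elements _ _)) ⟩
    Fld.∑ᶠ (λ α → pow α i * Fld.∑ᶠ (λ β → pow β j))
      ≡⟨ S.∑-*ʳ elements _ _ ⟩
    Fld.∑ᶠ (λ α → pow α i) * Fld.∑ᶠ (λ β → pow β j)
      ≡⟨ vanish ⟩
    0# ∎
    where
    open ≡-Reasoning
    vanish : Fld.∑ᶠ (λ α → pow α i) * Fld.∑ᶠ (λ β → pow β j) ≡ 0#
    vanish with i ℕ.<? q₁ | j ℕ.<? q₁
    ... | yes i< | _      = trans (cong (_* _) (power-sum i i<)) (zeroˡ _)
    ... | no _   | yes j< = trans (cong (_ *_) (power-sum j j<)) (zeroʳ _)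
    ... | no i≮  | no j≮  = ⊥-elim (ℕ.<⇒≱ (subst (_< q₁ ℕ.+ q₁) (ℕ.+-identityʳ _) lt)
                                         (ℕ.+-mono-≤ (ℕ.≮⇒≥ i≮) (ℕ.≮⇒≥ j≮)))
  ∑forms ((u , t) ∷ l) i j lt = begin
    Fld.∑ᶠ (λ α → Fld.∑ᶠ (λ β → pow α i * pow β j * (form α β (u , t) * ∏forms α β l)))
      ≡⟨ S.∑-cong elements (λ α → S.∑-cong elements (λ β →
           solve 8 (λ a b α β u t m r → a :* b :* ((α :* u :+ β :* t :+ m) :* r)
             := u :* (α :* a :* b :* r) :+ (t :* (a :* (β :* b) :* r) :+ m :* (a :* b :* r)))
           refl (pow α i) (pow β j) α β u t (- 1#) (∏forms α β l))) ⟩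
    Fld.∑ᶠ (λ α → Fld.∑ᶠ (λ β → u * T (suc i) j α β + (t * T i (suc j) α β + - 1# * T i j α β)))
      ≡⟨ ∑∑-+ _ _ ⟩
    ∑∑ (λ α β → u * T (suc i) j α β) + ∑∑ (λ α β → t * T i (suc j) α β + - 1# * T i j α β)
      ≡⟨ cong (∑∑ (λ α β → u * T (suc i) j α β) +_) (∑∑-+ _ _) ⟩
    ∑∑ (λ α β → u * T (suc i) j α β) + (∑∑ (λ α β → t * T i (suc j) α β) + ∑∑ (λ α β → - 1# * T i j α β))
      ≡⟨ cong₂ _+_ (scaled u (suc i) j lt′) (cong₂ _+_
           (scaled t i (suc j) (subst (λ z → z ℕ.+ length l < q₁ ℕ.+ q₁) (sym (ℕ.+-suc i j)) lt′))
           (scaled (- 1#) i j (ℕ.≤-trans (ℕ.n≤1+n _) lt′))) ⟩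
    0# + (0# + 0#)
      ≡⟨ trans (+-identityˡ _) (+-identityˡ _) ⟩
    0# ∎
    where
    open SemiringSolver
    open ≡-Reasoning
    lt′ : suc (i ℕ.+ j ℕ.+ length l) < q₁ ℕ.+ q₁
    lt′ = subst (_< q₁ ℕ.+ q₁) (ℕ.+-suc (i ℕ.+ j) (length l)) lt
    T : ℕ → ℕ → Carrier → Carrier → Carrier
    T i j α β = pow α i * pow β j * ∏forms α β l
    ∑∑ : (Carrier → Carrier → Carrier) → Carrier
    ∑∑ f = Fld.∑ᶠ (λ α → Fld.∑ᶠ (λ β → f α β))
    ∑∑-+ : ∀ f g → ∑∑ (λ α β → f α β + g α β) ≡ ∑∑ f + ∑∑ g
    ∑∑-+ f g = trans (S.∑-cong elements (λ α → S.∑-+ elements (f α) (g α))) (S.∑-+ elements _ _)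
    scaled : ∀ a i j → i ℕ.+ j ℕ.+ length l < q₁ ℕ.+ q₁ → ∑∑ (λ α β → a * T i j α β) ≡ 0#
    scaled a i j lt = trans (S.∑-cong elements (λ α → S.∑-*ˡ elements a _))
      (trans (S.∑-*ˡ elements a _) (trans (cong (a *_) (∑forms l i j lt)) (zeroʳ a)))

  ∏forms-≡0 : ∀ {α β l P} → P ∈ l → form α β P ≡ 0# → ∏forms α β l ≡ 0#
  ∏forms-≡0 {α} {β} {P ∷ l} (here refl) eq = trans (cong (_* ∏forms α β l) eq) (zeroˡ _)
  ∏forms-≡0 {α} {β} {P ∷ l} (there P∈)  eq = trans (cong (form α β P *_) (∏forms-≡0 P∈ eq)) (zeroʳ _)

  ∏forms-00 : ∀ l → ∏forms 0# 0# l ≢ 0#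
  ∏forms-00 []            = 1≢0
  ∏forms-00 ((u , t) ∷ l) = *-≢0 (λ eq → -≢0 1≢0 (trans (sym (trans
    (cong (_+ - 1#) (trans (cong₂ _+_ (zeroˡ u) (zeroˡ t)) (+-identityˡ 0#))) (+-identityˡ _))) eq)) (∏forms-00 l)

  -- The product of the forms αu + βt - 1 over the blocking points (u , t) vanishes for all (α , β)
  -- except (0 , 0), so its degree is at least 2(q - 1).
  jamison : ∀ (e : Carrier → Carrier → Carrier) →
    (∀ α β → ¬ (α ≡ 0# × β ≡ 0#) → ∃₂ λ u t → e u t ≢ 0# × α * u + β * t ≡ 1#) →
    q₁ ℕ.+ q₁ ≤ Nat.∑ᶠ (λ u → Nat.∑ᶠ (λ t → N.δ (¬? (e u t ≟ 0#))))
  jamison e blocks = ℕ.≮⇒≥ λ lt → ∏forms-00 pts (begin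
    ∏forms 0# 0# pts
      -- The product is concentrated at (0 , 0), so its value there equals the sum over all (α , β).
      ≡⟨ trans (Fld.∑ᶠ-δ 0# (λ α → Fld.∑ᶠ (λ β → S.δ (β ≟ 0#) * ∏forms α β pts))) (Fld.∑ᶠ-δ 0# (λ β → ∏forms 0# β pts)) ⟨
    Fld.∑ᶠ (λ α → S.δ (α ≟ 0#) * Fld.∑ᶠ (λ β → S.δ (β ≟ 0#) * ∏forms α β pts))
      ≡⟨ S.∑-cong elements (λ α → trans (sym (S.∑-*ˡ elements _ _)) (S.∑-cong elements (λ β → concentrated α β))) ⟩
    Fld.∑ᶠ (λ α → Fld.∑ᶠ (λ β → 1# * 1# * ∏forms α β pts))
      ≡⟨ ∑forms pts 0 0 (subst (_< q₁ ℕ.+ q₁) (sym length-pts) lt) ⟩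
    0# ∎)
    where
    open ≡-Reasoning
    blocked? : ∀ P → Dec (e (proj₁ P) (proj₂ P) ≢ 0#)
    blocked? (u , t) = ¬? (e u t ≟ 0#)
    pts : List (Carrier × Carrier)
    pts = filter blocked? (cartesianProduct elements elements)
    ∑-cartesian : ∀ xs (f : Carrier × Carrier → ℕ) →
      N.∑ (cartesianProduct xs elements) f ≡ N.∑ xs (λ u → Nat.∑ᶠ (λ t → f (u , t)))
    ∑-cartesian []       f = refl
    ∑-cartesian (x ∷ xs) f = trans (N.∑-++ (map (x ,_) elements) _ f)
      (cong₂ ℕ._+_ (N.∑-map (x ,_) elements f) (∑-cartesian xs f))
    length-pts : length pts ≡ Nat.∑ᶠ (λ u → Nat.∑ᶠ (λ t → N.δ (¬? (e u t ≟ 0#))))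
    length-pts = trans (length-filter blocked? (cartesianProduct elements elements)) (∑-cartesian elements _)
    vanish : ∀ {α β} → ¬ (α ≡ 0# × β ≡ 0#) → ∏forms α β pts ≡ 0#
    vanish {α} {β} ≢00 = let u , t , e≢0 , eq = blocks α β ≢00 in
      ∏forms-≡0 (∈-filter⁺ blocked? (∈-cartesianProduct⁺ (complete u) (complete t)) e≢0)
                (trans (cong (_+ - 1#) eq) (-‿inverseʳ 1#))
    concentrated : ∀ α β → S.δ (α ≟ 0#) * (S.δ (β ≟ 0#) * ∏forms α β pts) ≡ 1# * 1# * ∏forms α β pts
    concentrated α β with α ≟ 0# | β ≟ 0#
    ... | yes _  | yes _ = sym (*-assoc _ _ _)
    ... | yes _  | no β≢0 = trans (*-identityˡ _) (trans (zeroˡ _) (sym (trans (cong (1# * 1# *_) (vanish (β≢0 ∘ proj₂))) (zeroʳ _))))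
    ... | no α≢0 | _ = trans (zeroˡ _) (sym (trans (cong (1# * 1# *_) (vanish (α≢0 ∘ proj₁))) (zeroʳ _)))

-- Numerical consequences of the weight bound

<-by-slack : ∀ {a b} c → a ℕ.+ suc c ≡ b → a < b
<-by-slack c refl = ℕ.m<m+n _ (s≤s z≤n)

-- With q₁ = 1 + a the difference of the two sides, multiplied by 7, is a polynomial with
-- nonnegative coefficients, written out in `slack`. The other estimates follow the same scheme.
light<#*suc : ∀ W K {q₁} → 0 < q₁ → 7 ℕ.* W ≤ 12 ℕ.* K ℕ.+ 5 ℕ.* q₁ → W < suc q₁ ℕ.* K ℕ.+ q₁
light<#*suc W K {suc a} _ le = ℕ.*-cancelˡ-< 7 _ _ (ℕ.≤-<-trans le (<-by-slack _ (slack K a)))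
  where
  slack : ∀ K a → 12 ℕ.* K ℕ.+ 5 ℕ.* suc a ℕ.+ suc (1 ℕ.+ 2 ℕ.* a ℕ.+ 2 ℕ.* K ℕ.+ 7 ℕ.* a ℕ.* K)
                ≡ 7 ℕ.* (suc (suc a) ℕ.* K ℕ.+ suc a)
  slack = solve-∀

light<2#* : ∀ H K {q₁} → 0 < q₁ → 7 ℕ.* (H ℕ.+ q₁) ≤ 12 ℕ.* K ℕ.+ 5 ℕ.* q₁ → H < 2 ℕ.* K
light<2#* H K {suc a} _ le = ℕ.*-cancelˡ-< 7 _ _ (ℕ.+-cancelʳ-< (7 ℕ.* suc a) _ _
  (ℕ.≤-<-trans (subst (_≤ 12 ℕ.* K ℕ.+ 5 ℕ.* suc a) (ℕ.*-distribˡ-+ 7 H (suc a)) le) (<-by-slack _ (slack K a))))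
  where
  slack : ∀ K a → 12 ℕ.* K ℕ.+ 5 ℕ.* suc a ℕ.+ suc (1 ℕ.+ 2 ℕ.* a ℕ.+ 2 ℕ.* K) ≡ 7 ℕ.* (2 ℕ.* K) ℕ.+ 7 ℕ.* suc a
  slack = solve-∀

-- The inequality behind this is 12 N + 3 q₁ < 2 q₁ N, which holds for N ≥ q₁ ≥ 8.
light-plane : ∀ H N {q₁} → 8 ≤ q₁ → q₁ ≤ N →
  7 ℕ.* (H ℕ.+ (q₁ ℕ.+ q₁)) ≤ 12 ℕ.* (suc q₁ ℕ.* N ℕ.+ q₁) ℕ.+ 5 ℕ.* q₁ → H < (q₁ ℕ.+ q₁) ℕ.* N
light-plane H N 8≤q₁ q₁≤N le with ℕ.m≤n⇒∃[o]m+o≡n 8≤q₁ | ℕ.m≤n⇒∃[o]m+o≡n q₁≤N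
... | a , refl | b , refl = ℕ.*-cancelˡ-< 7 _ _ (ℕ.+-cancelʳ-< (7 ℕ.* (q₁ ℕ.+ q₁)) _ _
  (ℕ.≤-<-trans (subst (_≤ 12 ℕ.* (suc q₁ ℕ.* (q₁ ℕ.+ b) ℕ.+ q₁) ℕ.+ 5 ℕ.* q₁) (ℕ.*-distribˡ-+ 7 H _) le) (<-by-slack _ (slack a b))))
  where
  q₁ : ℕ
  q₁ = 8 ℕ.+ a
  slack : ∀ a b → 12 ℕ.* (suc (8 ℕ.+ a) ℕ.* (8 ℕ.+ a ℕ.+ b) ℕ.+ (8 ℕ.+ a)) ℕ.+ 5 ℕ.* (8 ℕ.+ a)
                  ℕ.+ suc (7 ℕ.+ a ℕ.+ 4 ℕ.* b ℕ.+ 2 ℕ.* a ℕ.* (8 ℕ.+ a ℕ.+ b))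
                ≡ 7 ℕ.* ((8 ℕ.+ a ℕ.+ (8 ℕ.+ a)) ℕ.* (8 ℕ.+ a ℕ.+ b)) ℕ.+ 7 ℕ.* (8 ℕ.+ a ℕ.+ (8 ℕ.+ a))
  slack = solve-∀

-- The two bounds are incompatible as soon as (5p - 14) q₁ < (2p - 14) K. Because K ≥ (p + 1) q₁,
-- this follows from 17 p < 2 p², which is true from p = 9 on.
no-light-dual-word : ∀ {p} W K {q₁} → 9 ≤ p → 0 < q₁ → suc p ℕ.* q₁ ≤ K →
  7 ℕ.* W ≤ 12 ℕ.* K ℕ.+ 5 ℕ.* q₁ →
  (ℕ.pred p ℕ.* K ℕ.+ q₁) ℕ.+ (ℕ.pred p ℕ.* K ℕ.+ q₁) ≤ p ℕ.* W → ⊥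
no-light-dual-word W K {suc a} 9≤p _ K≥ light heavy with ℕ.m≤n⇒∃[o]m+o≡n 9≤p | ℕ.m≤n⇒∃[o]m+o≡n K≥
... | r , refl | b , refl = ℕ.<-irrefl refl (begin-strict
  (9 ℕ.+ r) ℕ.* (7 ℕ.* W)                                      ≤⟨ ℕ.*-monoʳ-≤ (9 ℕ.+ r) light ⟩
  (9 ℕ.+ r) ℕ.* (12 ℕ.* K ℕ.+ 5 ℕ.* suc a)                     <⟨ <-by-slack _ (slack r a b) ⟩
  7 ℕ.* (((8 ℕ.+ r) ℕ.* K ℕ.+ suc a) ℕ.+ ((8 ℕ.+ r) ℕ.* K ℕ.+ suc a)) ≤⟨ ℕ.*-monoʳ-≤ 7 heavy ⟩
  7 ℕ.* ((9 ℕ.+ r) ℕ.* W)                                      ≡⟨ comm r W ⟩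
  (9 ℕ.+ r) ℕ.* (7 ℕ.* W)                                      ∎)
  where
  open ℕ.≤-Reasoning
  comm : ∀ r W → 7 ℕ.* ((9 ℕ.+ r) ℕ.* W) ≡ (9 ℕ.+ r) ℕ.* (7 ℕ.* W)
  comm = solve-∀
  slack : ∀ r a b → (9 ℕ.+ r) ℕ.* (12 ℕ.* ((10 ℕ.+ r) ℕ.* suc a ℕ.+ b) ℕ.+ 5 ℕ.* suc a)
      ℕ.+ suc (8 ℕ.+ 9 ℕ.* a ℕ.+ 19 ℕ.* r ℕ.* suc a ℕ.+ 2 ℕ.* r ℕ.* r ℕ.* suc a ℕ.+ 4 ℕ.* b ℕ.+ 2 ℕ.* r ℕ.* b)
    ≡ 7 ℕ.* (((8 ℕ.+ r) ℕ.* ((10 ℕ.+ r) ℕ.* suc a ℕ.+ b) ℕ.+ suc a)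
        ℕ.+ ((8 ℕ.+ r) ℕ.* ((10 ℕ.+ r) ℕ.* suc a ℕ.+ b) ℕ.+ suc a))
  slack = solve-∀

-- The estimates are stated from 9 on, so only the composite number 8 has to be excluded.
prime>7⇒≥9 : ∀ {p} → Prime p → 7 < p → 9 ≤ p
prime>7⇒≥9 {p} pr 7<p with 8 ℕ.≟ p
... | no 8≢p = ℕ.≤∧≢⇒< 7<p 8≢p
... | yes refl with prime⇒irreducible pr {2} (divides 4 refl)
...   | inj₁ ()
...   | inj₂ ()

-- Tangent lines, line sums and residues of light words

module Constancy {p h : ℕ} (pr : Prime p) (1≤h : 1 ≤ h) (F : FiniteField (p ^ h)) (9≤p : 9 ≤ p) where
  open Weights pr 1≤h F public
  open Jamison pr 1≤h F public using (jamison)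

  private variable
    m : ℕ

  p≤q : p ≤ q
  p≤q = ℕ.≤-trans (ℕ.≤-reflexive (sym (ℕ.^-identityʳ p))) (ℕ.^-monoʳ-≤ p {{prime⇒nonZero pr}} 1≤h)

  8≤q₁ : 8 ≤ q₁
  8≤q₁ = ℕ.≤-pred (subst (9 ≤_) (sym suc-q₁) (ℕ.≤-trans 9≤p p≤q))

  suc-p*q₁≤#* : ∀ i → suc p ℕ.* q₁ ≤ #* (suc (suc i))
  suc-p*q₁≤#* i = begin
    q₁ ℕ.+ p ℕ.* q₁        ≡⟨ ℕ.+-comm q₁ _ ⟩
    p ℕ.* q₁ ℕ.+ q₁        ≤⟨ ℕ.+-monoˡ-≤ q₁ (ℕ.*-monoˡ-≤ q₁ p≤q) ⟩
    q ℕ.* q₁ ℕ.+ q₁        ≡⟨ cong (λ z → q ℕ.* z ℕ.+ q₁) #*-1 ⟨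
    q ℕ.* #* 1 ℕ.+ q₁      ≡⟨ #*-suc 1 ⟨
    #* 2                   ≤⟨ #*-mono (s≤s (s≤s z≤n)) ⟩
    #* (suc (suc i))       ∎ where open ℕ.≤-Reasoning

  Light : ∀ κ → (V m → ℕ) → Set
  Light κ f = 7 ℕ.* ∑* f ≤ 12 ℕ.* #* κ ℕ.+ 5 ℕ.* q₁

  Light-mono : ∀ {κ a b} {f : V a → ℕ} {g : V b → ℕ} → ∑* f ≤ ∑* g → Light κ g → Light κ f
  Light-mono f≤g = ℕ.≤-trans (ℕ.*-monoʳ-≤ 7 f≤g)

  Light⇒<#* : ∀ {κ m′} {f : V m → ℕ} → suc κ ≤ m′ → Light κ f → ∑* f < #* m′
  Light⇒<#* {κ = κ} {m′} {f} κ<m′ light = ℕ.<-≤-trans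
    (subst (∑* f <_) (trans (cong (λ z → z ℕ.* #* κ ℕ.+ q₁) suc-q₁) (sym (#*-suc κ))) (light<#*suc _ (#* κ) 0<q₁ light))
    (#*-mono κ<m′)

  -- Pigeonhole: the projection of f adds up to less than the number of nonzero vectors of the
  -- quotient, so it is 0 at one of them. The corresponding line through R contains no further point
  -- of f.
  unsecant : ∀ {R : V (suc m)} → R ≢ zeroV → ∀ {f} → Nat.Homogeneous f → ∑* f < #* m →
             ∃ λ Y → Y ≢ zeroV × Nat.push R f Y ≡ 0
  unsecant R≢0 {f} hf lt =
    let Y , Y≢0 , small = ∑*-<⇒∃ {g = λ _ → 1} (ℕ.≤-<-trans (∑*-push-≤ R≢0 hf) lt) in
    Y , Y≢0 , ℕ.n≤0⇒n≡0 (ℕ.≤-pred small)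

  push-≡0 : ∀ {R : V (suc m)} {f Y} → Nat.push R f Y ≡ 0 → ∀ t → f (sec R Y ⊕ (t · R)) ≡ 0
  push-≡0 {R = R} {f} {Y} eq t = ℕ.n≤0⇒n≡0 (subst (f (sec R Y ⊕ (t · R)) ≤_) eq
    (term≤∑ (λ t → f (sec R Y ⊕ (t · R))) (complete t)))

  -- With Q = sec R Y, the point R is the only one on the line RQ at which f is nonzero.
  unsecant-zero : ∀ {R : V (suc m)} {f} → Nat.Homogeneous f → ∀ {Y} → Nat.push R f Y ≡ 0 →
                  ∀ {t} u → t ≢ 0# → f ((u · R) ⊕ (t · sec R Y)) ≡ 0
  unsecant-zero {R = R} {f} hf {Y} eq {t} u t≢0 = begin
    f ((u · R) ⊕ (t · sec R Y))                   ≡⟨ hf (inv-≢0 t≢0) _ ⟨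
    f (inv t · ((u · R) ⊕ (t · sec R Y)))         ≡⟨ cong f (·-distribˡ (inv t) _ _) ⟩
    f ((inv t · (u · R)) ⊕ (inv t · (t · sec R Y))) ≡⟨ cong f (cong₂ _⊕_ (sym (·-assoc _ u R)) (inv-· t≢0 _)) ⟩
    f (((inv t * u) · R) ⊕ sec R Y)               ≡⟨ cong f (⊕-comm _ _) ⟩
    f (sec R Y ⊕ ((inv t * u) · R))               ≡⟨ push-≡0 {R = R} {f} {Y} eq _ ⟩
    0                                             ∎ where open ≡-Reasoning

  sec≢0 : ∀ {R : V (suc m)} → R ≢ zeroV → ∀ {Y} → Y ≢ zeroV → sec R Y ≢ zeroV
  sec≢0 {R = R} R≢0 Y≢0 eq = sec-independent R≢0 Y≢0 0# (trans eq (sym (·-zeroˡ R)))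

  -- The multiples of Q contribute g 0 + (q - 1) g Q, which is g 0 - g Q in F.
  line-sum-zero : ∀ {g : V m → Carrier} → Fld.Homogeneous g → ∀ Q →
                  Fld.line elements Q g zeroV + g Q ≡ g zeroV
  line-sum-zero hg Q = trans (Fld.line-0 hg Q) (trans (cong (_ +_) (∑ᶠ-const _)) (+-identityʳ _))

  line-sum : ∀ {g : V m → Carrier} → Fld.Homogeneous g → FlatConstant whole 1 g → ∀ Q X →
             Fld.line elements Q g X + g Q ≡ g zeroV
  line-sum hg fc Q X = trans (cong (_+ _) (fc (Q ∷ []) X)) (line-sum-zero hg Q)

  -- Least residues as natural numbers: their sums can be estimated in size while remaining known
  -- modulo p.
  residue : ∀ {f : V m → Carrier} → Fld.Homogeneous f → (∀ X → InFp (f X)) →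
            ∃ λ (γ : V m → ℕ) → Nat.Homogeneous γ × (∀ X → ι (γ X) ≡ f X) × (∀ X → γ X < p)
  residue {f = f} hf fFp = γ , (λ a≢0 X → ι-injective (γ<p _) (γ<p X) (trans (ιγ _) (trans (hf a≢0 X) (sym (ιγ X))))) , ιγ , γ<p
    where
    instance _ = prime⇒nonZero pr
    γ : _ → ℕ
    γ X = proj₁ (fFp X) % p
    ιγ : ∀ X → ι (γ X) ≡ f X
    ιγ X = trans (ι-% (proj₁ (fFp X))) (sym (proj₂ (fFp X)))
    γ<p : ∀ X → γ X < p
    γ<p X = m%n<n (proj₁ (fFp X)) p

  suc-pred-p : suc (ℕ.pred p) ≡ p
  suc-pred-p = ℕ.suc-pred p {{prime⇒nonZero pr}}

  -- On every line through R the values other than that at R add up to - 1 modulo p.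
  residue-sum : ∀ {κ} {f : V (suc κ) → Carrier} {R} → R ≢ zeroV →
    (∀ X → Fld.line elements R f X ≡ - 1#) → f R ≡ 1# →
    ∀ {γ : V (suc κ) → ℕ} → Nat.Homogeneous γ → (∀ X → ι (γ X) ≡ f X) →
    ℕ.pred p ℕ.* #* κ ℕ.+ q₁ ≤ ∑* γ
  residue-sum {κ} {f} {R} R≢0 line≡-1 fR≡1 {γ} hγ ιγ = begin
    ℕ.pred p ℕ.* #* κ ℕ.+ q₁                    ≡⟨ cong₂ ℕ._+_ (∑*-const κ _) (ℕ.*-identityʳ q₁) ⟨
    ∑* {κ} (λ _ → ℕ.pred p) ℕ.+ q₁ ℕ.* 1        ≤⟨ ℕ.+-mono-≤ (∑*-mono (λ Y _ → push≥ Y)) (ℕ.*-monoʳ-≤ q₁ γR≥1) ⟩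
    ∑* (Nat.push R γ) ℕ.+ q₁ ℕ.* γ R            ≡⟨ ∑*-push R≢0 hγ ⟨
    ∑* γ                                        ∎
    where
    open ℕ.≤-Reasoning
    γR≥1 : 1 ≤ γ R
    γR≥1 = ℕ.n≢0⇒n>0 (λ γR≡0 → 1≢0 (trans (sym fR≡1) (trans (sym (ιγ R)) (cong ι γR≡0))))
    push≥ : ∀ Y → ℕ.pred p ≤ Nat.push R γ Y
    -- A natural number congruent to - 1 modulo p is at least p - 1.
    push≥ Y = ℕ.≤-pred (subst (_≤ suc (Nat.push R γ Y)) (sym suc-pred-p) (ι≡0⇒p≤ (s≤s z≤n)
      (trans (cong (1# +_) (trans (ι-∑ elements _) (trans (S.∑-cong elements (λ t → ιγ _)) (line≡-1 (sec R Y)))))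
             (-‿inverseʳ 1#))))

  module _ (e : Carrier → Carrier) (few : Nat.∑ᶠ (λ t → N.δ (¬? (e t ≟ 0#))) < 2) {t₀} (e≢0 : e t₀ ≢ 0#) where

    single-zero : ∀ {t} → t ≢ t₀ → e t ≡ 0#
    single-zero {t} t≢t₀ = decidable-stable (e t ≟ 0#) (λ et≢0 → ℕ.<⇒≱ few (subst₂ (λ a b → a ℕ.+ b ≤ _)
      (N.δ-yes (¬? (e t ≟ 0#)) et≢0) (N.δ-yes (¬? (e t₀ ≟ 0#)) e≢0) (two-terms (λ t → N.δ (¬? (e t ≟ 0#))) t≢t₀)))

    single-sum : Fld.∑ᶠ e ≡ e t₀
    single-sum = trans (S.∑-cong elements pointwise) (Fld.∑ᶠ-δ t₀ e)
      where
      pointwise : ∀ t → e t ≡ S.δ (t ≟ t₀) * e t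
      pointwise t with t ≟ t₀
      ... | yes _   = sym (*-identityˡ _)
      ... | no t≢t₀ = trans (single-zero t≢t₀) (sym (zeroˡ _))

  ∑≢0⇒term≢0 : ∀ (e : Carrier → Carrier) → Fld.∑ᶠ e ≢ 0# → ∃ λ t → e t ≢ 0#
  ∑≢0⇒term≢0 e ∑≢0 with ∃ᶠ? (λ t → ¬? (e t ≟ 0#))
  ... | yes found = found
  ... | no none   = ⊥-elim (∑≢0 (trans (S.∑-cong elements (λ t → decidable-stable (e t ≟ 0#) (λ ≢0 → none (t , ≢0))))
                                       (S.∑-zero elements)))

-- A light word takes only one nonzero value on points

module ConstantWords {p h : ℕ} (pr : Prime p) (1≤h : 1 ≤ h) (F : FiniteField (p ^ h)) (9≤p : 9 ≤ p) where
  open Constancy pr 1≤h F 9≤p public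

  private variable
    m : ℕ

  combination-0 : ∀ {g : V m → Carrier} → Fld.Homogeneous g → ∀ {X Y b c} → b ≡ 0# → c ≢ 0# →
                  g ((b · X) ⊕ (c · Y)) ≡ g Y
  combination-0 {g = g} hg {X} {Y} {c = c} refl c≢0 =
    trans (cong g (trans (cong (_⊕ (c · Y)) (·-zeroˡ X)) (⊕-identityˡ _))) (hg c≢0 Y)

  combination : ∀ {g : V m → Carrier} → Fld.Homogeneous g → ∀ {X Y b} → b ≢ 0# → ∀ c →
                g ((b · X) ⊕ (c · Y)) ≡ g (X ⊕ ((inv b * c) · Y))
  combination {g = g} hg {X} {Y} {b} b≢0 c = trans (sym (hg (inv-≢0 b≢0) _)) (cong g (trans (·-distribˡ (inv b) _ _)
    (cong₂ _⊕_ (inv-· b≢0 X) (sym (·-assoc (inv b) c Y)))))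

  module Exceptional {κ′} (g : V (suc (suc (suc κ′))) → Carrier) (hg : Fld.Homogeneous g)
      (fc : FlatConstant whole 1 g) (gFp : ∀ X → InFp (g X)) (light : Light (suc (suc κ′)) (supp g))
      {R} (R≢0 : R ≢ zeroV) (gR≢0 : g R ≢ 0#) (gR≢g0 : g R ≢ g zeroV) where

    κ : ℕ
    κ = suc (suc κ′)

    a : Carrier
    a = g zeroV

    lines : ∀ Q X → Fld.line elements Q g X + g Q ≡ a
    lines = line-sum hg fc

    f : V κ → ℕ
    f = Nat.push R (supp g)

    ∑*-supp : ∑* (supp g) ≡ ∑* f ℕ.+ q₁
    ∑*-supp = trans (∑*-push R≢0 (supp-homogeneous hg))
      (cong (∑* f ℕ.+_) (trans (cong (q₁ ℕ.*_) (supp-≢0 g gR≢0)) (ℕ.*-identityʳ q₁)))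

    bisecant : ∃ λ Y → Y ≢ zeroV × f Y < 2
    bisecant = ∑*-<⇒∃ {g = λ _ → 2} (subst (∑* f <_) (sym (∑*-const κ 2))
      (light<2#* _ (#* κ) 0<q₁ (subst (λ w → 7 ℕ.* w ≤ 12 ℕ.* #* κ ℕ.+ 5 ℕ.* q₁) ∑*-supp light)))

    Y₀ = proj₁ bisecant
    Y₀≢0 = proj₁ (proj₂ bisecant)

    e : Carrier → Carrier
    e t = g (sec R Y₀ ⊕ (t · R))

    few : Nat.∑ᶠ (λ t → N.δ (¬? (e t ≟ 0#))) < 2
    few = proj₂ (proj₂ bisecant)

    second : ∃ λ t → e t ≢ 0#
    -- If R were the only point of the support on this line, the line sum would give `g R` = `a`.
    second = ∑≢0⇒term≢0 e (λ ∑e≡0 → gR≢g0 (trans (sym (+-identityˡ _))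
      (trans (cong (_+ g R) (sym ∑e≡0)) (lines R (sec R Y₀)))))

    t₀ = proj₁ second

    P : V (suc κ)
    P = sec R Y₀ ⊕ (t₀ · R)

    gP≢0 : g P ≢ 0#
    gP≢0 = proj₂ second

    gP+gR : g P + g R ≡ a
    gP+gR = trans (cong (_+ g R) (sym (single-sum e few gP≢0))) (lines R (sec R Y₀))

    -- Bagchi and Inamdar's bound: the residues of g / g R and of its negative g / g P have
    -- large sums, but add up to p on the support.
    module Dual (a≡0 : a ≡ 0#) where

      P≢0 : P ≢ zeroV
      P≢0 P≡0 = gP≢0 (trans (cong g P≡0) a≡0)

      gP≡-gR : g P ≡ - g R
      gP≡-gR = x+y≡0⇒x≡-y (trans gP+gR a≡0)

      scaled : V (suc κ) → V (suc κ) → Carrier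
      scaled T X = inv (g T) * g X

      scaled-line : ∀ {T} → g T ≢ 0# → ∀ X → Fld.line elements T (scaled T) X ≡ - 1#
      scaled-line {T} gT≢0 X = begin
        Fld.line elements T (scaled T) X       ≡⟨ S.∑-*ˡ elements (inv (g T)) _ ⟩
        inv (g T) * Fld.line elements T g X    ≡⟨ cong (inv (g T) *_) (x+y≡0⇒x≡-y (trans (lines T X) a≡0)) ⟩
        inv (g T) * (- g T)                    ≡⟨ -‿distribʳ-* _ _ ⟨
        - (inv (g T) * g T)                    ≡⟨ cong -_ (inv-* gT≢0) ⟩
        - 1#                                   ∎ where open ≡-Reasoning

      residues : ∀ T → ∃ λ (γ : V (suc κ) → ℕ) →
                 Nat.Homogeneous γ × (∀ X → ι (γ X) ≡ scaled T X) × (∀ X → γ X < p)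
      residues T = residue (λ a≢0 X → cong (inv (g T) *_) (hg a≢0 X)) (λ X → InFp-* (InFp-inv (gFp T)) (gFp X))

      residues-sum : ∀ {T} → T ≢ zeroV → g T ≢ 0# → ℕ.pred p ℕ.* #* κ ℕ.+ q₁ ≤ ∑* (proj₁ (residues T))
      residues-sum {T} T≢0 gT≢0 = let γ , hγ , ιγ , _ = residues T in
        residue-sum T≢0 (scaled-line gT≢0) (inv-* gT≢0) hγ ιγ

      opposite : ∀ X → scaled R X + scaled P X ≡ 0#
      opposite X = begin
        inv (g R) * g X + inv (g P) * g X     ≡⟨ distribʳ (g X) _ _ ⟨
        (inv (g R) + inv (g P)) * g X         ≡⟨ cong (λ b → (inv (g R) + b) * g X) inv-gP ⟩
        (inv (g R) + - inv (g R)) * g X       ≡⟨ cong (_* g X) (-‿inverseʳ _) ⟩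
        0# * g X                              ≡⟨ zeroˡ _ ⟩
        0#                                    ∎
        where
        open ≡-Reasoning
        inv-gP : inv (g P) ≡ - inv (g R)
        inv-gP = *-cancelˡ gP≢0 (trans (*-inv gP≢0) (sym (begin
          g P * - inv (g R)        ≡⟨ cong (_* - inv (g R)) gP≡-gR ⟩
          - g R * - inv (g R)      ≡⟨ -‿distribˡ-* _ _ ⟨
          - (g R * - inv (g R))    ≡⟨ cong -_ (-‿distribʳ-* _ _) ⟨
          - (- (g R * inv (g R)))  ≡⟨ -‿involutive _ ⟩
          g R * inv (g R)          ≡⟨ *-inv gR≢0 ⟩
          1#                       ∎)))

      γ : V (suc κ) → V (suc κ) → ℕ
      γ T = proj₁ (residues T)

      ιγ : ∀ T X → ι (γ T X) ≡ scaled T X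
      ιγ T = proj₁ (proj₂ (proj₂ (residues T)))

      γ<p : ∀ T X → γ T X < p
      γ<p T = proj₂ (proj₂ (proj₂ (residues T)))

      γ≡0 : ∀ T {X} → g X ≡ 0# → γ T X ≡ 0
      γ≡0 T {X} gX≡0 = ι≡0⇒≡0 (γ<p T X) (trans (ιγ T X) (trans (cong (inv (g T) *_) gX≡0) (zeroʳ _)))

      residues≤p : ∀ X → γ R X ℕ.+ γ P X ≤ p ℕ.* supp g X
      residues≤p X = by-cases (g X ≟ 0#)
        where
        by-cases : Dec (g X ≡ 0#) → γ R X ℕ.+ γ P X ≤ p ℕ.* supp g X
        at-most-p : ∀ {x y} → x < p → y < p → p ∣ x ℕ.+ y → x ℕ.+ y ≤ p
        at-most-p x<p y<p (divides 0 eq) = ℕ.≤-trans (ℕ.≤-reflexive eq) z≤n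
        at-most-p x<p y<p (divides 1 eq) = ℕ.≤-reflexive (trans eq (ℕ.*-identityˡ p))
        at-most-p {x} {y} x<p y<p (divides (suc (suc d)) eq) = ⊥-elim (ℕ.<⇒≱ (ℕ.+-mono-< x<p y<p)
          (subst (p ℕ.+ p ≤_) (sym eq) (ℕ.+-monoʳ-≤ p (ℕ.m≤m+n p _))))

        by-cases (yes gX≡0) = ℕ.≤-trans (ℕ.≤-reflexive (cong₂ ℕ._+_ (γ≡0 R gX≡0) (γ≡0 P gX≡0))) z≤n
        by-cases (no gX≢0)  = ℕ.≤-trans (at-most-p (γ<p R X) (γ<p P X)
            (ι≡0⇒∣ (trans (ι-+ (γ R X) (γ P X)) (trans (cong₂ _+_ (ιγ R X) (ιγ P X)) (opposite X)))))
          (ℕ.≤-reflexive (sym (trans (cong (p ℕ.*_) (supp-≢0 g {X} gX≢0)) (ℕ.*-identityʳ p))))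

      impossible : ⊥
      impossible = no-light-dual-word (∑* (supp g)) (#* κ) 9≤p 0<q₁ (suc-p*q₁≤#* κ′) light (begin
        (ℕ.pred p ℕ.* #* κ ℕ.+ q₁) ℕ.+ (ℕ.pred p ℕ.* #* κ ℕ.+ q₁)
          ≤⟨ ℕ.+-mono-≤ (residues-sum R≢0 gR≢0) (residues-sum P≢0 gP≢0) ⟩
        ∑* (γ R) ℕ.+ ∑* (γ P)                ≡⟨ ∑*-+ (γ R) (γ P) ⟨
        ∑* (λ X → γ R X ℕ.+ γ P X)           ≤⟨ ∑*-mono (λ X _ → residues≤p X) ⟩
        ∑* (λ X → p ℕ.* supp g X)            ≡⟨ ∑*-*ˡ p (supp g) ⟩
        p ℕ.* ∑* (supp g)                    ∎)
        where open ℕ.≤-Reasoning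

    -- The line RP meets the support in R and P only; some affine plane with RP at infinity contains
    -- fewer than 2(q - 1) further points, yet all its lines are blocked.
    module Blocked (a≢0 : a ≢ 0#) where

      -- For nonzero `Z` this counts the support in an affine plane whose line at infinity is RP,
      -- namely the plane parametrised by `point` below.
      f₂ : V (suc κ′) → ℕ
      f₂ = Nat.push Y₀ f

      fY₀≥1 : 1 ≤ f Y₀
      fY₀≥1 = ℕ.≤-trans (ℕ.≤-reflexive (sym (supp-≢0 g gP≢0)))
        (term≤∑ (λ t → supp g (sec R Y₀ ⊕ (t · R))) (complete t₀))

      ∑*-f₂ : ∑* f₂ ℕ.+ (q₁ ℕ.+ q₁) ≤ ∑* (supp g)
      ∑*-f₂ = begin
        ∑* f₂ ℕ.+ (q₁ ℕ.+ q₁)          ≡⟨ ℕ.+-assoc (∑* f₂) q₁ q₁ ⟨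
        ∑* f₂ ℕ.+ q₁ ℕ.+ q₁            ≤⟨ ℕ.+-monoˡ-≤ q₁ (ℕ.+-monoʳ-≤ (∑* f₂)
                                            (ℕ.≤-trans (ℕ.≤-reflexive (sym (ℕ.*-identityʳ q₁))) (ℕ.*-monoʳ-≤ q₁ fY₀≥1))) ⟩
        ∑* f₂ ℕ.+ q₁ ℕ.* f Y₀ ℕ.+ q₁   ≡⟨ cong (ℕ._+ q₁) (∑*-push Y₀≢0 (Nat.push-homogeneous R (supp-homogeneous hg))) ⟨
        ∑* f ℕ.+ q₁                    ≡⟨ ∑*-supp ⟨
        ∑* (supp g)                    ∎ where open ℕ.≤-Reasoning

      plane : ∃ λ Z → Z ≢ zeroV × f₂ Z < q₁ ℕ.+ q₁
      plane = ∑*-<⇒∃ {g = λ _ → q₁ ℕ.+ q₁} (subst (∑* f₂ <_) (sym (∑*-const (suc κ′) _))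
        (light-plane (∑* f₂) (#* (suc κ′)) 8≤q₁ (ℕ.≤-trans (ℕ.≤-reflexive (sym #*-1)) (#*-mono (s≤s z≤n)))
          (ℕ.≤-trans (ℕ.*-monoʳ-≤ 7 ∑*-f₂) (subst (λ K → 7 ℕ.* ∑* (supp g) ≤ 12 ℕ.* K ℕ.+ 5 ℕ.* q₁)
            (trans (#*-suc (suc κ′)) (cong (λ s → s ℕ.* #* (suc κ′) ℕ.+ q₁) (sym suc-q₁))) light))))

      Z = proj₁ plane

      point : Carrier → Carrier → V (suc κ)
      point u t = sec R (sec Y₀ Z ⊕ (u · Y₀)) ⊕ (t · R)

      direction : Carrier → Carrier → V (suc κ)
      direction b c = (b · sec R Y₀) ⊕ (c · R)

      point-shift : ∀ u t s b c → point (u + s * b) (t + s * c) ≡ point u t ⊕ (s · direction b c)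
      point-shift u t s b c = begin
        sec R (sec Y₀ Z ⊕ ((u + s * b) · Y₀)) ⊕ ((t + s * c) · R)
          ≡⟨ cong₂ _⊕_ (begin
               sec R (sec Y₀ Z ⊕ ((u + s * b) · Y₀))            ≡⟨ cong (λ v → sec R (sec Y₀ Z ⊕ v)) (·-distribʳ u _ Y₀) ⟩
               sec R (sec Y₀ Z ⊕ ((u · Y₀) ⊕ ((s * b) · Y₀)))   ≡⟨ cong (sec R) (⊕-assoc _ _ _) ⟨
               sec R ((sec Y₀ Z ⊕ (u · Y₀)) ⊕ ((s * b) · Y₀))   ≡⟨ sec-⊕ R _ _ ⟩
               sec R (sec Y₀ Z ⊕ (u · Y₀)) ⊕ sec R ((s * b) · Y₀)
                 ≡⟨ cong (sec R (sec Y₀ Z ⊕ (u · Y₀)) ⊕_) (trans (sec-· R _ Y₀) (·-assoc s b _)) ⟩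
               sec R (sec Y₀ Z ⊕ (u · Y₀)) ⊕ (s · (b · sec R Y₀)) ∎)
             (trans (·-distribʳ t _ R) (cong ((t · R) ⊕_) (·-assoc s c R))) ⟩
        (sec R (sec Y₀ Z ⊕ (u · Y₀)) ⊕ (s · (b · sec R Y₀))) ⊕ ((t · R) ⊕ (s · (c · R)))
          ≡⟨ ⊕-medial _ _ _ _ ⟩
        point u t ⊕ ((s · (b · sec R Y₀)) ⊕ (s · (c · R)))
          ≡⟨ cong (point u t ⊕_) (·-distribˡ s _ _) ⟨
        point u t ⊕ (s · direction b c) ∎ where open ≡-Reasoning

      -- The directions are the points of RP. At R the value differs from `a` by assumption, at P
      -- because `g P` + `g R` = `a` and `g R` is nonzero, and elsewhere it is 0.
      direction≢ : ∀ b c → ¬ (b ≡ 0# × c ≡ 0#) → g (direction b c) ≢ a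
      direction≢ b c ≢00 gD≡a = by-cases (b ≟ 0#) ((inv b * c) ≟ t₀)
        where
        by-cases : Dec (b ≡ 0#) → Dec (inv b * c ≡ t₀) → ⊥
        by-cases (yes b≡0) _ = gR≢g0 (trans (sym (combination-0 hg b≡0 (λ c≡0 → ≢00 (b≡0 , c≡0)))) gD≡a)
        by-cases (no b≢0) (yes s≡t₀) = gR≢0 (+-cancelˡ (g P) (g R) 0# (trans gP+gR (trans (sym gD≡a)
          (trans (combination hg b≢0 c) (trans (cong e s≡t₀) (sym (+-identityʳ (g P))))))))
        by-cases (no b≢0) (no s≢t₀) = a≢0 (trans (sym gD≡a)
          (trans (combination hg b≢0 c) (single-zero e few gP≢0 s≢t₀)))

      base-point : ∀ α β → ¬ (α ≡ 0# × β ≡ 0#) → ∃₂ λ u t → α * u + β * t ≡ 1#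
      base-point α β ≢00 with α ≟ 0# | β ≟ 0#
      ... | no α≢0 | _      = inv α , 0# , trans (cong₂ _+_ (*-inv α≢0) (zeroʳ β)) (+-identityʳ 1#)
      ... | yes _  | no β≢0 = 0# , inv β , trans (cong₂ _+_ (zeroʳ α) (*-inv β≢0)) (+-identityˡ 1#)
      ... | yes α≡0 | yes β≡0 = ⊥-elim (≢00 (α≡0 , β≡0))

      on-line : ∀ α β u t s → α * u + β * t ≡ 1# → α * (u + s * - β) + β * (t + s * α) ≡ 1#
      on-line α β u t s eq = begin
        α * (u + s * - β) + β * (t + s * α)
          ≡⟨ solve 6 (λ α β n u t s → α :* (u :+ s :* n) :+ β :* (t :+ s :* α) := (α :* u :+ β :* t) :+ s :* α :* (β :+ n))
               refl α β (- β) u t s ⟩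
        α * u + β * t + s * α * (β + - β)
          ≡⟨ cong₂ (λ x y → x + s * α * y) eq (-‿inverseʳ β) ⟩
        1# + s * α * 0#
          ≡⟨ trans (cong (1# +_) (zeroʳ _)) (+-identityʳ 1#) ⟩
        1# ∎
        where
        open SemiringSolver
        open ≡-Reasoning

      -- The sum over the affine line is `a` minus the value at its point at infinity, and therefore
      -- nonzero.
      line-meets : ∀ b c → ¬ (b ≡ 0# × c ≡ 0#) → ∀ X → ∃ λ s → g (X ⊕ (s · direction b c)) ≢ 0#
      line-meets b c ≢00 X = ∑≢0⇒term≢0 (λ s → g (X ⊕ (s · direction b c))) (λ ∑≡0 →
        direction≢ b c ≢00 (trans (sym (+-identityˡ (g (direction b c))))
          (trans (cong (_+ g (direction b c)) (sym ∑≡0)) (lines (direction b c) X))))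

      -- The line α u + β t = 1 has direction (- β , α), so a vector of the support found by moving
      -- a base point this way still satisfies the equation.
      blocked : ∀ α β → ¬ (α ≡ 0# × β ≡ 0#) → ∃₂ λ u t → g (point u t) ≢ 0# × α * u + β * t ≡ 1#
      blocked α β ≢00 = from (base-point α β ≢00)
        where
        -β,α≢00 : ¬ (- β ≡ 0# × α ≡ 0#)
        -β,α≢00 (-β≡0 , α≡0) = ≢00 (α≡0 , decidable-stable (β ≟ 0#) (λ β≢0 → -≢0 β≢0 -β≡0))
        from : (∃₂ λ u t → α * u + β * t ≡ 1#) → ∃₂ λ u t → g (point u t) ≢ 0# × α * u + β * t ≡ 1#
        from (u , t , eq) = shifted (line-meets (- β) α -β,α≢00 (point u t))
          where
          shifted : (∃ λ s → g (point u t ⊕ (s · direction (- β) α)) ≢ 0#) →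
                    ∃₂ λ u t → g (point u t) ≢ 0# × α * u + β * t ≡ 1#
          shifted (s , ≢0) = u + s * - β , t + s * α ,
            (λ g≡0 → ≢0 (trans (cong g (sym (point-shift u t s (- β) α))) g≡0)) , on-line α β u t s eq

      impossible : ⊥
      impossible = ℕ.<⇒≱ (proj₂ (proj₂ plane)) (jamison (λ u t → g (point u t)) blocked)

    impossible : ⊥
    impossible = case a ≟ 0# of λ where
      (yes a≡0) → Dual.impossible a≡0
      (no a≢0)  → Blocked.impossible a≢0

  -- Projecting from a point Q such that R is the only point of the support on the line RQ.
  module TangentProjection (g : V (suc m) → Carrier) (hg : Fld.Homogeneous g)
      {R} (R≢0 : R ≢ zeroV) {Y} (Y≢0 : Y ≢ zeroV)
      (off : ∀ u {t} → t ≢ 0# → g ((u · R) ⊕ (t · sec R Y)) ≡ 0#) where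

    Q : V (suc m)
    Q = sec R Y

    Q≢0 : Q ≢ zeroV
    Q≢0 = sec≢0 R≢0 Y≢0

    R≢tQ : ∀ t → R ≢ t · Q
    R≢tQ = flip-multiple R≢0 (sec-independent R≢0 Y≢0)

    gQ≡0 : g Q ≡ 0#
    gQ≡0 = trans (cong g (sym (trans (cong₂ _⊕_ (·-zeroˡ R) (·-identity Q)) (⊕-identityˡ Q)))) (off 0# 1≢0)

    push-R : Fld.push Q g (π Q R) ≡ g R
    push-R = trans (Fld.push-π Q≢0 g R)
      (trans (S.∑-cong elements (λ t → pointwise t (t ≟ 0#))) (Fld.∑ᶠ-δ 0# (λ _ → g R)))
      where
      pointwise : ∀ t (d : Dec (t ≡ 0#)) → g (R ⊕ (t · Q)) ≡ S.δ d * g R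
      pointwise t (yes t≡0) = trans (cong (λ t → g (R ⊕ (t · Q))) t≡0)
        (trans (cong g (trans (cong (R ⊕_) (·-zeroˡ Q)) (⊕-identityʳ R))) (sym (*-identityˡ _)))
      pointwise t (no t≢0)  = trans (cong (λ v → g (v ⊕ (t · Q))) (sym (·-identity R))) (trans (off 1# t≢0) (sym (zeroˡ _)))

    -- Projection changes the value at 0 by - g Q, which vanishes because Q lies outside the
    -- support.
    push-zero : Fld.push Q g zeroV ≡ g zeroV
    push-zero = begin
      Fld.push Q g zeroV                 ≡⟨ cong (Fld.line elements Q g) (sec-zero Q) ⟩
      Fld.line elements Q g zeroV        ≡⟨ +-identityʳ _ ⟨
      Fld.line elements Q g zeroV + 0#   ≡⟨ cong (Fld.line elements Q g zeroV +_) gQ≡0 ⟨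
      Fld.line elements Q g zeroV + g Q  ≡⟨ line-sum-zero hg Q ⟩
      g zeroV                            ∎ where open ≡-Reasoning

  push-InFp : ∀ {g : V (suc m) → Carrier} Q → (∀ X → InFp (g X)) → ∀ Y → InFp (Fld.push Q g Y)
  push-InFp {g = g} Q gFp Y = ∑-InFp elements
    where
    ∑-InFp : ∀ L {e : Carrier → Vec Carrier _} → InFp (S.∑ L (λ t → g (e t)))
    ∑-InFp []          = 0 , refl
    ∑-InFp (t ∷ L) {e} = InFp-+ (gFp (e t)) (∑-InFp L)

  -- Projecting from a point other than R on a tangent at R keeps both `g R` and `g zeroV`, so a
  -- discrepancy between them would persist down to the case where all line sums are known.
  constant : ∀ j {κ′} (g : V (suc j ℕ.+ suc (suc κ′)) → Carrier) → Fld.Homogeneous g →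
    FlatConstant whole (suc j) g → (∀ X → InFp (g X)) → Light (suc (suc κ′)) (supp g) →
    ∀ {R} → R ≢ zeroV → g R ≢ 0# → g R ≡ g zeroV
  constant zero g hg fc gFp light R≢0 gR≢0 =
    decidable-stable (_ ≟ _) (λ gR≢g0 → Exceptional.impossible g hg fc gFp light R≢0 gR≢0 gR≢g0)
  constant (suc j) {κ′} g hg fc gFp light {R} R≢0 gR≢0 =
    from (unsecant R≢0 (supp-homogeneous hg) (Light⇒<#* {κ = suc (suc κ′)} {f = supp g} (s≤s (ℕ.m≤n+m _ j)) light))
    where
    from : (∃ λ Y → Y ≢ zeroV × Nat.push R (supp g) Y ≡ 0) → g R ≡ g zeroV
    from (Y , Y≢0 , f≡0) = trans (sym push-R) (trans
      (constant j (Fld.push Q g) (Fld.push-homogeneous Q hg) (FlatConstant-push (suc j) fc Q) (push-InFp Q gFp)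
        (Light-mono {κ = suc (suc κ′)} {f = supp (Fld.push Q g)} {g = supp g} (∑*-supp-push Q≢0 hg) light)
        (π≢0 Q≢0 R≢tQ) (λ eq → gR≢0 (trans (sym push-R) eq)))
      push-zero)
      where
      open TangentProjection g hg R≢0 Y≢0
        (λ u t≢0 → supp-none g (s≤s (ℕ.≤-reflexive (unsecant-zero (supp-homogeneous hg) f≡0 u t≢0))))

-- Tangent spaces at support points and the blocking property

module Tangents {p h : ℕ} (pr : Prime p) (1≤h : 1 ≤ h) (F : FiniteField (p ^ h)) (9≤p : 9 ≤ p) where
  open ConstantWords pr 1≤h F 9≤p public

  private variable
    m r : ℕ

  ι-push : ∀ Q (μ : V (suc m) → ℕ) Y → ι (Nat.push Q μ Y) ≡ Fld.push Q (ι ∘ μ) Y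
  ι-push Q μ Y = ι-∑ elements _

  -- If μ is nonzero at 0, the condition applies to vanishing combinations too and makes `b`
  -- independent modulo `R`.
  TangentSpace : (V m → ℕ) → V m → Vec (V m) r → Set
  TangentSpace μ R b = ∀ t s → 0 < μ ((t · R) ⊕ lincomb s b) → s ≡ zeroV

  -- A support vector of the lifted space projects into the tangent space at π Q R, which forces `s`
  -- to be zero. It then lies on the line RQ, where `off` leaves only the multiples of R.
  lift-tangent : ∀ (μ : V (suc m) → ℕ) {R Q} → Q ≢ zeroV →
    (∀ u {t} → t ≢ 0# → μ ((u · R) ⊕ (t · Q)) ≡ 0) → ∀ {b : Vec (V m) r} →
    TangentSpace (Nat.push Q μ) (π Q R) b → TangentSpace μ R (Q ∷ Vec.map (sec Q) b)
  lift-tangent μ {R} {Q} Q≢0 off {b} tangent t (u ∷ s) pos = cong₂ _∷_ u≡0 s≡0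
    where
    open ≡-Reasoning
    X L : Vec Carrier _
    X = (t · R) ⊕ ((u · Q) ⊕ lincomb s (Vec.map (sec Q) b))
    L = (t · π Q R) ⊕ lincomb s b
    X≡ : X ≡ sec Q L ⊕ ((t * τ Q R + u) · Q)
    X≡ = begin
      (t · R) ⊕ ((u · Q) ⊕ lincomb s (Vec.map (sec Q) b))
        ≡⟨ cong₂ _⊕_ (trans (cong (t ·_) (sym (decompose Q≢0 R))) (trans (·-distribˡ t _ _)
             (cong₂ _⊕_ (sym (sec-· Q t _)) (sym (·-assoc t _ Q)))))
             (trans (⊕-comm _ _) (cong (_⊕ (u · Q)) (lincomb-sec Q s b))) ⟩
      (sec Q (t · π Q R) ⊕ ((t * τ Q R) · Q)) ⊕ (sec Q (lincomb s b) ⊕ (u · Q))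
        ≡⟨ ⊕-medial _ _ _ _ ⟩
      (sec Q (t · π Q R) ⊕ sec Q (lincomb s b)) ⊕ (((t * τ Q R) · Q) ⊕ (u · Q))
        ≡⟨ cong₂ _⊕_ (sec-⊕ Q _ _) (·-distribʳ _ u Q) ⟨
      sec Q L ⊕ ((t * τ Q R + u) · Q) ∎
    s≡0 : s ≡ zeroV
    s≡0 = tangent t s (ℕ.≤-trans (subst (λ v → 0 < μ v) X≡ pos)
      (term≤∑ (λ x → μ (sec Q L ⊕ (x · Q))) (complete (t * τ Q R + u))))
    X≡′ : X ≡ (t · R) ⊕ (u · Q)
    X≡′ = cong ((t · R) ⊕_) (trans (cong (λ s → (u · Q) ⊕ lincomb s (Vec.map (sec Q) b)) s≡0)
      (trans (cong ((u · Q) ⊕_) (lincomb-zero (Vec.map (sec Q) b))) (⊕-identityʳ _)))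
    u≡0 : u ≡ 0#
    u≡0 = decidable-stable (u ≟ 0#) (λ u≢0 → ℕ.<⇒≢ pos (sym (trans (cong μ X≡′) (off t u≢0))))

  -- In the higher dimensions counting alone gives the line. In the last one it only gives a line
  -- with fewer than p further points, counted with multiplicity; their number is congruent to μ 0 -
  -- μ R = 0 modulo p, so there are none.
  tangent-line : ∀ j {κ} (μ : V (suc j ℕ.+ κ) → ℕ) → Nat.Homogeneous μ → FlatConstant whole (suc j) (ι ∘ μ) →
    ι (μ zeroV) ≡ 1# → ∑* μ < #* (suc κ) → ∑* μ < p ℕ.* #* κ → ∀ {R} → R ≢ zeroV → ι (μ R) ≡ 1# →
    ∃ λ Y → Y ≢ zeroV × Nat.push R μ Y ≡ 0
  tangent-line (suc j) μ hμ fc μ0 small <p R≢0 μR =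
    unsecant R≢0 hμ (ℕ.<-≤-trans small (#*-mono (s≤s (ℕ.m≤n+m _ j))))
  tangent-line zero {κ} μ hμ fc μ0 small <p {R} R≢0 μR =
    let Y , Y≢0 , push<p = ∑*-<⇒∃ {κ} {Nat.push R μ} {λ _ → p}
          (subst (∑* (Nat.push R μ) <_) (sym (∑*-const κ p)) (ℕ.≤-<-trans (∑*-push-≤ R≢0 hμ) <p))
    in Y , Y≢0 , ι≡0⇒≡0 push<p (trans (ι-push R μ Y) (line≡0 (sec R Y)))
    where
    line≡0 : ∀ X → Fld.line elements R (ι ∘ μ) X ≡ 0#
    line≡0 X = +-cancelʳ (ι (μ R)) _ _ (trans (line-sum (λ a≢0 X → cong ι (hμ a≢0 X)) fc R X)
      (trans (trans μ0 (sym μR)) (sym (+-identityˡ _))))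

  -- Multiplicities in ℕ replace sets because projecting an indicator function does not give an
  -- indicator, whereas the two size bounds and the residues at 0 and R are inherited.
  tangent-space : ∀ j {κ} (μ : V (j ℕ.+ κ) → ℕ) → Nat.Homogeneous μ → FlatConstant whole j (ι ∘ μ) →
    ι (μ zeroV) ≡ 1# → ∑* μ < #* (suc κ) → ∑* μ < p ℕ.* #* κ → ∀ {R} → R ≢ zeroV → ι (μ R) ≡ 1# →
    ∃ λ (b : Vec (V (j ℕ.+ κ)) j) → TangentSpace μ R b
  tangent-space zero μ hμ fc μ0 small <p R≢0 μR = [] , λ { t [] _ → refl }
  tangent-space (suc j) {κ} μ hμ fc μ0 small <p {R} R≢0 μR = from (tangent-line j μ hμ fc μ0 small <p R≢0 μR)
    where
    from : (∃ λ Y → Y ≢ zeroV × Nat.push R μ Y ≡ 0) →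
           ∃ λ (b : Vec (V (suc j ℕ.+ κ)) (suc j)) → TangentSpace μ R b
    from (Y , Y≢0 , f≡0) = Q ∷ Vec.map (sec Q) (proj₁ tangent) , lift-tangent μ Q≢0 off (proj₂ tangent)
      where
      off : ∀ u {t} → t ≢ 0# → μ ((u · R) ⊕ (t · sec R Y)) ≡ 0
      off u t≢0 = unsecant-zero hμ f≡0 u t≢0
      open TangentProjection (ι ∘ μ) (λ a≢0 X → cong ι (hμ a≢0 X)) R≢0 Y≢0 (λ u t≢0 → cong ι (off u t≢0))
      tangent : ∃ λ (b : Vec (V (j ℕ.+ κ)) j) → TangentSpace (Nat.push Q μ) (π Q R) b
      tangent = tangent-space j (Nat.push Q μ) (Nat.push-homogeneous Q hμ)
        (FlatConstant-cong whole j (λ Y → sym (ι-push Q μ Y)) (FlatConstant-push j fc Q))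
        (trans (ι-push Q μ zeroV) (trans push-zero μ0))
        (ℕ.≤-<-trans (∑*-push-≤ Q≢0 hμ) small) (ℕ.≤-<-trans (∑*-push-≤ Q≢0 hμ) <p)
        (π≢0 Q≢0 R≢tQ) (trans (ι-push Q μ _) (trans push-R μR))

  flat-sum : ∀ (C : Vec (V m) r) g X → Fld.flat elements C g X ≡ Fld.∑ⱽ (λ s → g (X ⊕ lincomb s C))
  flat-sum []      g X = trans (cong g (sym (⊕-identityʳ X))) (sym (+-identityʳ _))
  flat-sum {r = suc r} (Q ∷ C) g X = begin
    Fld.∑ᶠ (λ t → Fld.flat elements C g (X ⊕ (t · Q)))
      ≡⟨ S.∑-cong elements (λ t → trans (flat-sum C g _) (S.∑-cong (allVecs r) (λ s → cong g (⊕-assoc X _ _)))) ⟩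
    Fld.∑ᶠ (λ t → Fld.∑ⱽ (λ s → g (X ⊕ lincomb (t ∷ s) (Q ∷ C))))
      ≡⟨ Fld.∑ⱽ-∷ (λ s → g (X ⊕ lincomb s (Q ∷ C))) ⟨
    Fld.∑ⱽ (λ s → g (X ⊕ lincomb s (Q ∷ C))) ∎ where open ≡-Reasoning

  -- The values of g on a subspace of vector dimension j + 1 add up to 0.
  blocking-vector : ∀ j {g : V m → Carrier} → FlatConstant whole j g → g zeroV ≢ 0# →
    ∀ (C : Vec (V m) (suc j)) → ∃ λ s → s ≢ zeroV × g (lincomb s C) ≢ 0#
  blocking-vector j {g} fc g0≢0 C@(Q ∷ C′) with ∃ⱽ? (λ s → ¬? (s ≟ⱽ zeroV) ×-dec ¬? (g (lincomb s C) ≟ 0#))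
  ... | yes found = found
  ... | no none   = ⊥-elim (g0≢0 (begin
    g zeroV
      ≡⟨ cong g (lincomb-zero C) ⟨
    g (lincomb zeroV C)
      ≡⟨ S.∑-δ _≟ⱽ_ (allVecs-unique (suc j)) (allVecs-complete zeroV) (λ s → g (lincomb s C)) ⟨
    Fld.∑ⱽ (λ s → S.δ (s ≟ⱽ zeroV) * g (lincomb s C))
      ≡⟨ S.∑-cong (allVecs (suc j)) (λ s → pointwise s (s ≟ⱽ zeroV)) ⟩
    Fld.∑ⱽ (λ s → g (zeroV ⊕ lincomb s C))
      ≡⟨ flat-sum C g zeroV ⟨
    Fld.flat elements C g zeroV
      ≡⟨ S.∑-cong elements (λ t → fc C′ _) ⟩
    Fld.∑ᶠ (λ _ → Fld.flat elements C′ g zeroV)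
      ≡⟨ ∑ᶠ-const _ ⟩
    0# ∎))
    where
    open ≡-Reasoning
    pointwise : ∀ s (d : Dec (s ≡ zeroV)) → S.δ d * g (lincomb s C) ≡ g (zeroV ⊕ lincomb s C)
    pointwise s (yes _)   = trans (*-identityˡ _) (cong g (sym (⊕-identityˡ _)))
    pointwise s (no s≢0) = trans (zeroˡ _) (sym (trans (cong g (⊕-identityˡ _))
      (decidable-stable (g (lincomb s C) ≟ 0#) (λ ≢0 → none (s , s≢0 , ≢0)))))

-- Flats over the prime field force the support to be a subspace

module PrimeFlats {p h : ℕ} (pr : Prime p) (1≤h : 1 ≤ h) (F : FiniteField (p ^ h)) where
  open MinimumWords pr 1≤h F

  private variable
    m r : ℕ

  L : List Carrier
  L = list primeField

  1∈L : 1# ∈ L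
  1∈L = InFp⇒∈ (1 , sym ι-1)

  -- Double counting over all translates. This yields the average of a flat sum, from which
  -- translates with a small sum are found.
  ∑ⱽ-flat : ∀ (C : Vec (V m) r) (f : V m → ℕ) →
            Nat.∑ⱽ (Nat.flat L C f) ≡ p ^ r ℕ.* Nat.∑ⱽ f
  ∑ⱽ-flat []      f = sym (ℕ.*-identityˡ _)
  ∑ⱽ-flat {m} {suc r} (Q ∷ C) f = begin
    Nat.∑ⱽ (λ X → N.∑ L (λ t → Nat.flat L C f (X ⊕ (t · Q))))
      ≡⟨ N.∑-swap (allVecs m) L _ ⟩
    N.∑ L (λ t → Nat.∑ⱽ (λ X → Nat.flat L C f (X ⊕ (t · Q))))
      ≡⟨ N.∑-cong L (λ t → trans (Nat.∑ⱽ-translate (t · Q) (Nat.flat L C f)) (∑ⱽ-flat C f)) ⟩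
    N.∑ L (λ _ → p ^ r ℕ.* Nat.∑ⱽ f)
      ≡⟨ trans (∑-const L _) (cong (ℕ._* (p ^ r ℕ.* Nat.∑ⱽ f)) length-primeField) ⟩
    p ℕ.* (p ^ r ℕ.* Nat.∑ⱽ f)
      ≡⟨ ℕ.*-assoc p _ _ ⟨
    p ^ suc r ℕ.* Nat.∑ⱽ f ∎ where open ≡-Reasoning

  -- The scalars come from 𝔽ₚ because only these preserve the 𝔽ₚ-span of `C`.
  flat-homogeneous : ∀ (C : Vec (V m) r) {f : V m → ℕ} → Nat.Homogeneous f →
                     ∀ {t} → t ∈ L → t ≢ 0# → ∀ X → Nat.flat L C f (t · X) ≡ Nat.flat L C f X
  flat-homogeneous []      hf t∈ t≢0 X = hf t≢0 X
  flat-homogeneous (Q ∷ C) {f} hf {t} t∈ t≢0 X = begin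
    N.∑ L (λ s → Nat.flat L C f ((t · X) ⊕ (s · Q)))
      ≡⟨ N.∑-reindex _≟_ (unique primeField) (t *_) (inv t *_) (*∈ primeField t∈) (*∈ primeField (inv∈ primeField t∈))
           (λ {x} _ → trans (sym (*-assoc _ _ x)) (trans (cong (_* x) (*-inv t≢0)) (*-identityˡ x)))
           (λ {x} _ → trans (sym (*-assoc _ _ x)) (trans (cong (_* x) (inv-* t≢0)) (*-identityˡ x))) _ ⟨
    N.∑ L (λ s → Nat.flat L C f ((t · X) ⊕ ((t * s) · Q)))
      ≡⟨ N.∑-cong L (λ s → trans (cong (Nat.flat L C f) (trans (cong ((t · X) ⊕_) (·-assoc t s Q)) (sym (·-distribˡ t X _))))
           (flat-homogeneous C hf t∈ t≢0 _)) ⟩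
    N.∑ L (λ s → Nat.flat L C f (X ⊕ (s · Q))) ∎ where open ≡-Reasoning

  ∑L-const : ∀ c → ι (N.∑ L (λ _ → c)) ≡ 0#
  ∑L-const c = trans (cong ι (trans (∑-const L c) (cong (ℕ._* c) length-primeField)))
    (trans (ι-* p c) (trans (cong (_* ι c) ι-p) (zeroˡ _)))

  -- The new flat consists of the p translates by multiples of X. The p - 1 nonzero multiples
  -- contribute equally by homogeneity, so they amount to minus one copy modulo p.
  ι-flat-∷ : ∀ (C : Vec (V m) r) {f : V m → ℕ} → Nat.Homogeneous f → ∀ X →
             ι (Nat.flat L (X ∷ C) f zeroV) + ι (Nat.flat L C f X) ≡ ι (Nat.flat L C f zeroV)
  ι-flat-∷ C {f} hf X = begin
    ι (N.∑ L e) + ι (φ X)               ≡⟨ ι-+ (N.∑ L e) (φ X) ⟨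
    ι (N.∑ L e ℕ.+ φ X)                 ≡⟨ cong ι (Nat.∑-constant-off-0 (unique primeField) (0∈ primeField) e (φ X)
                                            (λ t∈ t≢0 → trans (cong φ (⊕-identityˡ _)) (flat-homogeneous C hf t∈ t≢0 X))) ⟩
    ι (e 0# ℕ.+ N.∑ L (λ _ → φ X))      ≡⟨ trans (ι-+ (e 0#) _) (trans (cong (ι (e 0#) +_) (∑L-const (φ X))) (+-identityʳ _)) ⟩
    ι (e 0#)                            ≡⟨ cong (ι ∘ φ) (trans (⊕-identityˡ _) (·-zeroˡ X)) ⟩
    ι (φ zeroV)                         ∎
    where
    open ≡-Reasoning
    φ : _ → ℕ
    φ = Nat.flat L C f
    e : Carrier → ℕ
    e t = φ (zeroV ⊕ (t · X))

  line-at-tangent : ∀ {φ : V m → ℕ} {X Y} → (∀ {t} → t ∈ L → t ≢ 0# → φ (Y ⊕ (t · X)) ≡ 0) →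
                    Nat.line L X φ Y ≡ φ Y
  line-at-tangent {φ = φ} {X} {Y} off = begin
    N.∑ L (λ t → φ (Y ⊕ (t · X)))
      ≡⟨ ℕ.+-identityʳ _ ⟨
    N.∑ L (λ t → φ (Y ⊕ (t · X))) ℕ.+ 0
      ≡⟨ Nat.∑-constant-off-0 (unique primeField) (0∈ primeField) (λ t → φ (Y ⊕ (t · X))) 0 off ⟩
    φ (Y ⊕ (0# · X)) ℕ.+ N.∑ L (λ _ → 0)
      ≡⟨ cong₂ ℕ._+_ (cong φ (trans (cong (Y ⊕_) (·-zeroˡ X)) (⊕-identityʳ Y))) (N.∑-zero L) ⟩
    φ Y ℕ.+ 0
      ≡⟨ ℕ.+-identityʳ _ ⟩
    φ Y ∎ where open ≡-Reasoning

  -- Sums of the indicator of G over 𝔽ₚ-flats of dimension d are constant modulo p; as G has fewer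
  -- than 2 q^κ elements some of them are at most 1, hence all are 0 or 1 modulo p.
  module Closed {d κ : ℕ} (g : V m → Carrier) (hg : Fld.Homogeneous g) (g0≢0 : g zeroV ≢ 0#)
      (total : p ^ suc (suc d) ℕ.* q ^ κ ≡ q ^ m)
      (fc : ∀ (C : Vec (V m) (suc (suc d))) X →
            ι (Nat.flat L C (supp g) X) ≡ ι (Nat.flat L C (supp g) zeroV))
      (few : Nat.∑ⱽ (supp g) < 2 ℕ.* q ^ κ) (2<p : 2 < p) where

    f : V m → ℕ
    f = supp g

    hf : Nat.Homogeneous f
    hf = supp-homogeneous hg

    φ : Vec (V m) r → V m → ℕ
    φ C = Nat.flat L C f

    small-value : ∀ c {i} (C : Vec (V m) i) → p ^ i ℕ.* (2 ℕ.* q ^ κ) ≤ c ℕ.* q ^ m → ∃ λ Y → φ C Y < c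
    small-value c {i} C le =
      let Y , _ , lt = ∑-<⇒∃ (allVecs m) {φ C} {λ _ → c} (begin-strict
            Nat.∑ⱽ (φ C)                       ≡⟨ ∑ⱽ-flat C f ⟩
            p ^ i ℕ.* Nat.∑ⱽ f                 <⟨ ℕ.*-monoʳ-< (p ^ i) {{p^i≢0}} few ⟩
            p ^ i ℕ.* (2 ℕ.* q ^ κ)            ≤⟨ le ⟩
            c ℕ.* q ^ m                        ≡⟨ ℕ.*-comm c _ ⟩
            q ^ m ℕ.* c                        ≡⟨ length-allVecs m c ⟨
            Nat.∑ⱽ {m} (λ _ → c)               ∎)
      in Y , lt
      where
      open ℕ.≤-Reasoning
      p^i≢0 : NonZero (p ^ i)
      p^i≢0 = ℕ.m^n≢0 p i {{ℕ.>-nonZero (ℕ.<-trans (s≤s z≤n) 2<p)}}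

    minimal-flat : ∀ (C : Vec (V m) (suc (suc d))) → ∃ λ Y → φ C Y < 2
    minimal-flat C = small-value 2 C (ℕ.≤-reflexive (begin
      p ^ D ℕ.* (2 ℕ.* q ^ κ)     ≡⟨ ℕ.*-assoc (p ^ D) 2 _ ⟨
      p ^ D ℕ.* 2 ℕ.* q ^ κ       ≡⟨ cong (ℕ._* q ^ κ) (ℕ.*-comm (p ^ D) 2) ⟩
      2 ℕ.* p ^ D ℕ.* q ^ κ       ≡⟨ ℕ.*-assoc 2 (p ^ D) _ ⟩
      2 ℕ.* (p ^ D ℕ.* q ^ κ)     ≡⟨ cong (2 ℕ.*_) total ⟩
      2 ℕ.* q ^ m                 ∎))
      where
      open ≡-Reasoning
      D : ℕ
      D = suc (suc d)

    0-or-1 : ∀ {x} → x < 2 → x ≡ 0 ⊎ x ≡ 1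
    0-or-1 {0} _ = inj₁ refl
    0-or-1 {1} _ = inj₂ refl
    0-or-1 {suc (suc _)} (s≤s (s≤s ()))

    flat-mod-p : ∀ (C : Vec (V m) (suc (suc d))) → ι (φ C zeroV) ≡ 0# ⊎ ι (φ C zeroV) ≡ 1#
    flat-mod-p C = from (minimal-flat C)
      where
      from : (∃ λ Y → φ C Y < 2) → ι (φ C zeroV) ≡ 0# ⊎ ι (φ C zeroV) ≡ 1#
      from (Y , lt) = Sum.map (λ eq → trans (sym (fc C Y)) (cong ι eq))
                                   (λ eq → trans (sym (fc C Y)) (trans (cong ι eq) ι-1)) (0-or-1 lt)

    -- By `φ∷` a translate of `C` with sum exactly 1 would give a larger flat with sum - 1 modulo p,
    -- which is neither 0 nor 1 as p > 2. But v makes the sums of `v ∷ C` nonzero modulo p, so a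
    -- minimal one is exactly 1, and it contains a translate of `C` with sum 1.
    no-Flat : ∀ (C : Vec (V m) (suc d)) → ι (φ C zeroV) ≡ 0# → ∀ v → ι (φ C v) ≢ 0# → ⊥
    no-Flat C φ0≡0 v φv≢0 = from (minimal-flat (v ∷ C))
      where
      φ∷ : ∀ X → ι (φ (X ∷ C) zeroV) + ι (φ C X) ≡ 0#
      φ∷ X = trans (ι-flat-∷ C hf X) φ0≡0

      not-1 : ∀ X → φ C X ≢ 1
      not-1 X eq = by-cases (flat-mod-p (X ∷ C))
        where
        sum≡0 : ι (φ (X ∷ C) zeroV) + 1# ≡ 0#
        sum≡0 = trans (cong (ι (φ (X ∷ C) zeroV) +_) (sym (trans (cong ι eq) ι-1))) (φ∷ X)
        by-cases : ι (φ (X ∷ C) zeroV) ≡ 0# ⊎ ι (φ (X ∷ C) zeroV) ≡ 1# → ⊥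
        by-cases (inj₁ ≡0) = 1≢0 (trans (sym (+-identityˡ 1#)) (trans (cong (_+ 1#) (sym ≡0)) sum≡0))
        by-cases (inj₂ ≡1) = case ι≡0⇒≡0 2<p (trans (cong (1# +_) ι-1) (trans (cong (_+ 1#) (sym ≡1)) sum≡0)) of λ ()

      from : (∃ λ Y → φ (v ∷ C) Y < 2) → ⊥
      from (Y , lt) = by-cases (0-or-1 lt)
        where
        φY≢0 : φ (v ∷ C) Y ≢ 0
        φY≢0 eq = φv≢0 (trans (sym (+-identityˡ _)) (trans (cong (_+ ι (φ C v))
          (trans (sym (cong ι eq)) (fc (v ∷ C) Y))) (φ∷ v)))
        by-cases : φ (v ∷ C) Y ≡ 0 ⊎ φ (v ∷ C) Y ≡ 1 → ⊥
        by-cases (inj₁ ≡0) = φY≢0 ≡0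
        by-cases (inj₂ ≡1) =
          let t , t∈ , pos = ∑≢0⇒∃ L {λ t → φ C (Y ⊕ (t · v))} (ℕ.≤-reflexive (sym ≡1))
          in not-1 (Y ⊕ (t · v)) (ℕ.≤-antisym (ℕ.≤-trans (term≤∑ (λ t → φ C (Y ⊕ (t · v))) t∈) (ℕ.≤-reflexive ≡1)) pos)

    module _ {u v : V m} (gu≢0 : g u ≢ 0#) (gv≢0 : g v ≢ 0#) (gu+v≡0 : g (v ⊕ u) ≡ 0#) where

      Witness : Vec (V m) r → Set
      Witness C = ι (φ C zeroV) ≡ 0# × ι (φ C v) ≢ 0#

      -- All p multiples of u lie in the support, 0 included, so the sum at 0 is p. The translate by
      -- v contains v but misses v ⊕ u, so its sum lies strictly between 0 and p.
      start : Witness (u ∷ [])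
      start = trans (cong ι (N.∑-cong∈ L {λ t → f (zeroV ⊕ (t · u))} {λ _ → 1} on-u)) (∑L-const 1)
            , λ eq → ℕ.<⇒≢ pos (sym (ι≡0⇒≡0 less eq))
        where
        on-u : ∀ {t} → t ∈ L → f (zeroV ⊕ (t · u)) ≡ 1
        on-u {t} _ = supp-≢0 g (λ eq → by-cases (t ≟ 0#) (trans (cong g (sym (⊕-identityˡ _))) eq))
          where
          by-cases : Dec (t ≡ 0#) → g (t · u) ≢ 0#
          by-cases (yes t≡0) eq = g0≢0 (trans (cong g (sym (trans (cong (_· u) t≡0) (·-zeroˡ u)))) eq)
          by-cases (no t≢0)  eq = gu≢0 (trans (sym (hg t≢0 u)) eq)
        e : Carrier → ℕ
        e t = f (v ⊕ (t · u))
        pos : 0 < N.∑ L e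
        pos = ℕ.≤-trans (ℕ.≤-reflexive (sym (trans (cong f (trans (cong (v ⊕_) (·-zeroˡ u)) (⊕-identityʳ v))) (supp-≢0 g gv≢0))))
                        (term≤∑ e (0∈ primeField))
        less : N.∑ L e < p
        less = ℕ.≰⇒> (λ p≤ → case trans (sym (supp-≡0 g gu+v≡0)) (trans (cong f (cong (v ⊕_) (sym (·-identity u))))
          (∑-tight L {e} {λ _ → 1} (λ {t} _ → δ≤1 (¬? (g (v ⊕ (t · u)) ≟ 0#)))
            (subst (_≤ N.∑ L e) (sym (trans (∑-const L 1) (trans (ℕ.*-identityʳ _) length-primeField))) p≤) 1∈L)) of λ ())

      -- A generic x adds no element of the support to the span of C and its translate by v.
      grow : ∀ {i} (C : Vec (V m) i) → suc i ≤ suc d → Witness C → ∃ λ x → Witness (x ∷ C)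
      grow {i} C i<d (φ0 , φv) = from (small-value 1 (v ∷ C) (begin
          p ^ suc i ℕ.* (2 ℕ.* q ^ κ)     ≤⟨ ℕ.*-monoʳ-≤ (p ^ suc i) (ℕ.*-monoˡ-≤ (q ^ κ) (ℕ.<⇒≤ 2<p)) ⟩
          p ^ suc i ℕ.* (p ℕ.* q ^ κ)     ≡⟨ ℕ.*-assoc (p ^ suc i) p _ ⟨
          p ^ suc i ℕ.* p ℕ.* q ^ κ       ≡⟨ cong (ℕ._* q ^ κ) (ℕ.*-comm (p ^ suc i) p) ⟩
          p ^ suc (suc i) ℕ.* q ^ κ       ≤⟨ ℕ.*-monoˡ-≤ (q ^ κ) (ℕ.^-monoʳ-≤ p {{ℕ.>-nonZero (ℕ.<-trans (s≤s z≤n) 2<p)}} (s≤s i<d)) ⟩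
          p ^ suc (suc d) ℕ.* q ^ κ       ≡⟨ total ⟩
          q ^ m                           ≡⟨ ℕ.*-identityˡ _ ⟨
          1 ℕ.* q ^ m                     ∎))
        where
        open ℕ.≤-Reasoning
        from : (∃ λ x → φ (v ∷ C) x < 1) → ∃ λ x → Witness (x ∷ C)
        from (x , lt) = x , trans (cong ι (line-at-tangent {φ = φ C} {x} {zeroV} (λ t∈ t≢0 → trans (cong (φ C) (⊕-identityˡ _))
                              (trans (flat-homogeneous C hf t∈ t≢0 x) at-x)))) φ0
                          , λ eq → φv (trans (cong ι (sym (line-at-tangent {φ = φ C} {x} {v} at-v))) eq)
          where
          zero-on : ∀ {t} → t ∈ L → φ C (x ⊕ (t · v)) ≡ 0
          zero-on t∈ = ℕ.n≤0⇒n≡0 (ℕ.≤-trans (term≤∑ (λ t → φ C (x ⊕ (t · v))) t∈) (ℕ.≤-pred lt))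
          at-x : φ C x ≡ 0
          at-x = trans (cong (φ C) (sym (trans (cong (x ⊕_) (·-zeroˡ v)) (⊕-identityʳ x)))) (zero-on (0∈ primeField))
          at-v : ∀ {t} → t ∈ L → t ≢ 0# → φ C (v ⊕ (t · x)) ≡ 0
          -- Write v + t x as t (x + t⁻¹ v): by homogeneity under 𝔽ₚ this reduces to a translate on
          -- the empty flat through x.
          at-v {t} t∈ t≢0 = trans (cong (φ C) (sym (trans (·-distribˡ t x _) (trans (cong ((t · x) ⊕_) (·-inv t≢0 v)) (⊕-comm _ _)))))
            (trans (flat-homogeneous C hf t∈ t≢0 _) (zero-on (inv∈ primeField t∈)))

      witness : ∀ i → i ≤ d → ∃ λ (C : Vec (V m) (suc i)) → Witness C
      witness zero    _   = u ∷ [] , start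
      witness (suc i) i<d = from (witness i (ℕ.<⇒≤ i<d))
        where
        from : (∃ λ (C : Vec (V m) (suc i)) → Witness C) → ∃ λ (C : Vec (V m) (suc (suc i))) → Witness C
        from (C , w) = let x , w′ = grow C (s≤s i<d) w in x ∷ C , w′

      not-closed-impossible : ⊥
      not-closed-impossible = let C , φ0 , φv = witness d ℕ.≤-refl in no-Flat C φ0 v φv

    support-subspace : IsSubspace (λ X → g X ≢ 0#)
    support-subspace = record
      { zero-closed = g0≢0
      ; ⊕-closed    = λ {X} {Y} gX gY eq → not-closed-impossible gY gX eq
      ; ·-closed    = λ a {X} gX eq → by-cases a gX eq (a ≟ 0#) }
      where
      by-cases : ∀ a {X} → g X ≢ 0# → g (a · X) ≡ 0# → Dec (a ≡ 0#) → ⊥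
      by-cases a {X} gX eq (yes a≡0) = g0≢0 (trans (cong g (sym (trans (cong (_· X) a≡0) (·-zeroˡ X)))) eq)
      by-cases a {X} gX eq (no a≢0)  = gX (trans (sym (hg a≢0 X)) eq)

    open Basis (λ X → ¬? (g X ≟ 0#)) support-subspace

    -- A subspace has q^i elements for some i.
    no-intermediate-support : q ^ κ < Nat.∑ⱽ (supp g) → ⊥
    no-intermediate-support many = ℕ.<⇒≱ few (ℕ.≤-trans (ℕ.*-monoˡ-≤ (q ^ κ) 1<q)
      (let B , GB , ind = basis κ (ℕ.<⇒≤ many)
           v , Gv , ind′ = extend ind many
       in independent⇒≤order (Gv VAll.∷ GB) ind′))

-- Codewords of small weight as non-linear minimal blocking sets

light-scaled : ∀ w t q₁ → 7 ℕ.* w < 12 ℕ.* t ℕ.+ 6 → 7 ℕ.* (q₁ ℕ.* w) ≤ 12 ℕ.* (q₁ ℕ.* t) ℕ.+ 5 ℕ.* q₁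
light-scaled w t q₁ lt = begin
  7 ℕ.* (q₁ ℕ.* w)                    ≡⟨ rearrange q₁ w ⟩
  -- Between integers a strict bound by 12 t + 6 is a bound by 12 t + 5; scaling by q₁ produces the
  -- term `5 ℕ.* q₁` of `Light`.
  q₁ ℕ.* (7 ℕ.* w)                    ≤⟨ ℕ.*-monoʳ-≤ q₁ (ℕ.≤-pred (subst (7 ℕ.* w <_) (ℕ.+-suc (12 ℕ.* t) 5) lt)) ⟩
  q₁ ℕ.* (12 ℕ.* t ℕ.+ 5)             ≡⟨ distribute q₁ t ⟩
  12 ℕ.* (q₁ ℕ.* t) ℕ.+ 5 ℕ.* q₁      ∎
  where
  open ℕ.≤-Reasoning
  rearrange : ∀ q₁ w → 7 ℕ.* (q₁ ℕ.* w) ≡ q₁ ℕ.* (7 ℕ.* w)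
  rearrange = solve-∀
  distribute : ∀ q₁ t → q₁ ℕ.* (12 ℕ.* t ℕ.+ 5) ≡ 12 ℕ.* (q₁ ℕ.* t) ℕ.+ 5 ℕ.* q₁
  distribute = solve-∀

light<double : ∀ W K {q₁} → 0 < q₁ → 10 ℕ.* q₁ ≤ K → 7 ℕ.* W ≤ 12 ℕ.* K ℕ.+ 5 ℕ.* q₁ → W < 2 ℕ.* K
light<double W K {suc a} _ K≥ le with ℕ.m≤n⇒∃[o]m+o≡n K≥
... | b , refl = ℕ.*-cancelˡ-< 7 _ _ (ℕ.≤-<-trans le (<-by-slack _ (slack a b)))
  where
  slack : ∀ a b → 12 ℕ.* (10 ℕ.* suc a ℕ.+ b) ℕ.+ 5 ℕ.* suc a ℕ.+ suc (14 ℕ.+ 15 ℕ.* a ℕ.+ 2 ℕ.* b)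
                ≡ 7 ℕ.* (2 ℕ.* (10 ℕ.* suc a ℕ.+ b))
  slack = solve-∀

module SmallWeight {p h : ℕ} (pr : Prime p) (1≤h : 1 ≤ h) (F : FiniteField (p ^ h)) (9≤p : 9 ≤ p) (j k′ : ℕ) where
  k : ℕ
  k = suc k′
  open MinimumWeight pr 1≤h F j k
  open Tangents pr 1≤h F 9≤p using (constant; TangentSpace; tangent-space; blocking-vector; suc-p*q₁≤#*; Light; Light⇒<#*)

  module _ (c : Word n) (cw : Codeword n k c) (θ<w : θ q k < weight c) (w-small : 7 ℕ.* weight c < 12 ℕ.* θ q k ℕ.+ 6) where
    open HomogeneousExtension (codeword-extension c cw)

    W K : ℕ
    W = ∑* (supp g)
    K = #* κ

    light : 7 ℕ.* W ≤ 12 ℕ.* K ℕ.+ 5 ℕ.* q₁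
    light = subst₂ (λ W K → 7 ℕ.* W ≤ 12 ℕ.* K ℕ.+ 5 ℕ.* q₁) weight-supp (q₁*θ k)
                   (light-scaled (weight c) (θ q k) q₁ w-small)

    K<W : K < W
    K<W = subst₂ _<_ (q₁*θ k) weight-supp (ℕ.*-monoʳ-< q₁ θ<w)

    W<2K : W < 2 ℕ.* K
    W<2K = light<double W K 0<q₁ (ℕ.≤-trans (ℕ.*-monoˡ-≤ q₁ (s≤s 9≤p)) (suc-p*q₁≤#* k′)) light

    a : Carrier
    a = g zeroV

    constant-value : ∀ {X} → g X ≢ 0# → g X ≡ a
    constant-value {X} gX≢0 = by-cases (X ≟ⱽ zeroV)
      where
      by-cases : Dec (X ≡ zeroV) → g X ≡ a
      by-cases (yes X≡0) = cong g X≡0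
      by-cases (no X≢0)  = constant j g hg fc-whole gFp light X≢0 gX≢0

    a≢0 : a ≢ 0#
    a≢0 = let X , _ , gX≢0 = nonzero-vector (ℕ.≤-<-trans z≤n θ<w) in λ a≡0 → gX≢0 (trans (constant-value gX≢0) a≡0)

    μ : V (suc n) → ℕ
    μ = supp g

    -- Dividing by the common value turns the word into the indicator of its support, so numbers of
    -- support vectors in flats inherit constancy modulo p.
    ιμ : ∀ X → inv a * g X ≡ ι (μ X)
    ιμ X = by-cases (g X ≟ 0#)
      where
      by-cases : Dec (g X ≡ 0#) → inv a * g X ≡ ι (μ X)
      by-cases (yes gX≡0) = trans (trans (cong (inv a *_) gX≡0) (zeroʳ _)) (sym (cong ι (supp-≡0 g {X} gX≡0)))
      by-cases (no gX≢0)  = trans (trans (cong (inv a *_) (constant-value gX≢0)) (inv-* a≢0))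
                                  (trans (sym ι-1) (cong ι (sym (supp-≢0 g {X} gX≢0))))

    ιμ-flatConstant : ∀ M d → FlatConstant M d g → FlatConstant M d (ι ∘ μ)
    ιμ-flatConstant M d gc = FlatConstant-cong M d ιμ (FlatConstant-*ˡ M d (inv a) gc)

    ιμ≡1 : ∀ {X} → g X ≢ 0# → ι (μ X) ≡ 1#
    ιμ≡1 {X} gX≢0 = trans (cong ι (supp-≢0 g {X} gX≢0)) ι-1

    B : PointSet n
    B v = ¬ (c v ≡ 0#)

    B⇒g : ∀ {v} → Normalized v → B v → g v ≢ 0#
    B⇒g nv Bv gv≡0 = Bv (trans (c≡g _ nv) gv≡0)

    g⇒B : ∀ {v} → Normalized v → g v ≢ 0# → B v
    g⇒B nv gv≢0 cv≡0 = gv≢0 (trans (sym (c≡g _ nv)) cv≡0)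

    -- The dimension is a variable here, which allows `n ∸ k` to be replaced by `suc j` by
    -- substitution.
    Blocks : ℕ → PointSet n → Set
    Blocks d B = ∀ (S : Subspace n d) → Σ (Vect n) λ v → Normalized v × B v × v ∈S S

    codimension : n ℕ.∸ k ≡ suc j
    codimension = trans (cong (ℕ._∸ k) (ℕ.+-suc j k)) (ℕ.m+n∸n≡m (suc j) k)

    blocking : IsBlockingSet n k B
    blocking = subst (λ d → Blocks d B) (sym codimension) (λ S →
      let s , s≢0 , ≢0 = blocking-vector (suc j) fc-whole a≢0 (Subspace.basis S)
          b , b≢0 , nv = normalize (λ eq → s≢0 (Subspace.independent S s eq))
      in b · lincomb s (Subspace.basis S) , nv
       , g⇒B nv (λ eq → ≢0 (trans (sym (hg b≢0 _)) eq))
       , (b · s , sym (lincomb-· b s (Subspace.basis S))))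

    -- A tangent (n - k)-space at v meets B in v alone, so a blocking subset of B has to contain v.
    minimal : ∀ (B′ : PointSet n) → B′ ⊆P B → IsBlockingSet n k B′ → B ⊆P B′
    minimal B′ B′⊆B blocking′ v nv Bv = from (subst (λ d → Blocks d B′) codimension blocking′ S)
      where
      tangent : ∃ λ (b : Vec (V (suc n)) (suc j)) → TangentSpace μ v b
      tangent = tangent-space (suc j) μ (supp-homogeneous hg) (ιμ-flatConstant whole (suc j) fc-whole) (ιμ≡1 a≢0)
        (Light⇒<#* {κ = κ} {f = supp g} ℕ.≤-refl light)
        (ℕ.<-≤-trans W<2K (ℕ.*-monoˡ-≤ K (ℕ.≤-trans (s≤s (s≤s z≤n)) 9≤p)))
        (normalized⇒≢0 nv) (ιμ≡1 (B⇒g nv Bv))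
      b = proj₁ tangent
      μ-pos : ∀ {X} → g X ≢ 0# → 0 < μ X
      μ-pos {X} gX≢0 = ℕ.≤-reflexive (sym (supp-≢0 g {X} gX≢0))
      independent : Independent (v ∷ b)
      independent (t ∷ s) eq = cong₂ _∷_ t≡0 s≡0
        where
        s≡0 : s ≡ zeroV
        s≡0 = proj₂ tangent t s (μ-pos (λ ≡0 → a≢0 (trans (cong g (sym eq)) ≡0)))
        tv≡0 : t · v ≡ zeroV
        tv≡0 = trans (sym (trans (cong ((t · v) ⊕_) (trans (cong (λ s → lincomb s b) s≡0) (lincomb-zero b))) (⊕-identityʳ _))) eq
        t≡0 : t ≡ 0#
        t≡0 = decidable-stable (t ≟ 0#) (λ t≢0 → ·-≢0 t≢0 (normalized⇒≢0 nv) tv≡0)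
      S : Subspace n (suc j)
      S = record { basis = v ∷ b ; independent = independent }
      from : (Σ (Vect n) λ w → Normalized w × B′ w × w ∈S S) → B′ v
      from (w , nw , B′w , (t ∷ s , w≡)) = subst B′ (normalized-unique t nw nv w≡tv) B′w
        where
        s≡0 : s ≡ zeroV
        s≡0 = proj₂ tangent t s (subst (λ x → 0 < μ x) w≡ (μ-pos (B⇒g nw (B′⊆B w nw B′w))))
        w≡tv : w ≡ t · v
        w≡tv = trans w≡ (trans (cong ((t · v) ⊕_) (trans (cong (λ s → lincomb s b) s≡0) (lincomb-zero b))) (⊕-identityʳ _))

    scalar-multiple : ScalarMultipleOfIncidence c B
    scalar-multiple = a , gFp zeroV , a≢0 , λ v nv →
      (λ Bv → trans (c≡g v nv) (constant-value (B⇒g nv Bv))) , λ ¬Bv → decidable-stable (c v ≟ 0#) ¬Bv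

    ∑-μ : Nat.∑ⱽ μ ≡ suc W
    ∑-μ = trans (sym (∑*-split μ)) (trans (cong (W ℕ.+_) (supp-≢0 g {zeroV} a≢0)) (ℕ.+-comm W 1))

    q^κ<∑-μ : q ^ κ < Nat.∑ⱽ μ
    q^κ<∑-μ = subst₂ _<_ (suc-#* κ) (sym ∑-μ) (s≤s K<W)

    ∑-μ<2q^κ : Nat.∑ⱽ μ < 2 ℕ.* q ^ κ
    ∑-μ<2q^κ = subst₂ _<_ (sym ∑-μ) (trans (sym (ℕ.*-suc 2 K)) (cong (2 ℕ.*_) (suc-#* κ)))
      (s≤s (ℕ.<-trans W<2K (ℕ.n<1+n _)))

    -- Over the prime field a linear set is a subspace, which has only θ_k points.
    non-linear-prime : h ≡ 1 → ¬ IsLinearBlockingSet h n k B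
    non-linear-prime h≡1 (_ , U , B⇔BU) = ℕ.<⇒≱ q^κ<∑-μ (begin
      Nat.∑ⱽ μ                          ≤⟨ ∑-mono (allVecs (suc n)) (λ {X} _ → by-cases X (g X ≟ 0#)) ⟩
      Nat.∑ⱽ (incidence basis)          ≡⟨ ∑-incidence basis ⟩
      q ^ suc (h ℕ.* k)                 ≡⟨ cong (λ i → q ^ suc (i ℕ.* k)) h≡1 ⟩
      q ^ suc (1 ℕ.* k)                 ≡⟨ cong (λ i → q ^ suc i) (ℕ.*-identityˡ k) ⟩
      q ^ κ                             ∎)
      where
      open ℕ.≤-Reasoning
      open FpSubspace U using (basis)
      in-span : ∀ X → g X ≢ 0# → Dec (X ≡ zeroV) → ∃ λ s → X ≡ lincomb s basis
      in-span X gX≢0 (yes X≡0) = zeroV , trans X≡0 (sym (lincomb-zero basis))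
      in-span X gX≢0 (no X≢0) =
        let b , b≢0 , nv = normalize X≢0
            d , d≢0 , s , _ , eq = proj₁ (B⇔BU (b · X) nv) (g⇒B nv (λ ≡0 → gX≢0 (trans (sym (hg b≢0 X)) ≡0)))
        in inv b · (inv d · s) , trans (sym (inv-· b≢0 X)) (trans (cong (inv b ·_) (trans (sym (inv-· d≢0 _))
             (trans (cong (inv d ·_) eq) (sym (lincomb-· (inv d) s basis))))) (sym (lincomb-· (inv b) (inv d · s) basis)))
      by-cases : ∀ X → Dec (g X ≡ 0#) → μ X ≤ incidence basis X
      by-cases X (yes gX≡0) = ℕ.≤-trans (ℕ.≤-reflexive (supp-≡0 g {X} gX≡0)) z≤n
      by-cases X (no gX≢0)  = let s , X≡ = in-span X gX≢0 (X ≟ⱽ zeroV) in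
        ℕ.≤-trans (δ≤1 (¬? (g X ≟ 0#))) (subst (λ Y → 0 < incidence basis Y) (sym X≡) (incidence≥1 basis s))

    -- For h ≥ 2 there are 2 + d = h (n - k) generators over 𝔽ₚ, and the support would be a subspace
    -- with strictly between q^κ and 2 q^κ vectors. So no codeword of the given weight exists and
    -- non-linearity holds vacuously.
    impossible-extension : 2 ≤ h → ⊥
    impossible-extension 2≤h = from (ℕ.m≤n⇒∃[o]m+o≡n (ℕ.≤-trans 2≤h (ℕ.m≤m*n h (suc j))))
      where
      from : (∃ λ d → 2 ℕ.+ d ≡ h ℕ.* suc j) → ⊥
      from (d , eq) = PrimeFlats.Closed.no-intermediate-support pr 1≤h F {d = d} {κ} g hg a≢0 total prime-flats
                        ∑-μ<2q^κ (ℕ.≤-trans (s≤s (s≤s (s≤s z≤n))) 9≤p) q^κ<∑-μ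
        where
        total : p ^ suc (suc d) ℕ.* q ^ κ ≡ q ^ suc n
        total = trans (cong (λ D → p ^ D ℕ.* q ^ κ) eq) (trans (cong (ℕ._* q ^ κ) (sym (ℕ.^-*-assoc p h (suc j))))
          (sym (ℕ.^-distribˡ-+-* q (suc j) κ)))
        prime-flats : ∀ (C : Vec (V (suc n)) (suc (suc d))) X →
                      ι (Nat.flat (list primeField) C μ X) ≡ ι (Nat.flat (list primeField) C μ zeroV)
        prime-flats C X = trans (ι-flat (list primeField) C μ X) (trans
          (ιμ-flatConstant primeField (suc (suc d))
            (fc primeField (suc (suc d)) (trans (cong (λ l → l ^ suc (suc d) ℕ.* q ^ κ) length-primeField) total)) C X)
          (sym (ι-flat (list primeField) C μ zeroV)))

    non-linear : ¬ IsLinearBlockingSet h n k B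
    non-linear = by-cases (h ℕ.≟ 1)
      where
      by-cases : Dec (h ≡ 1) → ¬ IsLinearBlockingSet h n k B
      by-cases (yes h≡1) = non-linear-prime h≡1
      by-cases (no h≢1)  = λ _ → impossible-extension (ℕ.≤∧≢⇒< 1≤h (λ 1≡h → h≢1 (sym 1≡h)))

    small-weight : Σ (PointSet n) λ B → IsMinimalBlockingSet n k B ×
                   ¬ IsLinearBlockingSet h n k B × ScalarMultipleOfIncidence c B
    small-weight = B , (blocking , minimal) , non-linear , scalar-multiple

open import Data.Nat using (_+_; _*_; _∸_)

-- With j = n - k - 1 the vector space dimension n + 1 takes the form `suc j + suc k`, on which the
-- inductions by projection run.
codimension : ∀ {n k} → 2 ≤ n → k ≤ n ∸ 1 → ∃ λ j → j + suc k ≡ n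
codimension {suc n} {k} _ k≤n = n ∸ k , ℕ.m∸n+n≡m (s≤s k≤n)

theorem4p13 : (p h n k : ℕ) → Prime p → 1 ≤ h → 2 ≤ n → 1 ≤ k → k ≤ n ∸ 1 →
    (F : FiniteField (p ^ h)) →
    let open Geometry F in
    (n ≤ 2 * k → 7 < p → ∀ (c : Word n) → Codeword n k c →
    θ (p ^ h) k < weight c → 7 * weight c < 12 * θ (p ^ h) k + 6 →
    Σ (PointSet n) λ B → IsMinimalBlockingSet n k B ×
    ¬ IsLinearBlockingSet h n k B × ScalarMultipleOfIncidence c B)
    ×
    ((∀ (c : Word n) → Codeword n k c → ¬ (weight c ≡ 0) → θ (p ^ h) k ≤ weight c)
    × (Σ (Word n) λ c → Codeword n k c × weight c ≡ θ (p ^ h) k)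
    × (∀ (c : Word n) → Codeword n k c → weight c ≡ θ (p ^ h) k →
    Σ (Subspace n k) λ S → ScalarMultipleOfIncidence c (λ v → v ∈S S)))
theorem4p13 p h n (suc k′) pr 1≤h 2≤n 1≤k k≤n-1 F with codimension 2≤n k≤n-1
... | j , refl =
  (λ _ 7<p c cw θ<w small → SmallWeight.small-weight pr 1≤h F (prime>7⇒≥9 pr 7<p) j k′ c cw θ<w small)
  , θ≤weight , subspace-word , minimum-weight-words
  where open MinimumWeight pr 1≤h F j (suc k′)
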